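{- Let $1\le n<m$ and let $A=(a_{ij})_{m\times m}$ be a Cartier-Foata matrix ($a_{ik}a_{jl}=a_{jl}a_{ik}$ for all $i\ne j$ and all $k,l$). Let $C=(c_{ij})_{n+1\le i,j\le m}$ with $$c_{ij}=-\det{}^{ -1}(I-A_0)\cdot\det\begin{pmatrix} I-A_0 & -a_{*j}\\ -a_{i*} & -a_{ij}\end{pmatrix}.$$ Then for every $\beta\in\mathbb C$, $$\Big(\frac1{\det(I-C)}\Big)^{\beta}=\sum_\mu e_\mu(\beta)\,a_{\lambda,\mu},$$ where $\mu$ runs over all words in the alphabet $\{1,\dots,m\}$, $\lambda$ is the non-decreasing rearrangement of $\mu$, and $e_\mu(\beta)$ is computed as follows. Let $u_1u_2\cdots u_k$ be the disjoint cycle decomposition of $a_{\lambda,\mu}$, let $\mathcal J$ be the set of $i\in\{1,\dots,k\}$ such that $u_i$ contains a height $>n$, and $l=|\mathcal J|$. Then $$e_\mu(\beta)=\sum_\pi\binom{\beta+l-1-d(\pi)}{l},$$ where $d(\pi)$ is the number of descents of the subword of $\pi(1)\pi(2)\cdots\pi(k)$ consisting of the letters $\pi(i)\in\mathcal J$, and the sum is over all $\pi\in S_k$ such that: (1) if $i<j$ and $\pi(i)>\pi(j)$, then $u_{\pi(i)}$ and $u_{\pi(j)}$ are disjoint; (2) for each $i=1,\dots,k$ there exists $j\ge i$ with $\pi(j)\in\mathcal J$; (3) if $j\ge i$ is minimal with $\pi(j)\in\mathcal J$ and $j>i$, then there exists $k'$ with $i<k'\le j$ such that $u_{\pi(i)}$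 and $u_{\pi(k')}$ are not disjoint; (4) if $\pi(i)>\pi(i+1)$ then $\pi(i)\in\mathcal J$.
   Context: $\mathcal A$ is the $\mathbb C$-algebra of formal power series in non-commuting variables $a_{ij}$, $1\le i,j\le m$; identities hold in the quotient by the closed two-sided ideal generated by the Cartier-Foata relations. $A_0=(a_{ij})_{1\le i,j\le n}$, $a_{i*}=(a_{i1},\dots,a_{in})$, $a_{*j}=(a_{1j},\dots,a_{nj})^T$; $\det B=\sum_{\sigma\in S_N}(-1)^{\operatorname{inv}\sigma}b_{\sigma(1)1}\cdots b_{\sigma(N)N}$, and $\det(I-C)$ is computed by this formula with the $c_{ij}$ as entries; $\det^{ -1}$ denotes the inverse of an element with constant term $1$. Writing $\det(I-C)=1-\Sigma$ with $\Sigma$ without constant term, $(1/\det(I-C))^\beta:=\sum_{r\ge0}\binom{\beta+r-1}{r}\Sigma^r$. Words: $a_{\lambda,\mu}=a_{\lambda_1\mu_1}\cdots a_{\lambda_\ell\mu_\ell}$; the letter $a_{ij}$ is viewed as a step from height $i$ to height $j$, and a word as a sequence of steps. An ordered sequence (o-sequence) is a word $a_{\lambda,\mu}$ with $\lambda$ non-decreasing and $\mu$ a rearrangement of $\lambda$. The map $\varphi$: given an o-sequence $\alpha$, for $h=1,\dots,m$ in turn build a walk $W_h$ starting at height $h$ by repeatedly appending, from the current height $c$, the first not-yet-used step of $\alpha$ (in the order of $\alpha$) that starts at $c$, until no unused step starts at the current height; $\varphi(\alpha)=W_1W_2\cdots W_m$. Disjoint cycle decomposition: set $\gamma=\varphi(a_{\lambda,\mu})$;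 while $\gamma$ is nonempty, let $v_0,v_1,v_2,\dots$ be the starting height of its first step followed by the ending heights of its successive steps, let $t$ be the least index with $v_t=v_s$ for some $s<t$; the steps $s+1,\dots,t$ form a cycle $v_s\to v_{s+1}\to\dots\to v_t=v_s$ with distinct starting heights; record it as the next $u_i$ and delete these steps from $\gamma$. The result is the list $u_1,\dots,u_k$. Two cycles are disjoint if their sets of starting heights are disjoint. A descent of a word $x_1\cdots x_r$ is an index $s$ with $x_s>x_{s+1}$. -}

module Defs where

open import Level using (0ℓ)
open import Algebra.Bundles using (CommutativeRing)
open import Data.Nat as ℕ using (ℕ; zero; suc; _≤_; _<_; _∸_)
open import Data.Nat.Properties using (m+[n∸m]≡n; <⇒≤)
open import Data.Fin as Fin using (Fin; toℕ)
open import Data.Fin.Properties as FinP using ()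
open import Data.Bool using (Bool; true; false; _∧_; _∨_; not; if_then_else_)
open import Data.Maybe using (Maybe; just; nothing)
import Data.Maybe as Maybe
import Data.Bool
open import Data.List using (List; []; _∷_; _++_; map; length; filter; concatMap;
  replicate; allFin; upTo; take; drop; foldr; zip; lookup)
open import Data.Bool.ListAction using (any; all)
import Data.List.Properties as ListP
import Data.Product.Properties as ProdP
open import Data.Product using (_×_; _,_; proj₁; proj₂)
open import Relation.Binary.PropositionalEquality using (_≡_; _≢_)
open import Relation.Nullary.Decidable using (⌊_⌋)

natR : (R : CommutativeRing 0ℓ 0ℓ) → ℕ → CommutativeRing.Carrier R
natR R zero    = CommutativeRing.0# R
natR R (suc k) = CommutativeRing._+_ R (CommutativeRing.1# R) (natR R k)

record QAlgebra : Set₁ where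
  field
    R          : CommutativeRing 0ℓ 0ℓ
  open CommutativeRing R
  field
    invSuc     : ℕ → Carrier
    invSuc-inv : ∀ k → natR R (suc k) * invSuc k ≈ 1#

-- Formal power series in the non-commuting variables a_ij (1 ≤ i,j ≤ m),
-- heights being represented by Fin m (height h+1 ↔ element h).

module Series (K : QAlgebra) (m : ℕ) where
  open QAlgebra K using (R; invSuc)
  open CommutativeRing R

  Letter : Set
  Letter = Fin m × Fin m          -- the letter a_ij, a step from i to j

  Word : Set
  Word = List Letter

  _≟L_ : (x y : Letter) → Bool
  x ≟L y = ⌊ ProdP.≡-dec FinP._≟_ FinP._≟_ x y ⌋

  _==W_ : (u v : Word) → Bool
  u ==W v = ⌊ ListP.≡-dec (ProdP.≡-dec FinP._≟_ FinP._≟_) u v ⌋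

  -- a formal power series = its coefficient function on words
  Ser : Set
  Ser = Word → Carrier

  sumR : List Carrier → Carrier
  sumR = foldr _+_ 0#

  ind : Bool → Carrier
  ind b = if b then 1# else 0#

  zeroS oneS : Ser
  zeroS w = 0#
  oneS w = ind ([] ==W w)

  _+S_ _-S_ : Ser → Ser → Ser
  (f +S g) w = f w + g w
  (f -S g) w = f w - g w

  -S_ : Ser → Ser
  (-S f) w = - f w

  scaleS : Carrier → Ser → Ser
  scaleS c f w = c * f w

  splits : Word → List (Word × Word)
  splits []      = ([] , []) ∷ []
  splits (x ∷ w) = ([] , x ∷ w) ∷ map (λ p → (x ∷ proj₁ p , proj₂ p)) (splits w)

  _*S_ : Ser → Ser → Ser
  (f *S g) w = sumR (map (λ p → f (proj₁ p) * g (proj₂ p)) (splits w))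

  powS : Ser → ℕ → Ser
  powS f zero    = oneS
  powS f (suc r) = f *S powS f r

  letter : Fin m → Fin m → Ser
  letter i j w = ind (((i , j) ∷ []) ==W w)

  -- inverse of a series with constant term 1:  1/f = Σ_r (1 - f)^r
  -- (the coefficient of a word w only receives contributions with r ≤ |w|)
  invS : Ser → Ser
  invS f w = sumR (map (λ r → powS (oneS -S f) r w) (upTo (suc (length w))))

  falling : Carrier → ℕ → Carrier
  falling x zero    = 1#
  falling x (suc l) = falling x l * (x - natR R l)

  invFact : ℕ → Carrier
  invFact zero    = 1#
  invFact (suc l) = invFact l * invSuc l

  binomR : Carrier → ℕ → Carrier
  binomR x l = falling x l * invFact l

  -- (1/(1 - Σ))^β = Σ_r binom(β+r-1, r) Σ^r   (Σ without constant term)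
  powβ : Carrier → Ser → Ser
  powβ β s w = sumR (map (λ r → binomR (β + natR R r - 1#) r * powS s r w)
                         (upTo (suc (length w))))

  insertAll : {A : Set} → A → List A → List (List A)
  insertAll x []       = (x ∷ []) ∷ []
  insertAll x (y ∷ ys) = (x ∷ y ∷ ys) ∷ map (y ∷_) (insertAll x ys)

  perms : {A : Set} → List A → List (List A)
  perms []       = [] ∷ []
  perms (x ∷ xs) = concatMap (insertAll x) (perms xs)

  _<ᵇF_ : {N : ℕ} → Fin N → Fin N → Bool
  x <ᵇF y = ⌊ x Fin.<? y ⌋

  inversions : {N : ℕ} → List (Fin N) → ℕ
  inversions []       = 0
  inversions (x ∷ xs) = length (filter (λ y → y Fin.<? x) xs) ℕ.+ inversions xs

  signR : ℕ → Carrier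
  signR zero    = 1#
  signR (suc k) = - signR k

  prodS : List Ser → Ser
  prodS = foldr _*S_ oneS

  -- det B = Σ_σ (-1)^{inv σ} b_{σ(1)1} ⋯ b_{σ(N)N}
  detS : {N : ℕ} → (Fin N → Fin N → Ser) → Ser
  detS {N} B = foldr _+S_ zeroS
    (map (λ σ → scaleS (signR (inversions σ))
                  (prodS (map (λ p → B (proj₁ p) (proj₂ p)) (zip σ (allFin N)))))
         (perms (allFin N)))

  kronS : {N : ℕ} → Fin N → Fin N → Ser
  kronS i j = if ⌊ i FinP.≟ j ⌋ then oneS else zeroS

  module Matrices (n : ℕ) (n<m : n < m) where
    inj : Fin n → Fin m
    inj i = Fin.inject≤ i (<⇒≤ n<m)

    emb : Fin (m ∸ n) → Fin m
    emb p = Fin.cast (m+[n∸m]≡n (<⇒≤ n<m)) (n Fin.↑ʳ p)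

    I-A₀ : Fin n → Fin n → Ser
    I-A₀ i j = kronS i j -S letter (inj i) (inj j)

    toInner : {N : ℕ} → Fin (suc N) → Maybe (Fin N)
    toInner {zero}  Fin.zero    = nothing
    toInner {suc N} Fin.zero    = just Fin.zero
    toInner {suc N} (Fin.suc i) = Maybe.map Fin.suc (toInner i)

    block : Fin m → Fin m → Fin (suc n) → Fin (suc n) → Ser
    block i j r s with toInner r | toInner s
    ... | just r' | just s' = I-A₀ r' s'
    ... | just r' | nothing = -S letter (inj r') j
    ... | nothing | just s' = -S letter i (inj s')
    ... | nothing | nothing = -S letter i j

    c : Fin m → Fin m → Ser
    c i j = -S (invS (detS I-A₀) *S detS (block i j))

    I-C : Fin (m ∸ n) → Fin (m ∸ n) → Ser
    I-C p q = kronS p q -S c (emb p) (emb q)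

    -- (1/det(I-C))^β  with  det(I-C) = 1 - Σ
    lhs : Carrier → Ser
    lhs β = powβ β (oneS -S detS I-C)

  mkWord : List (Fin m) → List (Fin m) → Word
  mkWord = zip

  count : Fin m → List (Fin m) → ℕ
  count h μ = length (filter (λ x → h FinP.≟ x) μ)

  sortW : List (Fin m) → List (Fin m)
  sortW μ = concatMap (λ h → replicate (count h μ) h) (allFin m)

  takeFirstFrom : Fin m → List Letter → Maybe (Letter × List Letter)
  takeFirstFrom c [] = nothing
  takeFirstFrom c (s ∷ ss) with ⌊ proj₁ s FinP.≟ c ⌋
  ... | true  = just (s , ss)
  ... | false = Maybe.map (λ p → (proj₁ p , s ∷ proj₂ p)) (takeFirstFrom c ss)

  walk : ℕ → Fin m → List Letter → Word × List Letter
  walk zero c rest = ([] , rest)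
  walk (suc f) c rest with takeFirstFrom c rest
  ... | nothing = ([] , rest)
  ... | just (s , rest') with walk f (proj₂ s) rest'
  ...   | (w , r) = (s ∷ w , r)

  φ : Word → Word
  φ α = go (allFin m) α
    where
      go : List (Fin m) → List Letter → Word
      go []       rest = []
      go (h ∷ hs) rest with walk (length α) h rest
      ... | (w , r) = w ++ go hs r

  indexOf : Fin m → List (Fin m) → Maybe ℕ
  indexOf v [] = nothing
  indexOf v (x ∷ xs) with ⌊ x FinP.≟ v ⌋
  ... | true  = just 0
  ... | false = Maybe.map suc (indexOf v xs)

  firstRep : List (Fin m) → Maybe (ℕ × ℕ)
  firstRep vs = go [] 0 vs
    where
      go : List (Fin m) → ℕ → List (Fin m) → Maybe (ℕ × ℕ)
      go seen t [] = nothing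
      go seen t (v ∷ rest) with indexOf v seen
      ... | just s  = just (s , t)
      ... | nothing = go (seen ++ (v ∷ [])) (suc t) rest

  heights : Word → List (Fin m)
  heights []         = []
  heights (s ∷ ss)   = proj₁ s ∷ map proj₂ (s ∷ ss)

  decompose : ℕ → Word → List Word
  decompose zero    γ = []
  decompose (suc f) [] = []
  decompose (suc f) (x ∷ γ) with firstRep (heights (x ∷ γ))
  ... | nothing       = []
  ... | just (s , t)  =
        take (t ∸ s) (drop s (x ∷ γ)) ∷
        decompose f (take s (x ∷ γ) ++ drop t (x ∷ γ))

  cycles : List (Fin m) → List Word
  cycles μ = decompose (length μ) (φ (mkWord (sortW μ) μ))

  module Coeff (n : ℕ) (μ : List (Fin m)) where
    u : List Word
    u = cycles μ

    k : ℕ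
    k = length u

    cyc : Fin k → Word
    cyc = lookup u

    -- u_p contains a height > n   (height toℕ h + 1 > n  ⟺  toℕ h ≥ n)
    inJ : Fin k → Bool
    inJ p = any (λ s → ⌊ n ℕ.≤? toℕ (proj₁ s) ⌋ ∨ ⌊ n ℕ.≤? toℕ (proj₂ s) ⌋) (cyc p)

    l : ℕ
    l = length (filter (λ p → inJ p Data.Bool.≟ true) (allFin k))

    disj : Fin k → Fin k → Bool
    disj p q = not (any (λ s → any (λ s' → ⌊ proj₁ s FinP.≟ proj₁ s' ⌋) (cyc q)) (cyc p))

    cond1 : List (Fin k) → Bool
    cond1 []       = true
    cond1 (x ∷ xs) = all (λ y → not (y <ᵇF x) ∨ disj x y) xs ∧ cond1 xs

    cond2 : List (Fin k) → Bool
    cond2 []       = true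
    cond2 (x ∷ xs) = any inJ (x ∷ xs) ∧ cond2 xs

    takeThroughJ : List (Fin k) → List (Fin k)
    takeThroughJ []       = []
    takeThroughJ (y ∷ ys) = if inJ y then y ∷ [] else y ∷ takeThroughJ ys

    cond3 : List (Fin k) → Bool
    cond3 []       = true
    cond3 (x ∷ xs) =
      (inJ x ∨ not (any inJ xs) ∨ any (λ y → not (disj x y)) (takeThroughJ xs))
      ∧ cond3 xs

    cond4 : List (Fin k) → Bool
    cond4 []           = true
    cond4 (x ∷ [])     = true
    cond4 (x ∷ y ∷ xs) = (not (y <ᵇF x) ∨ inJ x) ∧ cond4 (y ∷ xs)

    descents : List (Fin k) → ℕ
    descents []           = 0
    descents (x ∷ [])     = 0
    descents (x ∷ y ∷ xs) = (if y <ᵇF x then 1 else 0) ℕ.+ descents (y ∷ xs)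

    d : List (Fin k) → ℕ
    d π = descents (filter (λ p → inJ p Data.Bool.≟ true) π)

    e : Carrier → Carrier
    e β = sumR (map (λ π → if cond1 π ∧ cond2 π ∧ cond3 π ∧ cond4 π
                             then binomR (β + natR R l - 1# - natR R (d π)) l
                             else 0#)
                    (perms (allFin k)))

  -- Σ_μ e_μ(β) a_{λ,μ}: the coefficient of w is e_μ(β) if w = a_{λ,μ}
  -- (then μ is the sequence of end heights of w), and 0 otherwise
  rhs : ℕ → Carrier → Ser
  rhs n β w with mkWord (sortW (map proj₂ w)) (map proj₂ w) ==W w
  ... | true  = Coeff.e n (map proj₂ w) β
  ... | false = 0#

  -- equality in the quotient by the closed ideal generated by the
  -- Cartier–Foata relations a_ik a_jl = a_jl a_ik (i ≠ j)

  record Gen : Set where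
    field
      coef   : Carrier
      left   : Word
      x y    : Letter
      right  : Word
      rows≢  : proj₁ x ≢ proj₁ y

  evalGen : Word → Gen → Carrier
  evalGen w g = coef * (ind ((left ++ x ∷ y ∷ right) ==W w)
                        - ind ((left ++ y ∷ x ∷ right) ==W w))
    where open Gen g

  -- f - g lies in the closure of the ideal: for every N it agrees, on all
  -- words of length ≤ N, with an element of the (algebraic) ideal
  _≈CF_ : Ser → Ser → Set
  f ≈CF g = (N : ℕ) → Σ (List Gen) λ gs →
            (w : Word) → length w ≤ N → f w - g w ≈ sumR (map (evalGen w) gs)
    where open import Data.Product using (Σ)

{-# OPTIONS --safe #-}
module Submission where

-- In the quotient a word is determined by its rows, so series become functions
-- on words, multiplied by summing over the ways to write a word as a product
-- up to commutation.  Write G_S for the sum of all balanced words with rows in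
-- S (each height starts and ends equally many steps), D_S = det (I - A)_S, and
-- G, D when S contains all heights.  Popping the first
-- letter of a row gives linear equations between the series counting paths;
-- Cramer's rule turns them into D_S G_S = 1 (MacMahon), and column operations
-- give D = D_S det(I - C) for S = {1,…,n} (Sylvester).  Hence 1/det(I - C) is
-- g = G D_S, and (1/det(I - C))^r = g^r for natural r.
--
-- A factorisation of a balanced word into balanced words is the same as a
-- factorisation of the heap of its cycles, so g^r can be computed on sequences
-- of cycles.  There g counts the orders satisfying (1)-(4) without a descent
-- among the cycles of 𝒥: each heap has exactly one order in which every cycle
-- outside 𝒥 stands in front of the first 𝒥-segment it meets, or after all of
-- them, because the cycle with the smallest label can be inserted in exactly
-- one place.  Cutting an order into r blocks without descent then shows that
-- e_μ(r) is the coefficient of g^r, and both sides are polynomials in β.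

open import Defs
open import Level using (0ℓ)
open import Algebra.Bundles using (CommutativeRing; RawRing; Ring)
open import Data.Nat as ℕ using (ℕ; zero; suc; _≤_; _<_; _∸_; z≤n; s≤s)
import Data.Nat.Properties as ℕP
open import Data.Bool as Bool using (Bool; true; false; _∧_; _∨_; not; if_then_else_)
open import Data.Bool.ListAction using (any; all)
open import Data.Bool.Properties using (∧-assoc; ∧-zeroʳ; ∨-identityʳ; ∨-zeroʳ)
open import Data.Empty using (⊥; ⊥-elim)
open import Data.Fin as Fin using (Fin; toℕ)
import Data.Fin.Properties as FinP
open import Data.List using (List; []; _∷_; [_]; _++_; allFin; applyUpTo; cartesianProduct;
  concat; concatMap; drop; filter; foldr; length; map; null; replicate; take; upTo; zip)
import Data.List.Properties as ListP
open import Data.List.Membership.DecPropositional using (_∈?_)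
open import Data.List.Membership.Propositional using (_∈_)
import Data.List.Membership.Propositional.Properties as MemP
open import Data.List.Relation.Binary.Permutation.Propositional as Perm using (_↭_)
import Data.List.Relation.Binary.Permutation.Propositional.Properties as PermP
import Data.List.Relation.Binary.Permutation.Setoid.Properties as PermSetoidP
open import Data.List.Relation.Ternary.Interleaving.Propositional as Int
  using (Interleaving; []; consˡ; consʳ)
open import Data.List.Relation.Unary.All as All using (All; []; _∷_)
import Data.List.Relation.Unary.All.Properties as AllP
open import Data.List.Relation.Unary.AllPairs as AllPairs using (AllPairs; []; _∷_)
import Data.List.Relation.Unary.AllPairs.Properties as AllPairsP
open import Data.List.Relation.Unary.Any using (Any; here; there)
open import Data.List.Relation.Unary.Unique.Propositional using (Unique)
import Data.List.Relation.Unary.Unique.Propositional.Properties as UniqueP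
open import Data.List.Reverse using (Reverse; []; _∶_∶ʳ_; reverseView)
open import Data.Maybe as Maybe using (Maybe; just; nothing; maybe′)
open import Data.Product using (_×_; _,_; proj₁; proj₂; ∃; ∃₂)
import Data.Product.Properties as ProdP
open import Data.Sum using (_⊎_; inj₁; inj₂)
open import Function using (_∘_)
open import Relation.Binary.PropositionalEquality as ≡ using (_≡_; _≢_)
open import Relation.Nullary using (Dec; yes; no; ¬_)
open import Relation.Nullary.Decidable using (⌊_⌋; _×-dec_)

-- Entries of I - A commute only across rows, so determinants keep their columns in a fixed order
-- and column operations multiply on the right: the coefficient is absorbed by the factors behind
-- it, and the repeated column then cancels because its entries in distinct rows commute. No
-- bijection is set up between orders and the terms of g. Let X sum the orders with (2)-(4) and
-- increasing 𝒥-labels, and Y the increasing orders of cycles outside 𝒥. The uniqueness of the order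
-- in each heap says that X times Y counts every heap once. As Y projects to G_S with S = {1,...,n},
-- multiplying by D_S gives X = G D_S. Condition (1) only says that an order arises from 1 2 ... k
-- by commuting disjoint cycles. Of the cycle decomposition two facts enter: each u_i is a simple
-- cycle, and the product of the u_i is a_{λ,μ} up to commutation. Natural exponents suffice because
-- positive integers are invertible in the coefficient ring, so a polynomial vanishing at all of
-- them is zero. In the quotient, explicit generators sort all words up to a given length; the
-- right-hand side is already supported on sorted words.

-- Solving ring equations with integer coefficients

module RingSolving (R : CommutativeRing 0ℓ 0ℓ) where
  open CommutativeRing R
  open import Algebra.Properties.Ring ring
  open import Relation.Binary.Reasoning.Setoid setoid
  open import Algebra.Properties.Semiring.Mult semiring
    using () renaming (_×_ to _·_; ×-homo-+ to ·-homo-+; ×1-homo-* to ·1-homo-*)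
  open import Algebra.Properties.CommutativeSemigroup +-commutativeSemigroup
    using (interchange)
  open import Algebra.Solver.Ring.AlmostCommutativeRing
    using (AlmostCommutativeRing; fromCommutativeRing; _-Raw-AlmostCommutative⟶_)

  natR≈· : ∀ n → natR R n ≈ n · 1#
  natR≈· zero    = refl
  natR≈· (suc n) = +-congˡ (natR≈· n)

  natR-+ : ∀ a b → natR R (a ℕ.+ b) ≈ natR R a + natR R b
  natR-+ a b = begin
    natR R (a ℕ.+ b)        ≈⟨ natR≈· (a ℕ.+ b) ⟩
    (a ℕ.+ b) · 1#          ≈⟨ ·-homo-+ 1# a b ⟩
    a · 1# + b · 1#         ≈⟨ +-cong (natR≈· a) (natR≈· b) ⟨
    natR R a + natR R b     ∎

  natR-* : ∀ a b → natR R (a ℕ.* b) ≈ natR R a * natR R b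
  natR-* a b = begin
    natR R (a ℕ.* b)        ≈⟨ natR≈· (a ℕ.* b) ⟩
    (a ℕ.* b) · 1#          ≈⟨ ·1-homo-* a b ⟩
    (a · 1#) * (b · 1#)     ≈⟨ *-cong (natR≈· a) (natR≈· b) ⟨
    natR R a * natR R b     ∎

  -- Integer coefficients are pairs (a , b) standing for a - b, kept reduced
  -- because the solver compares coefficients definitionally.
  diff : ℕ × ℕ → Carrier
  diff (a , b) = natR R a - natR R b

  reduce : ℕ × ℕ → ℕ × ℕ
  reduce (suc a , suc b) = reduce (a , b)
  reduce p               = p

  coefficients : RawRing 0ℓ 0ℓ
  coefficients = record
    { Carrier = ℕ × ℕ
    ; _≈_     = _≡_
    ; _+_     = λ (a , b) (c , d) → reduce (a ℕ.+ c , b ℕ.+ d)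
    ; _*_     = λ (a , b) (c , d) → reduce (a ℕ.* c ℕ.+ b ℕ.* d , a ℕ.* d ℕ.+ b ℕ.* c)
    ; -_      = λ (a , b) → b , a
    ; 0#      = 0 , 0
    ; 1#      = 1 , 0
    }

  -- The cases 0 and 1 are separate so that `:0` and `:1` denote `0#` and `1#` themselves in a
  -- solved equation, instead of differences of numerals.
  ⟦_⟧ : ℕ × ℕ → Carrier
  ⟦ 0 , 0 ⟧ = 0#
  ⟦ 1 , 0 ⟧ = 1#
  ⟦ p     ⟧ = diff p

  1≈diff : 1# ≈ diff (1 , 0)
  1≈diff = begin
    1#              ≈⟨ +-identityʳ 1# ⟨
    1# + 0#         ≈⟨ +-identityʳ _ ⟨
    1# + 0# + 0#    ≈⟨ +-congˡ -0#≈0# ⟨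
    1# + 0# - 0#    ∎

  ⟦⟧≈diff : ∀ p → ⟦ p ⟧ ≈ diff p
  ⟦⟧≈diff (0 , 0)             = sym (-‿inverseʳ 0#)
  ⟦⟧≈diff (1 , 0)             = 1≈diff
  ⟦⟧≈diff (0 , suc b)         = refl
  ⟦⟧≈diff (1 , suc b)         = refl
  ⟦⟧≈diff (suc (suc a) , b)   = refl

  private
    shift : ∀ x y z → x - y ≈ (x + z) - (y + z)
    shift x y z = begin
      x - y                    ≈⟨ +-identityʳ _ ⟨
      x - y + 0#               ≈⟨ +-congˡ (-‿inverseʳ z) ⟨
      (x - y) + (z - z)        ≈⟨ interchange _ _ _ _ ⟩
      (x + z) + (- y + - z)    ≈⟨ +-congˡ (-‿+-comm _ _) ⟩
      (x + z) - (y + z)        ∎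

  diff-reduce : ∀ p → diff (reduce p) ≈ diff p
  diff-reduce (zero , b)      = refl
  diff-reduce (suc a , zero)  = refl
  diff-reduce (suc a , suc b) = trans (diff-reduce (a , b))
    (trans (shift _ _ 1#) (+-cong (+-comm _ _) (-‿cong (+-comm _ _))))

  diff-+ : ∀ p q → diff (RawRing._+_ coefficients p q) ≈ diff p + diff q
  diff-+ (a , b) (c , d) = begin
    diff (reduce (a ℕ.+ c , b ℕ.+ d))                    ≈⟨ diff-reduce (a ℕ.+ c , b ℕ.+ d) ⟩
    natR R (a ℕ.+ c) - natR R (b ℕ.+ d)                  ≈⟨ +-cong (natR-+ a c) (-‿cong (natR-+ b d)) ⟩
    natR R a + natR R c - (natR R b + natR R d)          ≈⟨ +-congˡ (-‿+-comm _ _) ⟨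
    natR R a + natR R c + (- natR R b + - natR R d)      ≈⟨ interchange _ _ _ _ ⟩
    (natR R a - natR R b) + (natR R c - natR R d)        ∎

  private
    *-diff : ∀ x y z w → (x * z + y * w) - (x * w + y * z) ≈ (x - y) * (z - w)
    *-diff x y z w = begin
      (x * z + y * w) - (x * w + y * z)             ≈⟨ +-congˡ (-‿+-comm _ _) ⟨
      (x * z + y * w) + (- (x * w) + - (y * z))     ≈⟨ interchange _ _ _ _ ⟩
      (x * z - x * w) + (y * w - y * z)             ≈⟨ +-congˡ (⁻¹-anti-homo‿- _ _) ⟨
      (x * z - x * w) - (y * z - y * w)             ≈⟨ +-cong (x[y-z]≈xy-xz x z w) (-‿cong (x[y-z]≈xy-xz y z w)) ⟨
      x * (z - w) - y * (z - w)                     ≈⟨ [y-z]x≈yx-zx (z - w) x y ⟨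
      (x - y) * (z - w)                             ∎

  diff-* : ∀ p q → diff (RawRing._*_ coefficients p q) ≈ diff p * diff q
  diff-* (a , b) (c , d) = begin
    diff (reduce (a ℕ.* c ℕ.+ b ℕ.* d , a ℕ.* d ℕ.+ b ℕ.* c))
      ≈⟨ diff-reduce (a ℕ.* c ℕ.+ b ℕ.* d , a ℕ.* d ℕ.+ b ℕ.* c) ⟩
    natR R (a ℕ.* c ℕ.+ b ℕ.* d) - natR R (a ℕ.* d ℕ.+ b ℕ.* c)
      ≈⟨ +-cong (trans (natR-+ (a ℕ.* c) _) (+-cong (natR-* a c) (natR-* b d)))
                (-‿cong (trans (natR-+ (a ℕ.* d) _) (+-cong (natR-* a d) (natR-* b c)))) ⟩
    _ ≈⟨ *-diff _ _ _ _ ⟩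
    diff (a , b) * diff (c , d) ∎

  morphism : coefficients -Raw-AlmostCommutative⟶ fromCommutativeRing R
  morphism = record
    { ⟦_⟧    = ⟦_⟧
    ; +-homo = λ p q → trans (⟦⟧≈diff (RawRing._+_ coefficients p q)) (trans (diff-+ p q) (sym (+-cong (⟦⟧≈diff p) (⟦⟧≈diff q))))
    ; *-homo = λ p q → trans (⟦⟧≈diff (RawRing._*_ coefficients p q)) (trans (diff-* p q) (sym (*-cong (⟦⟧≈diff p) (⟦⟧≈diff q))))
    ; -‿homo = λ p → trans (⟦⟧≈diff (RawRing.-_ coefficients p)) (trans (neg p) (sym (-‿cong (⟦⟧≈diff p))))
    ; 0-homo = refl
    ; 1-homo = refl
    }
    where
    neg : ∀ p → diff (RawRing.-_ coefficients p) ≈ - diff p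
    neg (a , b) = sym (⁻¹-anti-homo‿- _ _)

  coefficients≟ : ∀ p q → Maybe (⟦ p ⟧ ≈ ⟦ q ⟧)
  coefficients≟ (a , b) (c , d) with a ℕ.+ d ℕ.≟ c ℕ.+ b
  ... | no  _  = nothing
  ... | yes eq = just (trans (⟦⟧≈diff (a , b)) (trans lemma (sym (⟦⟧≈diff (c , d)))))
    where
    lemma : diff (a , b) ≈ diff (c , d)
    lemma = begin
      natR R a - natR R b                            ≈⟨ shift _ _ (natR R d) ⟩
      (natR R a + natR R d) - (natR R b + natR R d)  ≈⟨ +-cong (trans (sym (natR-+ a d))
                                                          (trans (reflexive (≡.cong (natR R) eq)) (natR-+ c b)))
                                                          (-‿cong (+-comm _ _)) ⟩
      (natR R c + natR R b) - (natR R d + natR R b)  ≈⟨ shift _ _ (natR R b) ⟨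
      natR R c - natR R d                            ∎

  open import Algebra.Solver.Ring coefficients (fromCommutativeRing R) morphism coefficients≟ public
    using (solve; _:=_; _:+_; _:*_; _:-_; :-_; con)
    renaming (Polynomial to Expr)

  :0 :1 : ∀ {n} → Expr n
  :0 = con (0 , 0)
  :1 = con (1 , 0)

-- Convolution in a partially commutative monoid, and the projection from the free monoid

module Trace (R : CommutativeRing 0ℓ 0ℓ) {L : Set} (dj : L → L → Bool) where
  open CommutativeRing R
  open RingSolving R
  open import Relation.Binary.Reasoning.Setoid setoid

  ind : Bool → Carrier
  ind b = if b then 1# else 0#

  ind-∧ : ∀ a b → ind (a ∧ b) ≈ ind a * ind b
  ind-∧ true  b = sym (*-identityˡ _)
  ind-∧ false b = sym (zeroˡ _)

  infix 4 _≋_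
  _≋_ : (List L → Carrier) → (List L → Carrier) → Set
  f ≋ g = ∀ w → f w ≈ g w

  clear : L → List L → Bool
  clear a S = all (λ y → dj y a) S

  clear-interleaving : ∀ a {S T w} → Interleaving S T w → clear a w ≡ clear a S ∧ clear a T
  clear-interleaving a [] = ≡.refl
  clear-interleaving a {y ∷ S} {T} (consˡ i) with dj y a
  ... | true  = clear-interleaving a i
  ... | false = ≡.refl
  clear-interleaving a {S} {y ∷ T} (consʳ i) with dj y a | clear a S | clear-interleaving a i
  ... | true  | true  | eq = eq
  ... | true  | false | eq = eq
  ... | false | true  | eq = ≡.refl
  ... | false | false | eq = ≡.refl

  -- The sum of F over all factorisations S T of w in the monoid in which
  -- disjoint letters commute; the factors are represented by subwords of w.
  CS : List L → (List L → List L → Carrier) → Carrier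
  CS []      F = F [] []
  CS (a ∷ w) F = CS w λ S T → F (a ∷ S) T + ind (clear a S) * F S (a ∷ T)

  CS-cong : ∀ w {F G} → (∀ {S T} → Interleaving S T w → F S T ≈ G S T) → CS w F ≈ CS w G
  CS-cong []      e = e []
  CS-cong (a ∷ w) e = CS-cong w λ i → +-cong (e (consˡ i)) (*-congˡ (e (consʳ i)))

  CS-+ : ∀ w F G → CS w (λ S T → F S T + G S T) ≈ CS w F + CS w G
  CS-+ []      F G = refl
  CS-+ (a ∷ w) F G = trans
    (CS-cong w λ _ → solve 5 (λ p q c r s → (p :+ q) :+ c :* (r :+ s) := (p :+ c :* r) :+ (q :+ c :* s)) refl _ _ _ _ _)
    (CS-+ w _ _)

  CS-*ˡ : ∀ w c F → CS w (λ S T → c * F S T) ≈ c * CS w F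
  CS-*ˡ []      c F = refl
  CS-*ˡ (a ∷ w) c F = trans
    (CS-cong w λ _ → solve 4 (λ p q c r → c :* p :+ q :* (c :* r) := c :* (p :+ q :* r)) refl _ _ _ _)
    (CS-*ˡ w c _)

  CS-*ʳ : ∀ w c F → CS w (λ S T → F S T * c) ≈ CS w F * c
  CS-*ʳ w c F = trans (CS-cong w λ _ → *-comm _ _) (trans (CS-*ˡ w c F) (*-comm _ _))

  CS-0 : ∀ w {F} → (∀ {S T} → Interleaving S T w → F S T ≈ 0#) → CS w F ≈ 0#
  CS-0 w e = trans (CS-cong w λ i → trans (e i) (sym (zeroˡ 0#))) (trans (CS-*ˡ w 0# (λ _ _ → 0#)) (zeroˡ _))

  CS-unitˡ : ∀ w {F} → (∀ a S T → F (a ∷ S) T ≈ 0#) → CS w F ≈ F [] w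
  CS-unitˡ []          e = refl
  CS-unitˡ (a ∷ w) {F} e = begin
    CS (a ∷ w) F                       ≈⟨ CS-cong w (λ {S} {T} _ → +-congʳ (e a S T)) ⟩
    CS w (λ S T → 0# + ind (clear a S) * F S (a ∷ T)) ≈⟨ CS-unitˡ w (λ b S T → trans (+-identityˡ _) (trans (*-congˡ (e b S _)) (zeroʳ _))) ⟩
    0# + 1# * F [] (a ∷ w)             ≈⟨ trans (+-identityˡ _) (*-identityˡ _) ⟩
    F [] (a ∷ w)                       ∎

  CS-unitʳ : ∀ w {F} → (∀ a S T → F S (a ∷ T) ≈ 0#) → CS w F ≈ F w []
  CS-unitʳ []          e = refl
  CS-unitʳ (a ∷ w) {F} e = begin
    CS (a ∷ w) F                       ≈⟨ CS-cong w (λ {S} {T} _ → trans (+-congˡ (trans (*-congˡ (e a S T)) (zeroʳ _))) (+-identityʳ _)) ⟩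
    CS w (λ S T → F (a ∷ S) T)         ≈⟨ CS-unitʳ w (λ b S T → e b _ _) ⟩
    F (a ∷ w) []                       ∎

  -- Both sides run over factorisations into three factors. The head `a` goes to the first, to the
  -- second after passing `S₁`, or to the third after passing `S₁` and `S₂`; `G` lists these three
  -- terms, and clearing an interleaving of `S₁` and `S₂` means clearing both.
  CS-assoc : ∀ w F → CS w (λ S T → CS S λ S₁ S₂ → F S₁ S₂ T) ≈ CS w (λ S T → CS T λ T₁ T₂ → F S T₁ T₂)
  CS-assoc []      F = refl
  CS-assoc (a ∷ w) F = begin
    CS w (λ S T → CS S (λ S₁ S₂ → F (a ∷ S₁) S₂ T + ind (clear a S₁) * F S₁ (a ∷ S₂) T)
                + ind (clear a S) * CS S (λ S₁ S₂ → F S₁ S₂ (a ∷ T)))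
      ≈⟨ CS-cong w (λ {S} {T} _ → trans (+-congˡ (sym (CS-*ˡ S _ _))) (trans (sym (CS-+ S _ _))
           (CS-cong S λ {S₁} {S₂} i → +-congˡ (*-congʳ
             (trans (reflexive (≡.cong ind (clear-interleaving a i))) (ind-∧ (clear a S₁) (clear a S₂))))))) ⟩
    CS w (λ S T → CS S (λ S₁ S₂ → G S₁ S₂ T))
      ≈⟨ CS-assoc w G ⟩
    CS w (λ S T → CS T (λ T₁ T₂ → G S T₁ T₂))
      ≈⟨ CS-cong w (λ {S} {T} _ → trans
           (CS-cong T λ _ → solve 5 (λ x p y q z → x :+ p :* y :+ p :* q :* z := x :+ p :* (y :+ q :* z)) refl _ _ _ _ _)
           (trans (CS-+ T _ _) (+-congˡ (CS-*ˡ T _ _)))) ⟩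
    CS w (λ S T → CS T (λ T₁ T₂ → F (a ∷ S) T₁ T₂)
                + ind (clear a S) * CS T (λ T₁ T₂ → F S (a ∷ T₁) T₂ + ind (clear a T₁) * F S T₁ (a ∷ T₂)))
      ∎
    where
    G : List L → List L → List L → Carrier
    G S₁ S₂ T = F (a ∷ S₁) S₂ T + ind (clear a S₁) * F S₁ (a ∷ S₂) T
              + ind (clear a S₁) * ind (clear a S₂) * F S₁ S₂ (a ∷ T)

  infixl 7 _⊛_
  _⊛_ : (List L → Carrier) → (List L → Carrier) → List L → Carrier
  (f ⊛ g) w = CS w λ S T → f S * g T

  one : List L → Carrier
  one w = ind (null w)

  ⊛-cong : ∀ {f f′ g g′} → f ≋ f′ → g ≋ g′ → f ⊛ g ≋ f′ ⊛ g′
  ⊛-cong e e′ w = CS-cong w λ {S} {T} _ → *-cong (e S) (e′ T)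

  ⊛-assoc : ∀ f g h → (f ⊛ g) ⊛ h ≋ f ⊛ (g ⊛ h)
  ⊛-assoc f g h w = begin
    CS w (λ S T → CS S (λ S₁ S₂ → f S₁ * g S₂) * h T)    ≈⟨ CS-cong w (λ {S} {T} _ → sym (CS-*ʳ S (h T) _)) ⟩
    CS w (λ S T → CS S (λ S₁ S₂ → f S₁ * g S₂ * h T))    ≈⟨ CS-assoc w (λ x y z → f x * g y * h z) ⟩
    CS w (λ S T → CS T (λ T₁ T₂ → f S * g T₁ * h T₂))    ≈⟨ CS-cong w (λ {S} {T} _ → trans (CS-cong T λ _ → *-assoc _ _ _) (CS-*ˡ T (f S) _)) ⟩
    CS w (λ S T → f S * CS T (λ T₁ T₂ → g T₁ * h T₂))    ∎

  ⊛-identityˡ : ∀ f → one ⊛ f ≋ f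
  ⊛-identityˡ f w = trans (CS-unitˡ w λ _ _ _ → zeroˡ _) (*-identityˡ _)

  ⊛-identityʳ : ∀ f → f ⊛ one ≋ f
  ⊛-identityʳ f w = trans (CS-unitʳ w λ _ _ _ → zeroʳ _) (*-identityʳ _)

  ring⊛ : Ring 0ℓ 0ℓ
  ring⊛ = record
    { Carrier = List L → Carrier
    ; _≈_ = _≋_
    ; _+_ = λ f g w → f w + g w
    ; _*_ = _⊛_
    ; -_  = λ f w → - f w
    ; 0#  = λ _ → 0#
    ; 1#  = one
    ; isRing = record
      { +-isAbelianGroup = record
        { isGroup = record
          { isMonoid = record
            { isSemigroup = record
              { isMagma = record
                { isEquivalence = record
                  { refl = λ _ → refl ; sym = λ e w → sym (e w) ; trans = λ e e′ w → trans (e w) (e′ w) }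
                ; ∙-cong = λ e e′ w → +-cong (e w) (e′ w) }
              ; assoc = λ _ _ _ _ → +-assoc _ _ _ }
            ; identity = (λ _ _ → +-identityˡ _) , (λ _ _ → +-identityʳ _) }
          ; inverse = (λ _ _ → -‿inverseˡ _) , (λ _ _ → -‿inverseʳ _)
          ; ⁻¹-cong = λ e w → -‿cong (e w) }
        ; comm = λ _ _ _ → +-comm _ _ }
      ; *-cong = ⊛-cong
      ; *-assoc = ⊛-assoc
      ; *-identity = ⊛-identityˡ , ⊛-identityʳ
      ; distrib = (λ _ _ _ w → trans (CS-cong w λ _ → distribˡ _ _ _) (CS-+ w _ _))
                , (λ _ _ _ w → trans (CS-cong w λ _ → distribʳ _ _ _) (CS-+ w _ _))
      }
    }

  -- Series in the free monoid, and their images: push X w is the sum of X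
  -- over the words equal to w up to commutations of disjoint letters.
  INS : L → List L → (List L → Carrier) → Carrier
  INS a []      X = X (a ∷ [])
  INS a (y ∷ v) X = X (a ∷ y ∷ v) + ind (dj y a) * INS a v (λ π → X (y ∷ π))

  push : (List L → Carrier) → List L → Carrier
  push X []      = X []
  push X (a ∷ w) = push (λ π → INS a π X) w

  SP : List L → (List L → List L → Carrier) → Carrier
  SP []      F = F [] []
  SP (x ∷ w) F = F [] (x ∷ w) + SP w (λ p q → F (x ∷ p) q)

  INS-cong : ∀ a v {X Y} → (∀ π → a ∷ v ↭ π → X π ≈ Y π) → INS a v X ≈ INS a v Y
  INS-cong a []      e = e _ Perm.refl
  INS-cong a (y ∷ v) e = +-cong (e _ Perm.refl)
    (*-congˡ (INS-cong a v λ π p → e _ (Perm.trans (Perm.swap a y Perm.refl) (Perm.prep y p))))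

  -- Restricting the hypothesis to rearrangements of `w` lets later arguments use what these
  -- preserve: the length, or that one label is smaller than all the others.
  push-cong : ∀ w {X Y} → (∀ π → w ↭ π → X π ≈ Y π) → push X w ≈ push Y w
  push-cong []      e = e _ Perm.refl
  push-cong (a ∷ w) e = push-cong w λ π p → INS-cong a π λ ρ q → e ρ (Perm.trans (Perm.prep a p) q)

  INS-+ : ∀ a v X Y → INS a v (λ π → X π + Y π) ≈ INS a v X + INS a v Y
  INS-+ a []      X Y = refl
  INS-+ a (y ∷ v) X Y = trans (+-congˡ (*-congˡ (INS-+ a v _ _)))
    (solve 5 (λ p q c r s → (p :+ q) :+ c :* (r :+ s) := (p :+ c :* r) :+ (q :+ c :* s)) refl _ _ _ _ _)

  INS-* : ∀ a v c X → INS a v (λ π → c * X π) ≈ c * INS a v X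
  INS-* a []      c X = refl
  INS-* a (y ∷ v) c X = trans (+-congˡ (*-congˡ (INS-* a v c _)))
    (solve 4 (λ p q c r → c :* p :+ q :* (c :* r) := c :* (p :+ q :* r)) refl _ _ _ _)

  push-+ : ∀ w X Y → push (λ π → X π + Y π) w ≈ push X w + push Y w
  push-+ []      X Y = refl
  push-+ (a ∷ w) X Y = trans (push-cong w λ π _ → INS-+ a π X Y) (push-+ w _ _)

  push-* : ∀ w c X → push (λ π → c * X π) w ≈ c * push X w
  push-* []      c X = refl
  push-* (a ∷ w) c X = trans (push-cong w λ π _ → INS-* a π c X) (push-* w c _)

  push-0 : ∀ w {X} → (∀ π → w ↭ π → X π ≈ 0#) → push X w ≈ 0#
  push-0 w e = trans (push-cong w λ π p → trans (e π p) (sym (zeroˡ 0#))) (trans (push-* w 0# (λ _ → 0#)) (zeroˡ _))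

  SP-cong : ∀ w {F G} → (∀ p q → F p q ≈ G p q) → SP w F ≈ SP w G
  SP-cong []      e = e _ _
  SP-cong (x ∷ w) e = +-cong (e _ _) (SP-cong w λ p q → e (x ∷ p) q)

  SP-* : ∀ w c F → SP w (λ p q → c * F p q) ≈ c * SP w F
  SP-* []      c F = refl
  SP-* (x ∷ w) c F = trans (+-congˡ (SP-* w c _)) (sym (distribˡ _ _ _))

  SP-+ : ∀ w F G → SP w (λ p q → F p q + G p q) ≈ SP w F + SP w G
  SP-+ []      F G = refl
  SP-+ (x ∷ w) F G = trans (+-congˡ (SP-+ w _ _))
    (solve 4 (λ p q r s → (p :+ q) :+ (r :+ s) := (p :+ r) :+ (q :+ s)) refl _ _ _ _)

  infixl 7 _⋆_
  _⋆_ : (List L → Carrier) → (List L → Carrier) → List L → Carrier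
  (X ⋆ Y) w = SP w λ p q → X p * Y q

  -- In a cut of a word with `a` inserted, `a` lies in the left factor, or in the right one after
  -- passing all of the left factor.
  INS-SP : ∀ a v F → INS a v (λ π → SP π F)
         ≈ SP v (λ p q → INS a p (λ π → F π q) + ind (clear a p) * INS a q (F p))
  INS-SP a []      F = solve 2 (λ x y → x :+ y := y :+ :1 :* x) refl _ _
  INS-SP a (y ∷ v) F = begin
    (F [] (a ∷ y ∷ v) + (F (a ∷ []) (y ∷ v) + SP v (λ p q → F (a ∷ y ∷ p) q)))
      + ind (dj y a) * INS a v (λ π → F [] (y ∷ π) + SP π (λ p q → F (y ∷ p) q))
      ≈⟨ +-congˡ (*-congˡ (trans (INS-+ a v _ _) (+-congˡ (INS-SP a v (λ p → F (y ∷ p)))))) ⟩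
    (F [] (a ∷ y ∷ v) + (F (a ∷ []) (y ∷ v) + SP v (λ p q → F (a ∷ y ∷ p) q)))
      + ind (dj y a) * (INS a v (λ π → F [] (y ∷ π)) + SP v (λ p q → INS a p (λ π → F (y ∷ π) q) + ind (clear a p) * INS a q (F (y ∷ p))))
      ≈⟨ solve 6 (λ A B C d E G → (A :+ (B :+ C)) :+ d :* (E :+ G) := (B :+ :1 :* (A :+ d :* E)) :+ (C :+ d :* G)) refl _ _ _ _ _ _ ⟩
    (F (a ∷ []) (y ∷ v) + 1# * (F [] (a ∷ y ∷ v) + ind (dj y a) * INS a v (λ π → F [] (y ∷ π))))
      + (SP v (λ p q → F (a ∷ y ∷ p) q) + ind (dj y a) * SP v (λ p q → INS a p (λ π → F (y ∷ π) q) + ind (clear a p) * INS a q (F (y ∷ p))))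
      ≈⟨ +-congˡ (trans (+-congˡ (sym (SP-* v _ _))) (trans (sym (SP-+ v _ _)) (SP-cong v λ p q →
           trans (solve 5 (λ x d u c z → x :+ d :* (u :+ c :* z) := (x :+ d :* u) :+ (d :* c) :* z) refl _ _ _ _ _)
                 (+-congˡ (*-congʳ (sym (ind-∧ (dj y a) (clear a p)))))))) ⟩
    SP (y ∷ v) (λ p q → INS a p (λ π → F π q) + ind (clear a p) * INS a q (F p)) ∎

  all-↭ : ∀ (P : L → Bool) {v w} → v ↭ w → all P v ≡ all P w
  all-↭ P Perm.refl = ≡.refl
  all-↭ P (Perm.prep x p) = ≡.cong (P x ∧_) (all-↭ P p)
  all-↭ P (Perm.swap x y p) with P x | P y
  ... | true  | true  = all-↭ P p
  ... | true  | false = ≡.refl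
  ... | false | true  = ≡.refl
  ... | false | false = ≡.refl
  all-↭ P (Perm.trans p q) = ≡.trans (all-↭ P p) (all-↭ P q)

  -- Multiplicativity of the projection: concatenation of words becomes `⊛`. By `INS-SP` the head
  -- letter gives one term for each factor, and the constraint `clear a` depends only on which
  -- letters `p` contains, so it can be taken out of the projection of `X₂`.
  push-SP : ∀ w X Y → push (X ⋆ Y) w ≈ (push X ⊛ push Y) w
  push-SP []      X Y = refl
  push-SP (a ∷ w) X Y = begin
    push (λ v → INS a v (X ⋆ Y)) w
      ≈⟨ push-cong w (λ v _ → trans (INS-SP a v (λ p q → X p * Y q)) (SP-+ v _ _)) ⟩
    push (λ v → SP v (λ p q → INS a p (λ π → X π * Y q)) + SP v (λ p q → ind (clear a p) * INS a q (λ π → X p * Y π))) w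
      ≈⟨ push-cong w (λ v _ → +-cong
           (SP-cong v λ p q → trans (INS-cong a p λ _ _ → *-comm _ _) (trans (INS-* a p (Y q) X) (*-comm _ _)))
           (SP-cong v λ p q → trans (*-congˡ (INS-* a q (X p) Y)) (sym (*-assoc _ _ _)))) ⟩
    push (λ v → (X₁ ⋆ Y) v + (X₂ ⋆ Y₂) v) w
      ≈⟨ push-+ w _ _ ⟩
    push (X₁ ⋆ Y) w + push (X₂ ⋆ Y₂) w
      ≈⟨ +-cong (push-SP w X₁ Y) (push-SP w X₂ Y₂) ⟩
    (push X₁ ⊛ push Y) w + (push X₂ ⊛ push Y₂) w
      ≈⟨ CS-+ w _ _ ⟨
    CS w (λ S T → push X₁ S * push Y T + push X₂ S * push Y₂ T)
      ≈⟨ CS-cong w (λ {S} {T} _ → +-congˡ (trans (*-congʳ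
           (trans (push-cong S λ π p → *-congʳ (reflexive (≡.cong ind (≡.sym (all-↭ _ p))))) (push-* S _ X))) (*-assoc _ _ _))) ⟩
    (push X ⊛ push Y) (a ∷ w) ∎
    where
    X₁ X₂ Y₂ : List L → Carrier
    X₁ p = INS a p X
    X₂ p = ind (clear a p) * X p
    Y₂ q = INS a q Y

-- Alternating sums and determinants over a non-commutative ring

module Alternating (A : Ring 0ℓ 0ℓ) {V : Set} where
  open Ring A
  open import Algebra.Properties.Ring A
  open import Algebra.Properties.CommutativeSemigroup +-commutativeSemigroup using (interchange)
  open import Relation.Binary.Reasoning.Setoid setoid

  -- The term for an entry with i predecessors carries the sign (-1)^i, and the second argument of
  -- `F` is the list without that entry.
  Alt : List V → (V → List V → Carrier) → Carrier
  Alt []       F = 0#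
  Alt (x ∷ xs) F = F x xs - Alt xs (λ y r → F y (x ∷ r))

  private
    Unique-resp-↭ : ∀ {xs ys : List V} → xs ↭ ys → Unique xs → Unique ys
    Unique-resp-↭ p = PermSetoidP.Unique-resp-↭ (≡.setoid V) (Perm.↭⇒↭ₛ p)

    bring : ∀ {x y : V} {r xs} → y ∷ r ↭ xs → y ∷ x ∷ r ↭ x ∷ xs
    bring {x} {y} p = Perm.trans (Perm.swap y x Perm.refl) (Perm.prep x p)

    bring₂ : ∀ {x y z : V} {r xs} → y ∷ z ∷ r ↭ xs → y ∷ z ∷ x ∷ r ↭ x ∷ xs
    bring₂ {x} {y} {z} p = Perm.trans (Perm.prep y (Perm.swap z x Perm.refl)) (bring p)

  Alt-cong : ∀ xs {F G} → (∀ x r → x ∷ r ↭ xs → F x r ≈ G x r) → Alt xs F ≈ Alt xs G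
  Alt-cong []       e = refl
  Alt-cong (x ∷ xs) e = +-cong (e x xs Perm.refl) (-‿cong (Alt-cong xs λ y r p → e y (x ∷ r) (bring p)))

  Alt-0 : ∀ xs {F} → (∀ x r → x ∷ r ↭ xs → F x r ≈ 0#) → Alt xs F ≈ 0#
  Alt-0 []       e = refl
  Alt-0 (x ∷ xs) e = trans (+-cong (e x xs Perm.refl) (trans (-‿cong (Alt-0 xs λ y r p → e y (x ∷ r) (bring p))) -0#≈0#)) (+-identityʳ 0#)

  Alt-+ : ∀ xs F G → Alt xs (λ x r → F x r + G x r) ≈ Alt xs F + Alt xs G
  Alt-+ []       F G = sym (+-identityʳ 0#)
  Alt-+ (x ∷ xs) F G = trans (+-congˡ (trans (-‿cong (Alt-+ xs _ _)) (sym (-‿+-comm _ _)))) (interchange _ _ _ _)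

  Alt-neg : ∀ xs F → Alt xs (λ x r → - F x r) ≈ - Alt xs F
  Alt-neg []       F = sym -0#≈0#
  Alt-neg (x ∷ xs) F = trans (+-congˡ (-‿cong (Alt-neg xs _))) (-‿+-comm _ _)

  Alt-*ˡ : ∀ xs c F → Alt xs (λ x r → c * F x r) ≈ c * Alt xs F
  Alt-*ˡ []       c F = sym (zeroʳ c)
  Alt-*ˡ (x ∷ xs) c F = trans (+-congˡ (-‿cong (Alt-*ˡ xs c _))) (sym (x[y-z]≈xy-xz c _ _))

  Alt-*ʳ : ∀ xs c F → Alt xs (λ x r → F x r * c) ≈ Alt xs F * c
  Alt-*ʳ []       c F = sym (zeroˡ c)
  Alt-*ʳ (x ∷ xs) c F = trans (+-congˡ (-‿cong (Alt-*ʳ xs c _))) (sym ([y-z]x≈yx-zx c _ _))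

  private
    -- Pairs are sorted by whether the head is picked first, second or not at all; in the last case
    -- it is passed twice, so the sign is unchanged.
    Alt²-step : ∀ x xs (F : V → V → List V → Carrier) →
      Alt (x ∷ xs) (λ y r → Alt r (λ z → F y z)) ≈
      (Alt xs (λ y r → F x y r) - Alt xs (λ y r → F y x r)) + Alt xs (λ y r → Alt r (λ z s → F y z (x ∷ s)))
    Alt²-step x xs F = begin
      Alt xs (F x) - Alt xs (λ y r → F y x r - Alt r (λ z s → F y z (x ∷ s)))
        ≈⟨ +-congˡ (-‿cong (trans (Alt-+ xs _ _) (+-congˡ (Alt-neg xs _)))) ⟩
      Alt xs (F x) - (Alt xs (λ y r → F y x r) - B)
        ≈⟨ +-congˡ (sym (-‿+-comm _ _)) ⟩
      Alt xs (F x) + (- Alt xs (λ y r → F y x r) + - - B)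
        ≈⟨ +-assoc _ _ _ ⟨
      (Alt xs (F x) - Alt xs (λ y r → F y x r)) + - - B
        ≈⟨ +-congˡ (-‿involutive B) ⟩
      (Alt xs (F x) - Alt xs (λ y r → F y x r)) + B ∎
      where B = Alt xs (λ y r → Alt r (λ z s → F y z (x ∷ s)))

  Alt²-antisym : ∀ xs (F : V → V → List V → Carrier) →
    Alt xs (λ y r → Alt r (λ z → F z y)) ≈ - Alt xs (λ y r → Alt r (λ z → F y z))
  Alt²-antisym []       F = sym -0#≈0#
  Alt²-antisym (x ∷ xs) F = begin
    Alt (x ∷ xs) (λ y r → Alt r (λ z → F z y)) ≈⟨ Alt²-step x xs (λ y z → F z y) ⟩
    (P - Q) + Alt xs (λ y r → Alt r (λ z s → F z y (x ∷ s)))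
      ≈⟨ +-cong (sym (⁻¹-anti-homo‿- Q P)) (Alt²-antisym xs (λ y z s → F y z (x ∷ s))) ⟩
    - (Q - P) + - Alt xs (λ y r → Alt r (λ z s → F y z (x ∷ s)))  ≈⟨ -‿+-comm _ _ ⟩
    - ((Q - P) + Alt xs (λ y r → Alt r (λ z s → F y z (x ∷ s))))  ≈⟨ -‿cong (Alt²-step x xs F) ⟨
    - Alt (x ∷ xs) (λ y r → Alt r (λ z → F y z)) ∎
    where
    P = Alt xs (λ y r → F y x r)
    Q = Alt xs (λ y r → F x y r)

  -- Antisymmetry alone would only show that twice the sum is zero, so the two orders of each pair
  -- are cancelled against each other.
  Alt²-0 : ∀ xs (F : V → V → List V → Carrier) →
    (∀ x y r → x ∷ y ∷ r ↭ xs → F x y r ≈ F y x r) → Alt xs (λ y r → Alt r (λ z → F y z)) ≈ 0#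
  Alt²-0 []       F e = refl
  Alt²-0 (x ∷ xs) F e = begin
    Alt (x ∷ xs) (λ y r → Alt r (λ z → F y z)) ≈⟨ Alt²-step x xs F ⟩
    (Alt xs (λ y r → F x y r) - Alt xs (λ y r → F y x r)) + Alt xs (λ y r → Alt r (λ z s → F y z (x ∷ s)))
      ≈⟨ +-cong (trans (+-congʳ (Alt-cong xs λ y r p → e x y r (Perm.prep x p))) (-‿inverseʳ _))
                (Alt²-0 xs _ λ y z r p → e y z (x ∷ r) (bring₂ p)) ⟩
    0# + 0# ≈⟨ +-identityʳ 0# ⟩
    0# ∎

  Alt-++ : ∀ xs ys F → (∀ y r → y ∷ r ↭ ys → F y (xs ++ r) ≈ 0#) →
    Alt (xs ++ ys) F ≈ Alt xs (λ x r → F x (r ++ ys))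
  Alt-++ []       ys F e = Alt-0 ys e
  Alt-++ (x ∷ xs) ys F e = +-congˡ (-‿cong (Alt-++ xs ys (λ y r → F y (x ∷ r)) e))

  -- Det cs rs K is the alternating sum of c₁(ρ₁) ⋯ c_k(ρ_k) K(the rows left)
  -- over the choices of distinct rows ρ₁, …, ρ_k in rs.
  Det : List (V → Carrier) → List V → (List V → Carrier) → Carrier
  Det []       rs K = K rs
  Det (c ∷ cs) rs K = Alt rs (λ x r → c x * Det cs r K)

  det : List (V → Carrier) → List V → Carrier
  det cs rs = Det cs rs (λ _ → 1#)

  Det-cong : ∀ cs rs {K K′} → (∀ r → K r ≈ K′ r) → Det cs rs K ≈ Det cs rs K′
  Det-cong []       rs e = e rs
  Det-cong (c ∷ cs) rs e = Alt-cong rs λ x r _ → *-congˡ (Det-cong cs r e)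

  Det-columns-cong : ∀ {I : Set} (c c′ : I → V → Carrier) → (∀ q x → c q x ≈ c′ q x) →
    ∀ qs rs K → Det (map c qs) rs K ≈ Det (map c′ qs) rs K
  Det-columns-cong c c′ e []       rs K = refl
  Det-columns-cong c c′ e (q ∷ qs) rs K = Alt-cong rs λ x r _ → *-cong (e q x) (Det-columns-cong c c′ e qs r K)

  Det-+ : ∀ cs rs K K′ → Det cs rs (λ r → K r + K′ r) ≈ Det cs rs K + Det cs rs K′
  Det-+ []       rs K K′ = refl
  Det-+ (c ∷ cs) rs K K′ = trans (Alt-cong rs λ x r _ → trans (*-congˡ (Det-+ cs r K K′)) (distribˡ _ _ _)) (Alt-+ rs _ _)

  Det-*ʳ : ∀ cs rs K c → Det cs rs (λ r → K r * c) ≈ Det cs rs K * c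
  Det-*ʳ []       rs K c = refl
  Det-*ʳ (b ∷ cs) rs K c = trans (Alt-cong rs λ x r _ → trans (*-congˡ (Det-*ʳ cs r K c)) (sym (*-assoc _ _ _))) (Alt-*ʳ rs c _)

  Det-++ : ∀ cs ds rs K → Det (cs ++ ds) rs K ≈ Det cs rs (λ r → Det ds r K)
  Det-++ []       ds rs K = refl
  Det-++ (c ∷ cs) ds rs K = Alt-cong rs λ x r _ → *-congˡ (Det-++ cs ds r K)

  module _ {Inner : V → Set} where

    private
      split : ∀ {x r inn} → x ∷ r ↭ inn → All Inner inn → All Inner r
      split p inner with PermP.All-resp-↭ (Perm.↭-sym p) inner
      ... | _ ∷ all = all

    -- There are as many columns as rows, so every choice uses the given inner row, where all
    -- entries vanish.
    Det-Inner-0 : ∀ cs rs K → All (λ c → ∀ x → Inner x → c x ≈ 0#) cs → length cs ≡ length rs →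
      Any Inner rs → Det cs rs K ≈ 0#
    Det-Inner-0 []       []  K zs eq ()
    Det-Inner-0 (c ∷ cs) rs  K (z ∷ zs) eq inner = Alt-0 rs step
      where
      step : ∀ x r → x ∷ r ↭ rs → c x * Det cs r K ≈ 0#
      step x r π with PermP.Any-resp-↭ (Perm.↭-sym π) inner
      ... | here ix  = trans (*-congʳ (z x ix)) (zeroˡ _)
      ... | there ir = trans (*-congˡ (Det-Inner-0 cs r K zs (ℕP.suc-injective (≡.trans eq (≡.sym (PermP.↭-length π)))) ir)) (zeroʳ _)

    module _ (K : List V → Carrier) (N : ℕ) (K-0 : ∀ r → length r ≡ N → Any Inner r → K r ≈ 0#) where

      -- The columns cannot use up the inner rows, so one of these is left to `K`, which then
      -- vanishes.
      Det-few-columns : ∀ cs inn out → All Inner inn → length cs ℕ.+ N ≡ length (inn ++ out) →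
        length cs < length inn → Det cs (inn ++ out) K ≈ 0#
      Det-few-columns []       (x ∷ inn) out (i ∷ _) eq _      = K-0 _ (≡.sym eq) (here i)
      Det-few-columns (c ∷ cs) inn       out inner eq cs<inn = trans
        (Alt-++ inn out _ λ y r p → trans (*-congˡ (Det-few-columns cs inn r inner
          (ℕP.suc-injective (≡.trans eq (≡.trans (PermP.↭-length (PermP.++⁺ˡ inn (Perm.↭-sym p)))
            (PermP.↭-length (PermP.shift y inn r)))))
          (ℕP.<-trans (ℕP.n<1+n _) cs<inn))) (zeroʳ _))
        (Alt-0 inn λ x r p → trans (*-congˡ (Det-few-columns cs r out (split p inner)
          (ℕP.suc-injective (≡.trans eq (PermP.↭-length (PermP.++⁺ʳ out (Perm.↭-sym p)))))
          (ℕP.≤-pred (≡.subst (suc (length cs) <_) (≡.sym (PermP.↭-length p)) cs<inn)))) (zeroʳ _))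

      -- Laplace expansion along the first columns: a choice of an outer row would leave an inner
      -- row to `K`, so only the inner rows contribute.
      Det-block : ∀ cs inn out → All Inner inn → length cs ≡ length inn → length out ≡ N →
        Det cs (inn ++ out) K ≈ det cs inn * K out
      Det-block []       []  out inner eq eqN = sym (*-identityˡ _)
      Det-block (c ∷ cs) inn out inner eq eqN = begin
        Det (c ∷ cs) (inn ++ out) K
          ≈⟨ Alt-++ inn out _ (λ y r p → trans (*-congˡ (Det-few-columns cs inn r inner
               (ℕP.suc-injective (≡.trans (≡.cong₂ ℕ._+_ eq (≡.sym eqN)) (≡.trans (≡.sym (ListP.length-++ inn))
                 (≡.trans (PermP.↭-length (PermP.++⁺ˡ inn (Perm.↭-sym p))) (PermP.↭-length (PermP.shift y inn r))))))
               (ℕP.≤-reflexive eq))) (zeroʳ _)) ⟩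
        Alt inn (λ x r → c x * Det cs (r ++ out) K)
          ≈⟨ Alt-cong inn (λ x r p → trans (*-congˡ (Det-block cs r out (split p inner)
               (ℕP.suc-injective (≡.trans eq (≡.sym (PermP.↭-length p)))) eqN)) (sym (*-assoc _ _ _))) ⟩
        Alt inn (λ x r → c x * det cs r * K out)  ≈⟨ Alt-*ʳ inn (K out) _ ⟩
        det (c ∷ cs) inn * K out ∎

  module _ {I : Set} (b : I → V → Carrier)
           (b-comm : ∀ p q x y → x ≢ y → b p x * b q y ≈ b q y * b p x) where

    private
      rows≢ : ∀ {x y : V} {r rs} → x ∷ y ∷ r ↭ rs → Unique rs → x ≢ y
      rows≢ p u with Unique-resp-↭ (Perm.↭-sym p) u
      ... | (x≢y ∷ _) ∷ _ = x≢y

      rest : ∀ {x : V} {r rs} → x ∷ r ↭ rs → Unique rs → Unique r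
      rest p u with Unique-resp-↭ (Perm.↭-sym p) u
      ... | _ ∷ u′ = u′

      exchange : ∀ p q {x y} {c} → x ≢ y → b p x * (b q y * c) ≈ b q y * (b p x * c)
      exchange p q x≢y = trans (sym (*-assoc _ _ _)) (trans (*-congʳ (b-comm p q _ _ x≢y)) (*-assoc _ _ _))

      -- Adjacent equal columns cancel because their entries in distinct rows commute. Otherwise the
      -- first column is exchanged with its neighbour `q`, which flips the sign and shortens the
      -- gap.
      first-repeated : ∀ p qs rs K → Unique rs → Det (b p ∷ map b qs ++ b p ∷ []) rs K ≈ 0#
      first-repeated p [] rs K u = trans
        (Alt-cong rs λ x r _ → sym (Alt-*ˡ r _ _))
        (Alt²-0 rs (λ x y s → b p x * (b p y * K s)) λ x y r π → exchange p p (rows≢ π u))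
      first-repeated p (q ∷ qs) rs K u = begin
        Alt rs (λ x r → b p x * Alt r (λ y s → b q y * M s))
          ≈⟨ Alt-cong rs (λ x r π → trans (sym (Alt-*ˡ r _ _)) (Alt-cong r λ y s π′ →
               exchange p q (rows≢ (Perm.trans (Perm.prep x π′) π) u))) ⟩
        Alt rs (λ x r → Alt r (λ y s → b q y * (b p x * M s)))
          ≈⟨ Alt²-antisym rs (λ y x s → b q y * (b p x * M s)) ⟩
        - Alt rs (λ y r → Alt r (λ x s → b q y * (b p x * M s)))
          ≈⟨ -‿cong (Alt-0 rs λ y r π → trans (Alt-*ˡ r _ _) (trans (*-congˡ (first-repeated p qs r K (rest π u))) (zeroʳ _))) ⟩
        - 0# ≈⟨ -0#≈0# ⟩
        0# ∎
        where
        M : List V → Carrier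
        M s = Det (map b qs ++ b p ∷ []) s K

    Det-repeated : ∀ {p qs} → p ∈ qs → ∀ rs (K : List V → Carrier) → Unique rs → Det (map b qs) rs (λ r → Alt r (λ x s → b p x * K s)) ≈ 0#
    Det-repeated {p} {_ ∷ qs} (here ≡.refl) rs K u = trans (sym (Det-++ (b p ∷ map b qs) (b p ∷ []) rs K)) (first-repeated p qs rs K u)
    Det-repeated {p} {q ∷ qs} (there p∈qs)  rs K u = Alt-0 rs λ x r π → trans (*-congˡ (Det-repeated p∈qs r K (rest π u))) (zeroʳ _)

    add-columns : (V → Carrier) → List I → (I → Carrier) → V → Carrier
    add-columns v ps g x = foldr _+_ (v x) (map (λ p → b p x * g p) ps)

    -- The coefficient `g p` is moved past no entry: it is absorbed into `K`, after which column `p`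
    -- occurs twice. This is why only columns to the left of the changed one are added.
    Det-add-columns : ∀ {qs} v ps g rs (K : List V → Carrier) → All (_∈ qs) ps → Unique rs →
      Det (map b qs) rs (λ r → Alt r (λ x s → add-columns v ps g x * K s)) ≈
      Det (map b qs) rs (λ r → Alt r (λ x s → v x * K s))
    Det-add-columns      v []       g rs K _  u = refl
    Det-add-columns {qs} v (p ∷ ps) g rs K (p∈ ∷ ps∈) u = begin
      Det (map b qs) rs (λ r → Alt r (λ x s → (b p x * g p + add-columns v ps g x) * K s))
        ≈⟨ Det-cong (map b qs) rs (λ r → trans
             (Alt-cong r λ x s _ → trans (distribʳ _ _ _) (+-congʳ (*-assoc _ _ _))) (Alt-+ r _ _)) ⟩
      Det (map b qs) rs (λ r → Alt r (λ x s → b p x * (g p * K s)) + Alt r (λ x s → add-columns v ps g x * K s))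
        ≈⟨ Det-+ (map b qs) rs _ _ ⟩
      Det (map b qs) rs (λ r → Alt r (λ x s → b p x * (g p * K s)))
        + Det (map b qs) rs (λ r → Alt r (λ x s → add-columns v ps g x * K s))
        ≈⟨ +-cong (Det-repeated p∈ rs (λ s → g p * K s) u) (Det-add-columns v ps g rs K ps∈ u) ⟩
      0# + Det (map b qs) rs (λ r → Alt r (λ x s → v x * K s))  ≈⟨ +-identityˡ _ ⟩
      Det (map b qs) rs (λ r → Alt r (λ x s → v x * K s)) ∎

    -- Cramer's rule for the last column: once it is cleared on the rows `inn`, only its entry in
    -- row `t` contributes.
    det-last-column : ∀ ps v g inn t → length ps ≡ length inn → Unique (inn ++ t ∷ []) →
      (∀ x → x ∈ inn → add-columns v ps g x ≈ 0#) →
      det (map b ps ++ v ∷ []) (inn ++ t ∷ []) ≈ det (map b ps) inn * add-columns v ps g t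
    det-last-column ps v g inn t eq u z = begin
      det (map b ps ++ v ∷ []) rs
        ≈⟨ Det-++ (map b ps) (v ∷ []) rs _ ⟩
      Det (map b ps) rs (λ r → Alt r (λ x s → v x * 1#))
        ≈⟨ Det-add-columns v ps g rs (λ _ → 1#) (All.tabulate λ p∈ → p∈) u ⟨
      Det (map b ps) rs (λ r → det (add-columns v ps g ∷ []) r)
        ≈⟨ Det-block _ 1 (λ r |r|≡1 → Det-Inner-0 _ r _ (z ∷ []) (≡.sym |r|≡1)) (map b ps) inn (t ∷ [])
             (All.tabulate λ x∈ → x∈) (≡.trans (ListP.length-map b ps) eq) ≡.refl ⟩
      det (map b ps) inn * (add-columns v ps g t * 1# - 0#)
        ≈⟨ *-congˡ (trans (+-cong (*-identityʳ _) -0#≈0#) (+-identityʳ _)) ⟩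
      det (map b ps) inn * add-columns v ps g t ∎
      where
      rs : List V
      rs = inn ++ t ∷ []

    -- Adding to each column of js a combination of the columns ps that clears
    -- it on the rows inn makes the matrix block triangular.
    det-eliminate : ∀ ps js (g : I → I → Carrier) inn out → length ps ≡ length inn → length js ≡ length out →
      Unique (inn ++ out) →
      (∀ j → j ∈ js → ∀ x → x ∈ inn → add-columns (b j) ps (g j) x ≈ 0#) →
      det (map b (ps ++ js)) (inn ++ out) ≈ det (map b ps) inn * det (map (λ j → add-columns (b j) ps (g j)) js) out
    det-eliminate ps js g inn out eq eq′ u z = begin
      det (map b (ps ++ js)) rs
        ≡⟨ ≡.cong (λ cs → det cs rs) (ListP.map-++ b ps js) ⟩
      det (map b ps ++ map b js) rs
        ≈⟨ Det-++ (map b ps) (map b js) rs _ ⟩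
      Det (map b ps) rs (λ r → det (map b js) r)
        ≈⟨ replace ps js (All.tabulate λ p∈ → p∈) ⟩
      Det (map b ps) rs (λ r → det (map ζ js) r)
        ≈⟨ Det-block _ (length js) (λ r |r| → Det-Inner-0 _ r _ zs (≡.trans (ListP.length-map ζ js) (≡.sym |r|)))
             (map b ps) inn out (All.tabulate λ x∈ → x∈) (≡.trans (ListP.length-map b ps) eq) (≡.sym eq′) ⟩
      det (map b ps) inn * det (map ζ js) out ∎
      where
      rs : List V
      rs = inn ++ out
      ζ : I → V → Carrier
      ζ j = add-columns (b j) ps (g j)
      zs : All (λ c → ∀ x → x ∈ inn → c x ≈ 0#) (map ζ js)
      zs = AllP.map⁺ (All.tabulate λ {j} → z j)
      -- The columns are changed from the last to the first, so that those to the left of the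
      -- changed column are still the original ones.
      replace : ∀ pre js → All (_∈ pre) ps →
        Det (map b pre) rs (λ r → det (map b js) r) ≈ Det (map b pre) rs (λ r → det (map ζ js) r)
      replace pre []       sub = refl
      replace pre (j ∷ js) sub = begin
        Det (map b pre) rs (λ r → Alt r (λ x s → b j x * det (map b js) s))
          ≈⟨ snoc (λ s → det (map b js) s) ⟨
        Det (map b (pre ++ j ∷ [])) rs (λ r → det (map b js) r)
          ≈⟨ replace (pre ++ j ∷ []) js (All.map MemP.∈-++⁺ˡ sub) ⟩
        Det (map b (pre ++ j ∷ [])) rs (λ r → det (map ζ js) r)
          ≈⟨ snoc (λ s → det (map ζ js) s) ⟩
        Det (map b pre) rs (λ r → Alt r (λ x s → b j x * det (map ζ js) s))
          ≈⟨ Det-add-columns (b j) ps (g j) rs (λ s → det (map ζ js) s) sub u ⟨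
        Det (map b pre) rs (λ r → Alt r (λ x s → ζ j x * det (map ζ js) s)) ∎
        where
        snoc : ∀ K → Det (map b (pre ++ j ∷ [])) rs K ≈ Det (map b pre) rs (λ r → Alt r (λ x s → b j x * K s))
        snoc K = trans (reflexive (≡.cong (λ cs → Det cs rs K) (ListP.map-++ b pre (j ∷ []))))
                       (Det-++ (map b pre) (b j ∷ []) rs K)

-- Finite sums

module Sums (A : Ring 0ℓ 0ℓ) where
  open Ring A
  open import Algebra.Properties.Ring A
  open import Algebra.Properties.CommutativeSemigroup +-commutativeSemigroup using (interchange)

  ∑ : ∀ {X : Set} → List X → (X → Carrier) → Carrier
  ∑ xs f = foldr _+_ 0# (map f xs)

  module _ {X : Set} where

    ∑-cong : ∀ (xs : List X) {f g} → (∀ {x} → x ∈ xs → f x ≈ g x) → ∑ xs f ≈ ∑ xs g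
    ∑-cong []       e = refl
    ∑-cong (x ∷ xs) e = +-cong (e (here ≡.refl)) (∑-cong xs (λ x∈ → e (there x∈)))

    ∑-0 : ∀ (xs : List X) {f} → (∀ {x} → x ∈ xs → f x ≈ 0#) → ∑ xs f ≈ 0#
    ∑-0 []       e = refl
    ∑-0 (x ∷ xs) e = trans (+-cong (e (here ≡.refl)) (∑-0 xs (λ x∈ → e (there x∈)))) (+-identityʳ 0#)

    ∑-+ : ∀ (xs : List X) f g → ∑ xs (λ x → f x + g x) ≈ ∑ xs f + ∑ xs g
    ∑-+ []       f g = sym (+-identityʳ 0#)
    ∑-+ (x ∷ xs) f g = trans (+-congˡ (∑-+ xs f g)) (interchange _ _ _ _)

    ∑-neg : ∀ (xs : List X) f → ∑ xs (λ x → - f x) ≈ - ∑ xs f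
    ∑-neg []       f = sym -0#≈0#
    ∑-neg (x ∷ xs) f = trans (+-congˡ (∑-neg xs f)) (-‿+-comm _ _)

    ∑-*ˡ : ∀ (xs : List X) c f → ∑ xs (λ x → c * f x) ≈ c * ∑ xs f
    ∑-*ˡ []       c f = sym (zeroʳ c)
    ∑-*ˡ (x ∷ xs) c f = trans (+-congˡ (∑-*ˡ xs c f)) (sym (distribˡ _ _ _))

    ∑-*ʳ : ∀ (xs : List X) c f → ∑ xs (λ x → f x * c) ≈ ∑ xs f * c
    ∑-*ʳ []       c f = sym (zeroˡ c)
    ∑-*ʳ (x ∷ xs) c f = trans (+-congˡ (∑-*ʳ xs c f)) (sym (distribʳ _ _ _))

    ∑-++ : ∀ (xs ys : List X) f → ∑ (xs ++ ys) f ≈ ∑ xs f + ∑ ys f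
    ∑-++ []       ys f = sym (+-identityˡ _)
    ∑-++ (x ∷ xs) ys f = trans (+-congˡ (∑-++ xs ys f)) (sym (+-assoc _ _ _))

    ∑-map : ∀ {Y : Set} (h : Y → X) ys f → ∑ (map h ys) f ≡ ∑ ys (f ∘ h)
    ∑-map h ys f = ≡.cong (foldr _+_ 0#) (≡.sym (ListP.map-∘ ys))

    ∑-concatMap : ∀ {Y : Set} (h : Y → List X) ys f → ∑ (concatMap h ys) f ≈ ∑ ys (λ y → ∑ (h y) f)
    ∑-concatMap h []       f = refl
    ∑-concatMap h (y ∷ ys) f = trans (∑-++ (h y) (concatMap h ys) f) (+-congˡ (∑-concatMap h ys f))

⌊⌋-yes : ∀ {P : Set} (d : Dec P) → P → ⌊ d ⌋ ≡ true
⌊⌋-yes (yes _) p = ≡.refl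
⌊⌋-yes (no ¬p) p = ⊥-elim (¬p p)

⌊⌋-no : ∀ {P : Set} (d : Dec P) → ¬ P → ⌊ d ⌋ ≡ false
⌊⌋-no (yes p) ¬p = ⊥-elim (¬p p)
⌊⌋-no (no _)  ¬p = ≡.refl

-- The signed sum over permutations as an iterated alternating sum

module Permutations (K : QAlgebra) (m : ℕ) where
  open Series K m using (insertAll; perms; inversions)

  insertAll-↭ : ∀ {X : Set} (x : X) xs {ys} → ys ∈ insertAll x xs → x ∷ xs ↭ ys
  insertAll-↭ x []       (here ≡.refl) = Perm.refl
  insertAll-↭ x (y ∷ xs) (here ≡.refl) = Perm.refl
  insertAll-↭ x (y ∷ xs) (there ys∈) with MemP.∈-map⁻ (y ∷_) ys∈
  ... | zs , zs∈ , ≡.refl = Perm.trans (Perm.swap x y Perm.refl) (Perm.prep y (insertAll-↭ x xs zs∈))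

  perms-↭ : ∀ {X : Set} (xs : List X) {ys} → ys ∈ perms xs → xs ↭ ys
  perms-↭ []       (here ≡.refl) = Perm.refl
  perms-↭ (x ∷ xs) ys∈ with MemP.∈-concat⁻′ (map (insertAll x) (perms xs)) ys∈
  ... | zss , ys∈zss , zss∈ with MemP.∈-map⁻ (insertAll x) zss∈
  ... | zs , zs∈ , ≡.refl = Perm.trans (Perm.prep x (perms-↭ xs zs∈)) (insertAll-↭ x zs ys∈zss)

  module _ (A : Ring 0ℓ 0ℓ) {N : ℕ} where
    open Ring A
    open import Algebra.Properties.Ring A
    open import Relation.Binary.Reasoning.Setoid setoid
    open Alternating A {Fin N}
    open Sums A

    signed : ℕ → Carrier → Carrier
    signed zero    x = x
    signed (suc k) x = - signed k x

    signed-cong : ∀ k {x y} → x ≈ y → signed k x ≈ signed k y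
    signed-cong zero    e = e
    signed-cong (suc k) e = -‿cong (signed-cong k e)

    signed-+ : ∀ k l x → signed (k ℕ.+ l) x ≈ signed k (signed l x)
    signed-+ zero    l x = refl
    signed-+ (suc k) l x = -‿cong (signed-+ k l x)

    signed-neg : ∀ k x → signed k (- x) ≈ - signed k x
    signed-neg zero    x = refl
    signed-neg (suc k) x = -‿cong (signed-neg k x)

    signed-add : ∀ k x y → signed k (x + y) ≈ signed k x + signed k y
    signed-add zero    x y = refl
    signed-add (suc k) x y = trans (-‿cong (signed-add k x y)) (sym (-‿+-comm _ _))

    ∑-signed : ∀ {X : Set} k (xs : List X) f → ∑ xs (λ x → signed k (f x)) ≈ signed k (∑ xs f)
    ∑-signed zero    xs f = refl
    ∑-signed (suc k) xs f = trans (∑-neg xs _) (-‿cong (∑-signed k xs f))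

    AltAll : ℕ → List (Fin N) → (List (Fin N) → Carrier) → Carrier
    AltAll zero    rs Ψ = Ψ []
    AltAll (suc k) rs Ψ = Alt rs (λ x r → AltAll k r (λ σ → Ψ (x ∷ σ)))

    AltAll-+ : ∀ k rs Ψ Ψ′ → AltAll k rs (λ σ → Ψ σ + Ψ′ σ) ≈ AltAll k rs Ψ + AltAll k rs Ψ′
    AltAll-+ zero    rs Ψ Ψ′ = refl
    AltAll-+ (suc k) rs Ψ Ψ′ = trans (Alt-cong rs λ x r _ → AltAll-+ k r _ _) (Alt-+ rs _ _)

    AltAll-neg : ∀ k rs Ψ → AltAll k rs (λ σ → - Ψ σ) ≈ - AltAll k rs Ψ
    AltAll-neg zero    rs Ψ = refl
    AltAll-neg (suc k) rs Ψ = trans (Alt-cong rs λ x r _ → AltAll-neg k r _) (Alt-neg rs _)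

    AltAll-*ˡ : ∀ k rs c Ψ → AltAll k rs (λ σ → c * Ψ σ) ≈ c * AltAll k rs Ψ
    AltAll-*ˡ zero    rs c Ψ = refl
    AltAll-*ˡ (suc k) rs c Ψ = trans (Alt-cong rs λ x r _ → AltAll-*ˡ k r c _) (Alt-*ˡ rs c _)

    signedInsert : Fin N → List (Fin N) → (List (Fin N) → Carrier) → Carrier
    signedInsert x []      Ψ = Ψ (x ∷ [])
    signedInsert x (y ∷ π) Ψ = Ψ (x ∷ y ∷ π) - signedInsert x π (λ ρ → Ψ (y ∷ ρ))

    -- Reconciles two recursions: the alternating sum picks the first entry of a permutation,
    -- whereas `perms` inserts the head of the list into a permutation of the rest. `signedInsert`
    -- flips the sign for every entry that `x` passes.
    AltAll-insert : ∀ k x xs Ψ → length xs ≡ k →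
      AltAll (suc k) (x ∷ xs) Ψ ≈ AltAll k xs (λ π → signedInsert x π Ψ)
    AltAll-insert zero    x []       Ψ eq = trans (+-congˡ -0#≈0#) (+-identityʳ _)
    AltAll-insert (suc k) x xs Ψ eq = begin
      AltAll (suc k) xs (λ σ → Ψ (x ∷ σ)) - Alt xs (λ y r → AltAll (suc k) (x ∷ r) (λ σ → Ψ (y ∷ σ)))
        ≈⟨ +-congˡ (-‿cong (Alt-cong xs λ y r p → AltAll-insert k x r _
             (ℕP.suc-injective (≡.trans (PermP.↭-length p) eq)))) ⟩
      AltAll (suc k) xs (λ σ → Ψ (x ∷ σ)) - Alt xs (λ y r → AltAll k r (λ π → signedInsert x π (λ ρ → Ψ (y ∷ ρ))))
        ≈⟨ +-congˡ (Alt-neg xs _) ⟨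
      AltAll (suc k) xs (λ σ → Ψ (x ∷ σ)) + Alt xs (λ y r → - AltAll k r (λ π → signedInsert x π (λ ρ → Ψ (y ∷ ρ))))
        ≈⟨ +-congˡ (Alt-cong xs λ y r _ → sym (AltAll-neg k r _)) ⟩
      AltAll (suc k) xs (λ σ → Ψ (x ∷ σ)) + Alt xs (λ y r → AltAll k r (λ π → - signedInsert x π (λ ρ → Ψ (y ∷ ρ))))
        ≈⟨ Alt-+ xs _ _ ⟨
      Alt xs (λ y r → AltAll k r (λ π → Ψ (x ∷ y ∷ π)) + AltAll k r (λ π → - signedInsert x π (λ ρ → Ψ (y ∷ ρ))))
        ≈⟨ Alt-cong xs (λ y r _ → AltAll-+ k r _ _) ⟨
      AltAll (suc k) xs (λ π → signedInsert x π Ψ) ∎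

    private
      below : Fin N → List (Fin N) → ℕ
      below y xs = length (filter (λ z → z Fin.<? y) xs)

      below-insert : ∀ {x y} π {ρ} → x Fin.< y → ρ ∈ insertAll x π → below y ρ ≡ suc (below y π)
      below-insert {x} {y} π x<y ρ∈ = ≡.trans
        (≡.sym (PermP.↭-length (PermP.filter-↭ (λ z → z Fin.<? y) (insertAll-↭ x π ρ∈))))
        (≡.cong length (ListP.filter-accept (λ z → z Fin.<? y) x<y))

      below-minimum : ∀ {x π} → All (x Fin.<_) π → below x π ≡ 0
      below-minimum {x} all = ≡.cong length
        (ListP.filter-none (λ z → z Fin.<? x) (All.map (λ x<z z<x → FinP.<-asym x<z z<x) all))

    -- As `x` is smaller than all of `π`, passing an entry creates exactly one inversion and keeps
    -- those among the other entries.
    ∑-insertAll : ∀ x π Ψ → All (x Fin.<_) π →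
      ∑ (insertAll x π) (λ σ → signed (inversions σ) (Ψ σ)) ≈ signed (inversions π) (signedInsert x π Ψ)
    ∑-insertAll x []      Ψ _ = +-identityʳ _
    ∑-insertAll x (y ∷ π) Ψ all@(x<y ∷ all′) = begin
      signed (inversions (x ∷ y ∷ π)) (Ψ (x ∷ y ∷ π)) + ∑ (map (y ∷_) (insertAll x π)) (λ σ → signed (inversions σ) (Ψ σ))
        ≈⟨ +-cong (reflexive (≡.cong (λ k → signed (k ℕ.+ inversions (y ∷ π)) _) (below-minimum all)))
                  (reflexive (∑-map (y ∷_) (insertAll x π) _)) ⟩
      signed i (Ψ (x ∷ y ∷ π)) + ∑ (insertAll x π) (λ ρ → signed (below y ρ ℕ.+ inversions ρ) (Ψ (y ∷ ρ)))
        ≈⟨ +-congˡ (∑-cong (insertAll x π) λ {ρ} ρ∈ → trans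
             (reflexive (≡.cong (λ k → signed (k ℕ.+ inversions ρ) (Ψ (y ∷ ρ))) (below-insert π x<y ρ∈)))
             (signed-+ (suc (below y π)) (inversions ρ) _)) ⟩
      signed i (Ψ (x ∷ y ∷ π)) + ∑ (insertAll x π) (λ ρ → signed (suc (below y π)) (signed (inversions ρ) (Ψ (y ∷ ρ))))
        ≈⟨ +-congˡ (trans (∑-signed (suc (below y π)) (insertAll x π) _)
             (signed-cong (suc (below y π)) (∑-insertAll x π (λ ρ → Ψ (y ∷ ρ)) all′))) ⟩
      signed i (Ψ (x ∷ y ∷ π)) + - signed (below y π) (signed (inversions π) (signedInsert x π (λ ρ → Ψ (y ∷ ρ))))
        ≈⟨ +-congˡ (trans (-‿cong (sym (signed-+ (below y π) (inversions π) _))) (sym (signed-neg i _))) ⟩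
      signed i (Ψ (x ∷ y ∷ π)) + signed i (- signedInsert x π (λ ρ → Ψ (y ∷ ρ)))
        ≈⟨ signed-add i _ _ ⟨
      signed i (signedInsert x (y ∷ π) Ψ) ∎
      where i = inversions (y ∷ π)

    ∑-perms : ∀ rs Ψ → AllPairs Fin._<_ rs →
      ∑ (perms rs) (λ σ → signed (inversions σ) (Ψ σ)) ≈ AltAll (length rs) rs Ψ
    ∑-perms []       Ψ _ = +-identityʳ _
    ∑-perms (x ∷ xs) Ψ (x< ∷ inc) = begin
      ∑ (concatMap (insertAll x) (perms xs)) (λ σ → signed (inversions σ) (Ψ σ))
        ≈⟨ ∑-concatMap (insertAll x) (perms xs) _ ⟩
      ∑ (perms xs) (λ π → ∑ (insertAll x π) (λ σ → signed (inversions σ) (Ψ σ)))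
        ≈⟨ ∑-cong (perms xs) (λ {π} π∈ → ∑-insertAll x π Ψ (PermP.All-resp-↭ (perms-↭ xs π∈) x<)) ⟩
      ∑ (perms xs) (λ π → signed (inversions π) (signedInsert x π Ψ))
        ≈⟨ ∑-perms xs (λ π → signedInsert x π Ψ) inc ⟩
      AltAll (length xs) xs (λ π → signedInsert x π Ψ)
        ≈⟨ AltAll-insert (length xs) x xs Ψ ≡.refl ⟨
      AltAll (suc (length xs)) (x ∷ xs) Ψ ∎

    productAlong : List (Fin N → Carrier) → List (Fin N) → Carrier
    productAlong (c ∷ cs) (x ∷ σ) = c x * productAlong cs σ
    productAlong _        _       = 1#

    Det-AltAll : ∀ cs rs → AltAll (length cs) rs (productAlong cs) ≈ det cs rs
    Det-AltAll []       rs = refl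
    Det-AltAll (c ∷ cs) rs = Alt-cong rs λ x r _ → trans (AltAll-*ˡ (length cs) r (c x) _) (*-congˡ (Det-AltAll cs r))

    det-perms : ∀ cs rs → AllPairs Fin._<_ rs → length cs ≡ length rs →
      ∑ (perms rs) (λ σ → signed (inversions σ) (productAlong cs σ)) ≈ det cs rs
    det-perms cs rs inc eq = trans (∑-perms rs (productAlong cs) inc)
      (trans (reflexive (≡.cong (λ k → AltAll k rs (productAlong cs)) (≡.sym eq))) (Det-AltAll cs rs))

-- Images of the series operations in the quotient

module PushSeries (K : QAlgebra) (m : ℕ) where
  open QAlgebra K using (R)
  open CommutativeRing R
  open import Relation.Binary.Reasoning.Setoid setoid
  open Series K m hiding (ind)
  open Permutations K m

  apart : Letter → Letter → Bool
  apart x y = not ⌊ proj₁ x FinP.≟ proj₁ y ⌋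

  open Trace R apart public
  module P = Ring ring⊛
  module PSum = Sums ring⊛
  open Sums ring

  infixr 8 _⊛^_
  _⊛^_ : Ser → ℕ → Ser
  f ⊛^ zero  = one
  f ⊛^ suc r = f ⊛ (f ⊛^ r)

  ⊛^-cong : ∀ r {f g} → f ≋ g → f ⊛^ r ≋ g ⊛^ r
  ⊛^-cong zero    e = P.refl
  ⊛^-cong (suc r) e = ⊛-cong e (⊛^-cong r e)

  push-≋ : ∀ {X Y} → X ≋ Y → push X ≋ push Y
  push-≋ e w = push-cong w λ π _ → e π

  ∑-splits : ∀ w (F : Word → Word → Carrier) → ∑ (splits w) (λ p → F (proj₁ p) (proj₂ p)) ≈ SP w F
  ∑-splits []      F = +-identityʳ _
  ∑-splits (x ∷ w) F = +-congˡ (trans (reflexive (∑-map _ (splits w) _)) (∑-splits w (λ p q → F (x ∷ p) q)))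

  push-*S : ∀ f g → push (f *S g) ≋ push f ⊛ push g
  push-*S f g w = trans (push-≋ (λ v → ∑-splits v (λ p q → f p * g q)) w) (push-SP w f g)

  push-oneS : push oneS ≋ one
  push-oneS []      = refl
  push-oneS (a ∷ w) = push-0 (a ∷ w) λ { [] p → ⊥-elim (PermP.¬x∷xs↭[] p) ; (x ∷ π) p → refl }

  push-zeroS : push zeroS ≋ P.0#
  push-zeroS w = push-0 w λ _ _ → refl

  push-+S : ∀ f g → push (f +S g) ≋ push f P.+ push g
  push-+S f g w = push-+ w f g

  push-scaleS : ∀ c f → push (scaleS c f) ≋ λ w → c * push f w
  push-scaleS c f w = push-* w c f

  push--S : ∀ f → push (-S f) ≋ P.- push f
  push--S f w = trans (push-cong w λ π _ → sym (-1*x≈-x _)) (trans (push-* w (- 1#) f) (-1*x≈-x _))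
    where open import Algebra.Properties.Ring ring

  push--S- : ∀ f g → push (f -S g) ≋ push f P.- push g
  push--S- f g w = trans (push-+ w f (-S g)) (+-congˡ (push--S g w))

  push-powS : ∀ f r → push (powS f r) ≋ push f ⊛^ r
  push-powS f zero    = push-oneS
  push-powS f (suc r) = P.trans (push-*S f (powS f r)) (⊛-cong P.refl (push-powS f r))

  push-∑ : ∀ {X : Set} w (xs : List X) (f : X → Ser) → push (λ π → ∑ xs (λ x → f x π)) w ≈ ∑ xs (λ x → push (f x) w)
  push-∑ w []       f = push-0 w λ _ _ → refl
  push-∑ w (x ∷ xs) f = trans (push-+ w (f x) _) (+-congˡ (push-∑ w xs f))

  -- The truncation bound is the length of the word, which is the same for all rearrangements, so
  -- the projection acts on each term separately.
  push-graded : ∀ (f : ℕ → Ser) w →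
    push (λ π → ∑ (upTo (suc (length π))) (λ r → f r π)) w ≈ ∑ (upTo (suc (length w))) (λ r → push (f r) w)
  push-graded f w = trans
    (push-cong w λ π p → reflexive (≡.cong (λ k → ∑ (upTo (suc k)) (λ r → f r π)) (≡.sym (PermP.↭-length p))))
    (push-∑ w (upTo (suc (length w))) f)

  inverse : Ser → Ser
  inverse f w = ∑ (upTo (suc (length w))) (λ r → ((one P.- f) ⊛^ r) w)

  power : Carrier → Ser → Ser
  power β s w = ∑ (upTo (suc (length w))) (λ r → binomR (β + natR R r - 1#) r * (s ⊛^ r) w)

  inverse-cong : ∀ {f g} → f ≋ g → inverse f ≋ inverse g
  inverse-cong e w = ∑-cong (upTo (suc (length w))) λ {r} _ → ⊛^-cong r (λ v → +-congˡ (-‿cong (e v))) w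

  power-cong : ∀ β {f g} → f ≋ g → power β f ≋ power β g
  power-cong β e w = ∑-cong (upTo (suc (length w))) λ {r} _ → *-congˡ (⊛^-cong r e w)

  push-invS : ∀ f → push (invS f) ≋ inverse (push f)
  push-invS f w = trans (push-graded _ w) (∑-cong (upTo (suc (length w))) λ {r} _ → P.trans (push-powS (oneS -S f) r)
    (⊛^-cong r (P.trans (push--S- oneS f) (P.+-congʳ push-oneS))) w)

  push-powβ : ∀ β s → push (powβ β s) ≋ power β (push s)
  push-powβ β s w = trans (push-graded _ w) (∑-cong (upTo (suc (length w))) λ {r} _ → trans (push-* w _ (powS s r)) (*-congˡ (push-powS s r w)))

  letter-long : ∀ i j x y w → letter i j (x ∷ y ∷ w) ≈ 0#
  letter-long i j x y w = reflexive (≡.cong (λ b → if b then 1# else 0#)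
    (⌊⌋-no (ListP.≡-dec (ProdP.≡-dec FinP._≟_ FinP._≟_) ((i , j) ∷ []) (x ∷ y ∷ w)) λ ()))

  push-letter : ∀ i j → push (letter i j) ≋ letter i j
  push-letter i j []          = refl
  push-letter i j (x ∷ [])    = refl
  push-letter i j (x ∷ y ∷ w) = trans (push-0 (x ∷ y ∷ w) long) (sym (letter-long i j x y w))
    where
    long : ∀ π → x ∷ y ∷ w ↭ π → letter i j π ≈ 0#
    long []           p = ⊥-elim (PermP.¬x∷xs↭[] p)
    long (z ∷ [])     p with PermP.↭-length p
    ... | ()
    long (z ∷ z′ ∷ π) p = letter-long i j z z′ π

  kron : ∀ {N} → Fin N → Fin N → Ser
  kron i j = if ⌊ i FinP.≟ j ⌋ then one else P.0#

  push-kronS : ∀ {N} (i j : Fin N) → push (kronS i j) ≋ kron i j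
  push-kronS i j with ⌊ i FinP.≟ j ⌋
  ... | true  = push-oneS
  ... | false = push-zeroS

  module _ {N : ℕ} where
    open Alternating ring⊛ {Fin N} using (det)

    push-detS : ∀ (M : Fin N → Fin N → Ser) → push (detS M) ≋ det (map (λ q x → push (M x q)) (allFin N)) (allFin N)
    push-detS M = P.trans sum (det-perms ring⊛ cs (allFin N) increasing (ListP.length-map _ (allFin N)))
      where
      cs : List (Fin N → Ser)
      cs = map (λ q x → push (M x q)) (allFin N)

      increasing : AllPairs Fin._<_ (allFin N)
      increasing = AllPairsP.tabulate⁺-< λ i<j → i<j

      term : List (Fin N) → Ser
      term σ = scaleS (signR (inversions σ)) (prodS (map (λ p → M (proj₁ p) (proj₂ p)) (zip σ (allFin N))))

      push-sign : ∀ k f → (λ w → signR k * f w) ≋ signed ring⊛ k f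
      push-sign zero    f w = *-identityˡ _
      push-sign (suc k) f w = trans (sym (-‿distribˡ-* _ _)) (-‿cong (push-sign k f w))
        where open import Algebra.Properties.Ring ring

      push-product : ∀ σ qs → push (prodS (map (λ p → M (proj₁ p) (proj₂ p)) (zip σ qs))) ≋
        productAlong ring⊛ (map (λ q x → push (M x q)) qs) σ
      push-product []      []       = push-oneS
      push-product []      (q ∷ qs) = push-oneS
      push-product (x ∷ σ) []       = push-oneS
      push-product (x ∷ σ) (q ∷ qs) = P.trans (push-*S _ _) (⊛-cong P.refl (push-product σ qs))

      sums : ∀ σs → push (foldr _+S_ zeroS (map term σs)) ≋
        PSum.∑ σs (λ σ → signed ring⊛ (inversions σ) (productAlong ring⊛ cs σ))
      sums []       = push-zeroS
      sums (σ ∷ σs) = P.trans (push-+S _ _) (P.+-cong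
        (P.trans (push-scaleS _ _) (P.trans (λ w → *-congˡ (push-product σ (allFin N) w)) (push-sign (inversions σ) _))) (sums σs))

      sum : push (detS M) ≋ PSum.∑ (perms (allFin N)) (λ σ → signed ring⊛ (inversions σ) (productAlong ring⊛ cs σ))
      sum = sums (perms (allFin N))

-- Binomial coefficients with arbitrary upper entry

module Binomial (K : QAlgebra) (m : ℕ) where
  open QAlgebra K
  open CommutativeRing R
  open import Relation.Binary.Reasoning.Setoid setoid
  open RingSolving R
  open Series K m using (falling; invFact; binomR)

  falling-cong : ∀ l {x y} → x ≈ y → falling x l ≈ falling y l
  falling-cong zero    e = refl
  falling-cong (suc l) e = *-cong (falling-cong l e) (+-congʳ e)

  binom-cong : ∀ l {x y} → x ≈ y → binomR x l ≈ binomR y l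
  binom-cong l e = *-congʳ (falling-cong l e)

  falling-suc : ∀ x l → falling (x + 1#) (suc l) ≈ (x + 1#) * falling x l
  falling-suc x zero    = solve 1 (λ x → :1 :* (x :+ :1 :- :0) := (x :+ :1) :* :1) refl x
  falling-suc x (suc l) = begin
    falling (x + 1#) (suc l) * (x + 1# - (1# + natR R l))  ≈⟨ *-congʳ (falling-suc x l) ⟩
    (x + 1#) * falling x l * (x + 1# - (1# + natR R l))
      ≈⟨ solve 3 (λ x f n → (x :+ :1) :* f :* (x :+ :1 :- (:1 :+ n)) := (x :+ :1) :* (f :* (x :- n))) refl x _ _ ⟩
    (x + 1#) * (falling x l * (x - natR R l)) ∎

  pascal : ∀ x l → binomR (x + 1#) (suc l) ≈ binomR x (suc l) + binomR x l
  pascal x l = begin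
    falling (x + 1#) (suc l) * (invFact l * invSuc l)    ≈⟨ *-congʳ (falling-suc x l) ⟩
    (x + 1#) * falling x l * (invFact l * invSuc l)
      ≈⟨ solve 5 (λ x f n i s → (x :+ :1) :* f :* (i :* s) := f :* (x :- n) :* (i :* s) :+ f :* i :* ((:1 :+ n) :* s)) refl x _ (natR R l) _ _ ⟩
    binomR x (suc l) + falling x l * invFact l * (natR R (suc l) * invSuc l)
      ≈⟨ +-congˡ (trans (*-congˡ (invSuc-inv l)) (*-identityʳ _)) ⟩
    binomR x (suc l) + binomR x l ∎

  binom-0 : ∀ x → binomR x 0 ≈ 1#
  binom-0 x = *-identityʳ 1#

  falling-natR-0 : ∀ a l → a < l → falling (natR R a) l ≈ 0#
  falling-natR-0 a (suc l) (s≤s a≤l) with ℕP.m≤n⇒m<n∨m≡n a≤l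
  ... | inj₁ a<l    = trans (*-congʳ (falling-natR-0 a l a<l)) (zeroˡ _)
  ... | inj₂ ≡.refl = trans (*-congˡ (-‿inverseʳ _)) (zeroʳ _)

  binom-natR-0 : ∀ a l → a < l → binomR (natR R a) l ≈ 0#
  binom-natR-0 a l a<l = trans (*-congʳ (falling-natR-0 a l a<l)) (zeroˡ _)

-- Powers and inverses of series with constant term 1

module Powers (K : QAlgebra) (m : ℕ) where
  open QAlgebra K using (R)
  open CommutativeRing R
  open import Relation.Binary.Reasoning.Setoid setoid
  open RingSolving R using (solve; _:=_; _:+_; _:*_; _:-_; :-_; :0; :1)
  open Series K m using (Ser; binomR)
  open PushSeries K m
  open Binomial K m
  open Sums ring

  ∑-upTo-last : ∀ N f → ∑ (upTo (suc N)) f ≈ ∑ (upTo N) f + f N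
  ∑-upTo-last N f = begin
    ∑ (upTo (suc N)) f            ≡⟨ ≡.cong (λ xs → ∑ xs f) (ListP.applyUpTo-∷ʳ (λ x → x) N) ⟨
    ∑ (upTo N ++ N ∷ []) f        ≈⟨ ∑-++ (upTo N) (N ∷ []) f ⟩
    ∑ (upTo N) f + (f N + 0#)     ≈⟨ +-congˡ (+-identityʳ _) ⟩
    ∑ (upTo N) f + f N            ∎

  ∑-upTo-first : ∀ N f → ∑ (upTo (suc N)) f ≈ f 0 + ∑ (upTo N) (λ r → f (suc r))
  ∑-upTo-first N f = +-congˡ (begin
    ∑ (applyUpTo suc N) f         ≡⟨ ≡.cong (λ xs → ∑ xs f) (ListP.map-upTo suc N) ⟨
    ∑ (map suc (upTo N)) f        ≡⟨ ∑-map suc (upTo N) f ⟩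
    ∑ (upTo N) (λ r → f (suc r))  ∎)

  ∑-upTo-extend : ∀ {N N′} f → N ≤ N′ → (∀ r → N ≤ r → f r ≈ 0#) → ∑ (upTo N′) f ≈ ∑ (upTo N) f
  ∑-upTo-extend {N} f N≤N′ z = go (ℕP.≤⇒≤′ N≤N′)
    where
    go : ∀ {N′} → N ℕ.≤′ N′ → ∑ (upTo N′) f ≈ ∑ (upTo N) f
    go ℕ.≤′-refl = refl
    go {suc N′} (ℕ.≤′-step p) = begin
      ∑ (upTo (suc N′)) f     ≈⟨ ∑-upTo-last N′ f ⟩
      ∑ (upTo N′) f + f N′    ≈⟨ +-cong (go p) (z N′ (ℕP.≤′⇒≤ p)) ⟩
      ∑ (upTo N) f + 0#       ≈⟨ +-identityʳ _ ⟩
      ∑ (upTo N) f            ∎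

  interleaving-length : ∀ {X : Set} {S T w : List X} → Interleaving S T w → length w ≡ length S ℕ.+ length T
  interleaving-length {S = S} i = ≡.trans (PermP.↭-length (Int.toPermutation i)) (ListP.length-++ S)

  module _ (s : Ser) (s-0 : s [] ≈ 0#) where

    -- Each of the `r` factors takes at least one letter, as `s` has no constant term.
    ⊛^-short : ∀ r w → length w < r → (s ⊛^ r) w ≈ 0#
    ⊛^-short (suc r) w (s≤s |w|≤r) = CS-0 w λ { {S} {T} i → term S T (interleaving-length i) }
      where
      term : ∀ S T → length w ≡ length S ℕ.+ length T → s S * (s ⊛^ r) T ≈ 0#
      term []      T eq = trans (*-congʳ s-0) (zeroˡ _)
      term (a ∷ S) T eq = trans (*-congˡ (⊛^-short r T (ℕP.<-≤-trans
        (≡.subst (length T <_) (≡.sym eq) (s≤s (ℕP.m≤n+m _ (length S)))) |w|≤r))) (zeroʳ _)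

    -- By `⊛^-short`, cutting the power series in `s` off at the length of the word loses nothing.
    expand : (ℕ → Carrier) → Ser
    expand c w = ∑ (upTo (suc (length w))) (λ r → c r * (s ⊛^ r) w)

    expand-cong : ∀ {c c′} → (∀ r → c r ≈ c′ r) → expand c ≋ expand c′
    expand-cong e w = ∑-cong (upTo (suc (length w))) λ {r} _ → *-congʳ (e r)

    shift : (ℕ → Carrier) → ℕ → Carrier
    shift c zero    = 0#
    shift c (suc r) = c r

    ⊛-expand : ∀ c → s ⊛ expand c ≋ expand (shift c)
    ⊛-expand c w = begin
      CS w (λ S T → s S * expand c T)
        ≈⟨ CS-cong w (λ {S} {T} i → *-congˡ (sym (∑-upTo-extend (λ r → c r * (s ⊛^ r) T)
             (s≤s (ℕP.≤-trans (ℕP.m≤n+m (length T) (length S)) (ℕP.≤-reflexive (≡.sym (interleaving-length i)))))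
             λ r T<r → trans (*-congˡ (⊛^-short r T T<r)) (zeroʳ _)))) ⟩
      CS w (λ S T → s S * ∑ (upTo N) (λ r → c r * (s ⊛^ r) T))
        ≈⟨ distribute (upTo N) ⟩
      ∑ (upTo N) (λ r → c r * (s ⊛^ suc r) w)
        ≈⟨ ∑-upTo-last (length w) _ ⟩
      ∑ (upTo (length w)) (λ r → c r * (s ⊛^ suc r) w) + c (length w) * (s ⊛^ N) w
        ≈⟨ +-congˡ (trans (*-congˡ (⊛^-short N w ℕP.≤-refl)) (zeroʳ _)) ⟩
      ∑ (upTo (length w)) (λ r → c r * (s ⊛^ suc r) w) + 0#
        ≈⟨ trans (+-comm _ _) (+-congʳ (sym (zeroˡ _))) ⟩
      0# * one w + ∑ (upTo (length w)) (λ r → c r * (s ⊛^ suc r) w)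
        ≈⟨ ∑-upTo-first (length w) _ ⟨
      expand (shift c) w ∎
      where
      N = suc (length w)
      distribute : ∀ rs → CS w (λ S T → s S * ∑ rs (λ r → c r * (s ⊛^ r) T)) ≈ ∑ rs (λ r → c r * (s ⊛^ suc r) w)
      distribute []       = CS-0 w λ _ → zeroʳ _
      distribute (r ∷ rs) = begin
        CS w (λ S T → s S * (c r * (s ⊛^ r) T + ∑ rs (λ r → c r * (s ⊛^ r) T)))
          ≈⟨ CS-cong w (λ _ → solve 4 (λ a b x y → a :* (b :* x :+ y) := b :* (a :* x) :+ a :* y) refl _ _ _ _) ⟩
        CS w (λ S T → c r * (s S * (s ⊛^ r) T) + s S * ∑ rs (λ r → c r * (s ⊛^ r) T))
          ≈⟨ CS-+ w _ _ ⟩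
        CS w (λ S T → c r * (s S * (s ⊛^ r) T)) + CS w (λ S T → s S * ∑ rs (λ r → c r * (s ⊛^ r) T))
          ≈⟨ +-cong (CS-*ˡ w (c r) _) (distribute rs) ⟩
        c r * (s ⊛^ suc r) w + ∑ rs (λ r → c r * (s ⊛^ suc r) w) ∎

    expand-one : ∀ c → c 0 ≈ 1# → (∀ r → c (suc r) ≈ 0#) → expand c ≋ one
    expand-one c c0 c+ w = begin
      expand c w ≈⟨ ∑-upTo-first (length w) _ ⟩
      c 0 * one w + ∑ (upTo (length w)) (λ r → c (suc r) * (s ⊛^ suc r) w)
        ≈⟨ +-cong (trans (*-congʳ c0) (*-identityˡ _)) (∑-0 (upTo (length w)) λ {r} _ → trans (*-congʳ (c+ r)) (zeroˡ _)) ⟩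
      one w + 0# ≈⟨ +-identityʳ _ ⟩
      one w ∎

    1-s-expand : ∀ c → (one P.- s) ⊛ expand c ≋ expand (λ r → c r - shift c r)
    1-s-expand c w = begin
      ((one P.- s) ⊛ expand c) w
        ≈⟨ [y-z]x≈yx-zx (expand c) one s w ⟩
      (one ⊛ expand c) w - (s ⊛ expand c) w
        ≈⟨ +-cong (⊛-identityˡ (expand c) w) (-‿cong (⊛-expand c w)) ⟩
      expand c w - expand (shift c) w
        ≈⟨ +-congˡ (∑-neg (upTo (suc (length w))) _) ⟨
      expand c w + ∑ (upTo (suc (length w))) (λ r → - (shift c r * (s ⊛^ r) w))
        ≈⟨ ∑-+ (upTo (suc (length w))) _ _ ⟨
      ∑ (upTo (suc (length w))) (λ r → c r * (s ⊛^ r) w - shift c r * (s ⊛^ r) w)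
        ≈⟨ ∑-cong (upTo (suc (length w))) (λ {r} _ → solve 3 (λ a b x → (a :- b) :* x := a :* x :- b :* x) refl (c r) _ _) ⟨
      expand (λ r → c r - shift c r) w ∎
      where open import Algebra.Properties.Ring ring⊛ using ([y-z]x≈yx-zx)

    -- Multiplication by 1 - s lowers the exponent of 1/(1 - s) from β + 1 to β; on coefficients
    -- this is Pascal's rule.
    power-suc : ∀ β → (one P.- s) ⊛ power (β + 1#) s ≋ power β s
    power-suc β w = trans (1-s-expand _ w) (expand-cong coefficient w)
      where
      c : ℕ → Carrier
      c r = binomR (β + 1# + natR R r - 1#) r
      coefficient : ∀ r → c r - shift c r ≈ binomR (β + natR R r - 1#) r
      coefficient zero    = trans (solve 1 (λ x → x :- :0 := x) refl _) (trans (binom-0 (β + 1# + natR R 0 - 1#)) (sym (binom-0 (β + natR R 0 - 1#))))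
      coefficient (suc r) = begin
        binomR (β + 1# + (1# + natR R r) - 1#) (suc r) - binomR (β + 1# + natR R r - 1#) r
          ≈⟨ +-cong (binom-cong (suc r) (solve 2 (λ b n → b :+ :1 :+ (:1 :+ n) :- :1 := (b :+ n) :+ :1) refl β (natR R r)))
                    (-‿cong (binom-cong r (solve 2 (λ b n → b :+ :1 :+ n :- :1 := b :+ n) refl β (natR R r)))) ⟩
        binomR ((β + natR R r) + 1#) (suc r) - binomR (β + natR R r) r
          ≈⟨ +-congʳ (pascal _ r) ⟩
        binomR (β + natR R r) (suc r) + binomR (β + natR R r) r - binomR (β + natR R r) r
          ≈⟨ solve 2 (λ a b → a :+ b :- b := a) refl _ _ ⟩
        binomR (β + natR R r) (suc r)
          ≈⟨ binom-cong (suc r) (solve 2 (λ b n → b :+ n := b :+ (:1 :+ n) :- :1) refl β (natR R r)) ⟩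
        binomR (β + natR R (suc r) - 1#) (suc r) ∎

    power-0 : power 0# s ≋ one
    power-0 = expand-one (λ r → binomR (0# + natR R r - 1#) r) (binom-0 (0# + natR R 0 - 1#)) λ r → trans
      (binom-cong (suc r) (solve 1 (λ n → :0 :+ (:1 :+ n) :- :1 := n) refl (natR R r)))
      (binom-natR-0 r (suc r) ℕP.≤-refl)

    -- Inserting `g` times 1 - s, which is `one`, splits off a factor `g` and lowers the exponent by
    -- `power-suc`.
    power-nat : ∀ {g} → g ⊛ (one P.- s) ≋ one → ∀ k → power (natR R k) s ≋ g ⊛^ k
    power-nat inv zero    = power-0
    power-nat {g} inv (suc k) = P.trans (P.sym (⊛-identityˡ _)) (P.trans (⊛-cong (P.sym inv) P.refl)
      (P.trans (⊛-assoc g _ _) (⊛-cong P.refl (P.trans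
        (⊛-cong P.refl (λ w → ∑-cong (upTo (suc (length w))) λ {r} _ → *-congʳ (binom-cong r (+-congʳ (+-congʳ (+-comm 1# (natR R k)))))))
        (P.trans (power-suc (natR R k)) (power-nat inv k))))))

  module _ (f : Ser) (f-1 : f [] ≈ 1#) where

    private
      s : Ser
      s = one P.- f
      s-0 : s [] ≈ 0#
      s-0 = trans (+-congˡ (-‿cong f-1)) (-‿inverseʳ 1#)

    ⊛-inverse : f ⊛ inverse f ≋ one
    ⊛-inverse = P.trans (⊛-cong f≋ (λ w → ∑-cong (upTo (suc (length w))) λ _ → sym (*-identityˡ _)))
      (P.trans (1-s-expand s s-0 (λ _ → 1#)) (expand-one s s-0 _
        (solve 0 (:1 :- :0 := :1) refl) λ r → -‿inverseʳ 1#))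
      where
      f≋ : f ≋ one P.- s
      f≋ w = solve 2 (λ o f → f := o :- (o :- f)) refl (one w) (f w)

    inverse-1 : inverse f [] ≈ 1#
    inverse-1 = +-identityʳ _

  -- The right inverse `g` of `f` has constant term 1, hence a right inverse `h` of its own;
  -- associativity identifies `f` with `h`.
  inverse-⊛ : ∀ f → f [] ≈ 1# → inverse f ⊛ f ≋ one
  inverse-⊛ f f-1 = P.trans (⊛-cong P.refl f≋h) gh
    where
    g h : Ser
    g = inverse f
    h = inverse g
    gh : g ⊛ h ≋ one
    gh = ⊛-inverse g (inverse-1 f f-1)
    f≋h : f ≋ h
    f≋h = P.trans (P.sym (⊛-identityʳ f)) (P.trans (⊛-cong P.refl (P.sym gh)) (P.trans (P.sym (⊛-assoc f g h))
      (P.trans (⊛-cong (⊛-inverse f f-1) P.refl) (⊛-identityˡ h))))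

  left-inverse-unique : ∀ {f g h} → f ⊛ g ≋ one → g ⊛ h ≋ one → f ≋ h
  left-inverse-unique {f} {g} {h} fg gh = P.trans (P.sym (⊛-identityʳ f)) (P.trans (⊛-cong P.refl (P.sym gh))
    (P.trans (P.sym (⊛-assoc f g h)) (P.trans (⊛-cong fg P.refl) (⊛-identityˡ h))))

private
  flow-shift′ : ∀ d c q → q ℕ.+ c ℕ.+ d ≡ d ℕ.+ (c ℕ.+ q)
  flow-shift′ d c q = ≡.trans (ℕP.+-comm (q ℕ.+ c) d) (≡.cong (d ℕ.+_) (ℕP.+-comm q c))

AllPairs-++⁻ˡ : ∀ {A : Set} {Q : A → A → Set} xs {ys} → AllPairs Q (xs ++ ys) → AllPairs Q xs
AllPairs-++⁻ˡ []       _        = []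
AllPairs-++⁻ˡ (x ∷ xs) (q ∷ qs) = AllP.++⁻ˡ xs q ∷ AllPairs-++⁻ˡ xs qs

AllPairs-++⁻ʳ : ∀ {A : Set} {Q : A → A → Set} xs {ys} → AllPairs Q (xs ++ ys) → AllPairs Q ys
AllPairs-++⁻ʳ []       qs       = qs
AllPairs-++⁻ʳ (x ∷ xs) (q ∷ qs) = AllPairs-++⁻ʳ xs qs

Unique-++-≢ : ∀ {A : Set} xs {ys : List A} → Unique (xs ++ ys) → ∀ {x y} → x ∈ xs → y ∈ ys → x ≢ y
Unique-++-≢ (_ ∷ xs) (x∉ ∷ _) (here ≡.refl) y∈ = All.lookup x∉ (MemP.∈-++⁺ʳ xs y∈)
Unique-++-≢ (_ ∷ xs) (_ ∷ u)  (there x∈)    y∈ = Unique-++-≢ xs u x∈ y∈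

-- Popping letters, commuting columns, and words with prescribed flow

module Walks (K : QAlgebra) (m : ℕ) where
  open QAlgebra K using (R)
  open CommutativeRing R
  open import Relation.Binary.Reasoning.Setoid setoid
  open Series K m hiding (ind)
  open PushSeries K m

  ind-⇔ : ∀ {A B : Set} (a : Dec A) (b : Dec B) → (A → B) → (B → A) → ind ⌊ a ⌋ ≈ ind ⌊ b ⌋
  ind-⇔ (yes _) (yes _) f g = refl
  ind-⇔ (yes p) (no ¬q) f g = ⊥-elim (¬q (f p))
  ind-⇔ (no ¬p) (yes q) f g = ⊥-elim (¬p (g q))
  ind-⇔ (no _)  (no _)  f g = refl

  ind-yes : ∀ {A : Set} (a : Dec A) → A → ind ⌊ a ⌋ ≈ 1#
  ind-yes a p = reflexive (≡.cong ind (⌊⌋-yes a p))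

  ind-no : ∀ {A : Set} (a : Dec A) → ¬ A → ind ⌊ a ⌋ ≈ 0#
  ind-no a ¬p = reflexive (≡.cong ind (⌊⌋-no a ¬p))

  _≟W_ : (u v : Word) → Dec (u ≡ v)
  _≟W_ = ListP.≡-dec (ProdP.≡-dec FinP._≟_ FinP._≟_)

  letter-yes : ∀ i q → letter i q ((i , q) ∷ []) ≈ 1#
  letter-yes i q = ind-yes (((i , q) ∷ []) ≟W ((i , q) ∷ [])) ≡.refl

  letter-no : ∀ {i q w} → (i , q) ∷ [] ≢ w → letter i q w ≈ 0#
  letter-no {i} {q} {w} ≢w = ind-no (((i , q) ∷ []) ≟W w) ≢w

  apart-yes : ∀ {a b : Letter} → proj₁ a ≢ proj₁ b → apart a b ≡ true
  apart-yes {a} {b} a≢b = ≡.cong not (⌊⌋-no (proj₁ a FinP.≟ proj₁ b) a≢b)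

  apart-no : ∀ {a b : Letter} → proj₁ a ≡ proj₁ b → apart a b ≡ false
  apart-no {a} {b} a≡b = ≡.cong not (⌊⌋-yes (proj₁ a FinP.≟ proj₁ b) a≡b)

  -- The first letter of row `i` is the only one of that row that commutations can bring to the
  -- front; the last index is the word without it.
  data Pop (i : Fin m) : Word → Fin m → Word → Set where
    here  : ∀ {q w} → Pop i ((i , q) ∷ w) q w
    there : ∀ {a q w r} → proj₁ a ≢ i → Pop i w q r → Pop i (a ∷ w) q (a ∷ r)

  pop? : ∀ i w → All (λ a → proj₁ a ≢ i) w ⊎ ∃₂ (Pop i w)
  pop? i []            = inj₁ []
  pop? i ((h , q) ∷ w) with h FinP.≟ i
  ... | yes ≡.refl = inj₂ (q , w , here)
  ... | no h≢i with pop? i w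
  ...   | inj₁ all         = inj₁ (h≢i ∷ all)
  ...   | inj₂ (p , r , x) = inj₂ (p , (h , q) ∷ r , there h≢i x)

  letter-⊛-skip : ∀ i p (F : Ser) a w → proj₁ a ≢ i → (letter i p ⊛ F) (a ∷ w) ≈ (letter i p ⊛ (λ T → F (a ∷ T))) w
  letter-⊛-skip i p F a w a≢i = CS-cong w λ {S} {T} _ → begin
    letter i p (a ∷ S) * F T + ind (clear a S) * (letter i p S * F (a ∷ T))
      ≈⟨ +-cong (trans (*-congʳ (letter-no λ { ≡.refl → a≢i ≡.refl })) (zeroˡ _))
                (trans (sym (*-assoc _ _ _)) (*-congʳ (unobstructed S))) ⟩
    0# + letter i p S * F (a ∷ T)  ≈⟨ +-identityˡ _ ⟩
    letter i p S * F (a ∷ T)       ∎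
    where
    unobstructed : ∀ S → ind (clear a S) * letter i p S ≈ letter i p S
    unobstructed S with ((i , p) ∷ []) ≟W S
    ... | no  _      = zeroʳ _
    ... | yes ≡.refl = trans (*-congʳ (reflexive (≡.cong (λ b → ind (b ∧ true)) (apart-yes {i , p} {a} λ e → a≢i (≡.sym e))))) (*-identityˡ _)

  letter-⊛-absent : ∀ i p (F : Ser) w → All (λ a → proj₁ a ≢ i) w → (letter i p ⊛ F) w ≈ 0#
  letter-⊛-absent i p F []      _            = trans (*-congʳ (letter-no {i} {p} {[]} λ ())) (zeroˡ _)
  letter-⊛-absent i p F (a ∷ w) (a≢i ∷ all) = trans (letter-⊛-skip i p F a w a≢i) (letter-⊛-absent i p _ w all)

  -- A letter of row `i` can be split off on the left only if it is the popped one, so the product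
  -- reduces to comparing `p` with `q`.
  letter-⊛-pop : ∀ {i q w r} p (F : Ser) → Pop i w q r → (letter i p ⊛ F) w ≈ ind ⌊ p FinP.≟ q ⌋ * F r
  letter-⊛-pop {i} {q} {w = _ ∷ w} p F here = begin
    CS w (λ S T → letter i p ((i , q) ∷ S) * F T + ind (clear (i , q) S) * (letter i p S * F ((i , q) ∷ T)))
      ≈⟨ CS-cong w (λ {S} {T} _ → trans (+-cong (trans (*-congʳ (first S)) (*-assoc _ _ _))
           (trans (sym (*-assoc _ _ _)) (trans (*-congʳ (blocked S)) (zeroˡ _)))) (+-identityʳ _)) ⟩
    CS w (λ S T → ind ⌊ p FinP.≟ q ⌋ * (one S * F T))
      ≈⟨ CS-*ˡ w _ _ ⟩
    ind ⌊ p FinP.≟ q ⌋ * (one ⊛ F) w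
      ≈⟨ *-congˡ (⊛-identityˡ F w) ⟩
    ind ⌊ p FinP.≟ q ⌋ * F w ∎
    where
    first : ∀ S → letter i p ((i , q) ∷ S) ≈ ind ⌊ p FinP.≟ q ⌋ * one S
    first [] with p FinP.≟ q
    ... | yes ≡.refl = trans (letter-yes i p) (sym (*-identityˡ _))
    ... | no  p≢q    = trans (letter-no λ { ≡.refl → p≢q ≡.refl }) (sym (zeroˡ _))
    first (a ∷ S) = trans (letter-long i p _ a S) (sym (zeroʳ _))
    blocked : ∀ S → ind (clear (i , q) S) * letter i p S ≈ 0#
    blocked S with ((i , p) ∷ []) ≟W S
    ... | no  _      = zeroʳ _
    ... | yes ≡.refl = trans (*-congʳ (reflexive (≡.cong (λ b → ind (b ∧ true)) (apart-no {i , p} {i , q} ≡.refl)))) (zeroˡ _)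
  letter-⊛-pop {i} p F (there {a} {w = w} a≢i x) = trans (letter-⊛-skip i p F a w a≢i) (letter-⊛-pop p (λ T → F (a ∷ T)) x)

  Commute : Ser → Ser → Set
  Commute f g = f ⊛ g ≋ g ⊛ f

  commute-sub : ∀ {f g h} → Commute f h → Commute g h → Commute (f P.- g) h
  commute-sub {f} {g} {h} e e′ = P.trans ([y-z]x≈yx-zx h f g) (P.trans (P.+-cong e (P.-‿cong e′)) (P.sym (x[y-z]≈xy-xz h f g)))
    where open import Algebra.Properties.Ring ring⊛

  -- Both products vanish off words of two letters; there distinct rows leave no obstruction, and
  -- the value is symmetric in the two series.
  commute-letter : ∀ {x y} p q → x ≢ y → Commute (letter x p) (letter y q)
  commute-letter {x} {y} p q x≢y = go
    where
    f g : Ser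
    f = letter x p
    g = letter y q

    f[]≈0 : f [] ≈ 0#
    f[]≈0 = letter-no {x} {p} {[]} λ ()

    g[]≈0 : g [] ≈ 0#
    g[]≈0 = letter-no {y} {q} {[]} λ ()

    long : ∀ i p j q a b c w → CS (a ∷ b ∷ c ∷ w) (λ S T → letter i p S * letter j q T) ≈ 0#
    long i p j q a b c w = CS-0 (a ∷ b ∷ c ∷ w) λ { {S} {T} i → term S T (PermP.↭-length (Int.toPermutation i)) }
      where
      term : ∀ S T → suc (suc (suc (length w))) ≡ length (S ++ T) → letter i p S * letter j q T ≈ 0#
      term []          T           eq = trans (*-congʳ (letter-no {i} {p} {[]} λ ())) (zeroˡ _)
      term (s ∷ s′ ∷ S) T           eq = trans (*-congʳ (letter-long i p s s′ S)) (zeroˡ _)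
      term (s ∷ [])    (t ∷ t′ ∷ T) eq = trans (*-congˡ (letter-long j q t t′ T)) (zeroʳ _)

    through : ∀ x y p q → x ≢ y → ∀ a b →
      ind (clear a (b ∷ [])) * (letter x p (b ∷ []) * letter y q (a ∷ [])) ≈ letter x p (b ∷ []) * letter y q (a ∷ [])
    through x y p q x≢y a b with ((x , p) ∷ []) ≟W (b ∷ []) | ((y , q) ∷ []) ≟W (a ∷ [])
    ... | no  _      | _          = trans (*-congˡ (zeroˡ _)) (trans (zeroʳ _) (sym (zeroˡ _)))
    ... | yes _      | no  _      = trans (*-congˡ (zeroʳ _)) (trans (zeroʳ _) (sym (zeroʳ _)))
    ... | yes ≡.refl | yes ≡.refl = trans (*-congʳ (reflexive (≡.cong (λ b → ind (b ∧ true)) (apart-yes {x , p} {y , q} x≢y)))) (*-identityˡ _)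

    two : ∀ x y p q → x ≢ y → ∀ a b → (letter x p ⊛ letter y q) (a ∷ b ∷ []) ≈
      letter x p (b ∷ []) * letter y q (a ∷ []) + letter x p (a ∷ []) * letter y q (b ∷ [])
    two x y p q x≢y a b = +-cong
      (trans (+-cong (trans (*-congʳ (letter-long x p a b [])) (zeroˡ _)) (through x y p q x≢y a b)) (+-identityˡ _))
      (trans (*-identityˡ _) (trans (+-congˡ (trans (*-identityˡ _) (trans (*-congʳ (letter-no {x} {p} {[]} λ ())) (zeroˡ _)))) (+-identityʳ _)))

    go : Commute f g
    go []              = *-comm _ _
    go (a ∷ [])        = +-cong (trans (*-congˡ g[]≈0) (trans (zeroʳ _) (sym (trans (*-congˡ f[]≈0) (zeroʳ _)))))
      (*-congˡ (trans (*-congʳ f[]≈0) (trans (zeroˡ _) (sym (trans (*-congʳ g[]≈0) (zeroˡ _))))))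
    go (a ∷ b ∷ [])    = begin
      (f ⊛ g) (a ∷ b ∷ [])                                   ≈⟨ two x y p q x≢y a b ⟩
      f (b ∷ []) * g (a ∷ []) + f (a ∷ []) * g (b ∷ [])      ≈⟨ +-comm _ _ ⟩
      f (a ∷ []) * g (b ∷ []) + f (b ∷ []) * g (a ∷ [])      ≈⟨ +-cong (*-comm _ _) (*-comm _ _) ⟩
      g (b ∷ []) * f (a ∷ []) + g (a ∷ []) * f (b ∷ [])      ≈⟨ two y x q p (λ e → x≢y (≡.sym e)) a b ⟨
      (g ⊛ f) (a ∷ b ∷ [])                                   ∎
    go (a ∷ b ∷ c ∷ w) = trans (long x p y q a b c w) (sym (long y q x p a b c w))

  commute-kron : ∀ {N} (i j : Fin N) f → Commute (kron i j) f
  commute-kron i j f with ⌊ i FinP.≟ j ⌋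
  ... | true  = P.trans (⊛-identityˡ f) (P.sym (⊛-identityʳ f))
  ... | false = P.trans (P.zeroˡ f) (P.sym (P.zeroʳ f))

  column : Fin m → Fin m → Ser
  column q x = kron x q P.- letter x q

  -- Entries of I - A in different rows commute; this is the hypothesis under which repeated columns
  -- cancel.
  column-commute : ∀ p q x y → x ≢ y → column p x ⊛ column q y ≋ column q y ⊛ column p x
  column-commute p q x y x≢y = commute-sub
    (commute-kron x p (column q y))
    (P.sym (commute-sub (commute-kron y q (letter x p)) (P.sym (commute-letter p q x≢y))))

  rows cols : Fin m → Word → ℕ
  rows h w = count h (map proj₁ w)
  cols h w = count h (map proj₂ w)

  δ : Fin m → Fin m → ℕ
  δ h i = if ⌊ h FinP.≟ i ⌋ then 1 else 0

  δ-yes : ∀ h → δ h h ≡ 1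
  δ-yes h = ≡.cong (λ b → if b then 1 else 0) (⌊⌋-yes (h FinP.≟ h) ≡.refl)

  δ-no : ∀ {h i} → h ≢ i → δ h i ≡ 0
  δ-no {h} {i} h≢i = ≡.cong (λ b → if b then 1 else 0) (⌊⌋-no (h FinP.≟ i) h≢i)

  count-∷ : ∀ h x xs → count h (x ∷ xs) ≡ δ h x ℕ.+ count h xs
  count-∷ h x xs with h FinP.≟ x
  ... | yes _ = ≡.refl
  ... | no  _ = ≡.refl

  InRows : List (Fin m) → Word → Set
  InRows rs = All (λ a → proj₁ a ∈ rs)

  Balanced : Word → Set
  Balanced w = ∀ h → rows h w ≡ cols h w

  -- The words that can be walked from i to j, possibly leaving closed walks.
  Flow : Fin m → Fin m → Word → Set
  Flow i j w = ∀ h → rows h w ℕ.+ δ h j ≡ cols h w ℕ.+ δ h i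

  inRows? : ∀ rs w → Dec (InRows rs w)
  inRows? rs = All.all? (λ a → _∈?_ FinP._≟_ (proj₁ a) rs)

  balanced? : ∀ w → Dec (Balanced w)
  balanced? w = FinP.all? λ h → rows h w ℕ.≟ cols h w

  flow? : ∀ i j w → Dec (Flow i j w)
  flow? i j w = FinP.all? λ h → rows h w ℕ.+ δ h j ℕ.≟ cols h w ℕ.+ δ h i

  -- The series G of the overview for the set `rs` of heights; `path` is its analogue with one walk
  -- left open.
  closed : List (Fin m) → Ser
  closed rs w = ind ⌊ inRows? rs w ×-dec balanced? w ⌋

  path : List (Fin m) → Fin m → Fin m → Ser
  path rs i j w = ind ⌊ inRows? rs w ×-dec flow? i j w ⌋

  path-closed : ∀ rs i → path rs i i ≋ closed rs
  path-closed rs i w = ind-⇔ (inRows? rs w ×-dec flow? i i w) (inRows? rs w ×-dec balanced? w)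
    (λ (r , f) → r , λ h → ℕP.+-cancelʳ-≡ (δ h i) _ _ (f h)) (λ (r , f) → r , λ h → ≡.cong (ℕ._+ δ h i) (f h))

  rows-absent : ∀ i w → All (λ a → proj₁ a ≢ i) w → rows i w ≡ 0
  rows-absent i w all = ≡.cong length (ListP.filter-none (i FinP.≟_) (AllP.map⁺ (All.map (λ a≢i i≡a → a≢i (≡.sym i≡a)) all)))

  pop-rows : ∀ {i q w r} → Pop i w q r → ∀ h → rows h w ≡ δ h i ℕ.+ rows h r
  pop-rows here h = count-∷ h _ _
  pop-rows {i} (there {a} {r = r} _ x) h = ≡.trans (count-∷ h _ _) (≡.trans (≡.cong (δ h (proj₁ a) ℕ.+_) (pop-rows x h))
    (≡.trans (exchange (δ h (proj₁ a)) (δ h i) (rows h r)) (≡.cong (δ h i ℕ.+_) (≡.sym (count-∷ h _ _)))))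
    where open import Algebra.Properties.CommutativeSemigroup ℕP.+-commutativeSemigroup using () renaming (x∙yz≈y∙xz to exchange)

  pop-cols : ∀ {i q w r} → Pop i w q r → ∀ h → cols h w ≡ δ h q ℕ.+ cols h r
  pop-cols here h = count-∷ h _ _
  pop-cols {q = q} (there {a} {r = r} _ x) h = ≡.trans (count-∷ h _ _) (≡.trans (≡.cong (δ h (proj₂ a) ℕ.+_) (pop-cols x h))
    (≡.trans (exchange (δ h (proj₂ a)) (δ h q) (cols h r)) (≡.cong (δ h q ℕ.+_) (≡.sym (count-∷ h _ _)))))
    where open import Algebra.Properties.CommutativeSemigroup ℕP.+-commutativeSemigroup using () renaming (x∙yz≈y∙xz to exchange)

  pop-All : ∀ {Q : Fin m → Set} {i q w r} → Pop i w q r → All (Q ∘ proj₁) w → Q i × All (Q ∘ proj₁) r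
  pop-All here        (p ∷ ps) = p , ps
  pop-All (there _ x) (p ∷ ps) with pop-All x ps
  ... | qi , qr = qi , p ∷ qr

  pop-All⁻ : ∀ {Q : Fin m → Set} {i q w r} → Pop i w q r → Q i → All (Q ∘ proj₁) r → All (Q ∘ proj₁) w
  pop-All⁻ here        qi qr       = qi ∷ qr
  pop-All⁻ (there _ x) qi (p ∷ qr) = p ∷ pop-All⁻ x qi qr

  pop-flow : ∀ {i q j w r} → Pop i w q r → Flow i j w → Flow q j r
  pop-flow {i} {q} {j} {w} {r} x f h = ℕP.+-cancelˡ-≡ (δ h i) _ _ (≡.trans (≡.sym (ℕP.+-assoc (δ h i) (rows h r) (δ h j)))
    (≡.trans (≡.subst₂ (λ a b → a ℕ.+ δ h j ≡ b ℕ.+ δ h i) (pop-rows x h) (pop-cols x h) (f h))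
      (flow-shift′ (δ h i) (cols h r) (δ h q))))

  pop-flow⁻ : ∀ {i q j w r} → Pop i w q r → Flow q j r → Flow i j w
  pop-flow⁻ {i} {q} {j} {w} {r} x f h = ≡.subst₂ (λ a b → a ℕ.+ δ h j ≡ b ℕ.+ δ h i) (≡.sym (pop-rows x h)) (≡.sym (pop-cols x h))
    (≡.trans (ℕP.+-assoc (δ h i) (rows h r) (δ h j)) (≡.trans (≡.cong (δ h i ℕ.+_) (f h))
      (≡.sym (flow-shift′ (δ h i) (cols h r) (δ h q)))))

  path-pop : ∀ rs {i q j w r} → i ∈ rs → Pop i w q r → path rs i j w ≈ path rs q j r
  path-pop rs {i} {q} {j} {w} {r} i∈ x = ind-⇔ (inRows? rs w ×-dec flow? i j w) (inRows? rs r ×-dec flow? q j r)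
    (λ (a , f) → proj₂ (pop-All x a) , pop-flow x f) (λ (a , f) → pop-All⁻ x i∈ a , pop-flow⁻ x f)

  -- Flow from `q` to a different height requires a step starting at `q`, but no letter of the word
  -- lies in that row.
  path-outside : ∀ rs q j → ¬ (q ∈ rs) → q ≢ j → path rs q j ≋ P.0#
  path-outside rs q j q∉ q≢j w = ind-no (inRows? rs w ×-dec flow? q j w) λ (a , f) → contra (≡.trans (≡.sym (ℕP.+-identityʳ _))
    (≡.subst₂ (λ x y → rows q w ℕ.+ x ≡ cols q w ℕ.+ y) (δ-no q≢j) (δ-yes q) (f q)))
    (rows-absent q w (All.map (λ { p∈ ≡.refl → q∉ p∈ }) a))
    where
    contra : ∀ {x y} → x ≡ y ℕ.+ 1 → x ≢ 0
    contra {y = y} ≡.refl eq with ≡.trans (≡.sym (ℕP.+-comm y 1)) eq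
    ... | ()

-- MacMahon's master theorem and Sylvester's determinant identity

module Sylvester (K : QAlgebra) (m : ℕ) where
  open QAlgebra K using (R)
  open Series K m using (Ser; letter)
  open PushSeries K m
  open Powers K m using (inverse-⊛; ⊛-inverse; left-inverse-unique)
  open Walks K m
  open Sums ring⊛
  open Alternating ring⊛ {Fin m}
  open Ring ring⊛
  open import Algebra.Properties.Ring ring⊛
  open import Relation.Binary.Reasoning.Setoid setoid
  private module R = CommutativeRing R

  ∑-kron : ∀ {x} rs (g : Fin m → Ser) → x ∈ rs → Unique rs → ∑ rs (λ p → kron x p * g p) ≈ g x
  ∑-kron-0 : ∀ {x} rs (g : Fin m → Ser) → All (x ≢_) rs → ∑ rs (λ p → kron x p * g p) ≈ 0#

  kron-yes : ∀ {N} (i : Fin N) → kron i i ≈ 1#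
  kron-yes i = reflexive (≡.cong (λ b → if b then one else 0#) (⌊⌋-yes (i FinP.≟ i) ≡.refl))

  kron-no : ∀ {N} {i j : Fin N} → i ≢ j → kron i j ≈ 0#
  kron-no {i = i} {j} i≢j = reflexive (≡.cong (λ b → if b then one else 0#) (⌊⌋-no (i FinP.≟ j) i≢j))

  ∑-kron (x ∷ rs) g (here ≡.refl) (x∉ ∷ u) = begin
    kron x x * g x + ∑ rs (λ p → kron x p * g p)  ≈⟨ +-cong (trans (*-congʳ (kron-yes x)) (*-identityˡ _)) (∑-kron-0 rs g x∉) ⟩
    g x + 0#                                      ≈⟨ +-identityʳ _ ⟩
    g x                                           ∎
  ∑-kron {x} (p ∷ rs) g (there x∈) (p∉ ∷ u) = begin
    kron x p * g p + ∑ rs (λ p → kron x p * g p)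
      ≈⟨ +-cong (trans (*-congʳ (kron-no {i = x} {p} λ { ≡.refl → All.lookup p∉ x∈ ≡.refl })) (zeroˡ _)) (∑-kron rs g x∈ u) ⟩
    0# + g x                                      ≈⟨ +-identityˡ _ ⟩
    g x                                           ∎

  ∑-kron-0 []       g []          = refl
  ∑-kron-0 (p ∷ rs) g (x≢p ∷ all) = trans (+-cong (trans (*-congʳ (kron-no x≢p)) (zeroˡ _)) (∑-kron-0 rs g all)) (+-identityʳ _)

  all-letters : Fin m → (Fin m → Ser) → Ser
  all-letters i F = ∑ (allFin m) (λ q → letter i q * F q)

  ∑-at : ∀ {X : Set} (xs : List X) (f : X → Ser) w → ∑ xs f w ≡ Sums.∑ R.ring xs (λ x → f x w)
  ∑-at []       f w = ≡.refl
  ∑-at (x ∷ xs) f w = ≡.cong (f x w R.+_) (∑-at xs f w)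

  all-letters-absent : ∀ i F w → All (λ a → proj₁ a ≢ i) w → all-letters i F w R.≈ R.0#
  all-letters-absent i F w all = R.trans (R.reflexive (∑-at (allFin m) _ w))
    (Sums.∑-0 R.ring (allFin m) λ {q} _ → letter-⊛-absent i q (F q) w all)

  all-letters-pop : ∀ {i q w r} F → Pop i w q r → all-letters i F w R.≈ F q r
  all-letters-pop {i} {q} {w} {r} F x = R.trans (R.reflexive (∑-at (allFin m) _ w)) (R.trans
    (Sums.∑-cong R.ring (allFin m) λ {p} _ → letter-⊛-pop p (F p) x)
    (select (allFin m) (MemP.∈-allFin q) (UniqueP.allFin⁺ m)))
    where
    none : ∀ xs → All (q ≢_) xs → Sums.∑ R.ring xs (λ p → ind ⌊ p FinP.≟ q ⌋ R.* F p r) R.≈ R.0#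
    none xs all = Sums.∑-0 R.ring xs λ {p} p∈ → R.trans (R.*-congʳ (ind-no (p FinP.≟ q) λ p≡q → All.lookup all p∈ (≡.sym p≡q))) (R.zeroˡ _)
    select : ∀ xs → q ∈ xs → Unique xs → Sums.∑ R.ring xs (λ p → ind ⌊ p FinP.≟ q ⌋ R.* F p r) R.≈ F q r
    select (p ∷ xs) (here ≡.refl) (p∉ ∷ u) = R.trans (R.+-cong (R.trans (R.*-congʳ (ind-yes (q FinP.≟ q) ≡.refl)) (R.*-identityˡ _)) (none xs p∉)) (R.+-identityʳ _)
    select (p ∷ xs) (there q∈)    (p∉ ∷ u) = R.trans (R.+-cong (R.trans (R.*-congʳ (ind-no (p FinP.≟ q) λ { ≡.refl → All.lookup p∉ q∈ ≡.refl })) (R.zeroˡ _)) (select xs q∈ u)) (R.+-identityˡ _)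

  -- The linear system to be solved: flow from `i` to another height forces a letter of row `i`, and
  -- popping the first one leaves flow from its end.
  path-step : ∀ rs {i j} → i ∈ rs → i ≢ j → path rs i j ≈ all-letters i (λ q → path rs q j)
  path-step rs {i} {j} i∈ i≢j w with pop? i w
  ... | inj₂ (q , r , x) = R.trans (path-pop rs i∈ x) (R.sym (all-letters-pop _ x))
  ... | inj₁ all = R.trans (ind-no (inRows? rs w ×-dec flow? i j w) λ (_ , f) → impossible (f i)) (R.sym (all-letters-absent i _ w all))
    where
    impossible : rows i w ℕ.+ δ i j ≢ cols i w ℕ.+ δ i i
    impossible rewrite rows-absent i w all | δ-no i≢j | δ-yes i | ℕP.+-comm (cols i w) 1 = λ ()

  -- Either row `t` does not occur, or its first letter is popped and flow from the end of that
  -- letter back to `t` remains.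
  closed-step : ∀ rs {t} → ¬ (t ∈ rs) →
    closed (rs ++ t ∷ []) ≈ closed rs + all-letters t (λ q → path (rs ++ t ∷ []) q t)
  closed-step rs {t} t∉ w with pop? t w
  ... | inj₂ (q , r , x) = R.trans (R.sym (path-closed (rs ++ t ∷ []) t w)) (R.trans (path-pop (rs ++ t ∷ []) t∈ x) (R.trans (R.sym (R.+-identityˡ _))
          (R.+-cong (R.sym (ind-no (inRows? rs w ×-dec balanced? w) λ (a , _) → t∉ (proj₁ (pop-All x a)))) (R.sym (all-letters-pop _ x)))))
    where
    t∈ : t ∈ rs ++ t ∷ []
    t∈ = MemP.∈-++⁺ʳ rs (here ≡.refl)
  ... | inj₁ all = R.trans (ind-⇔ (inRows? (rs ++ t ∷ []) w ×-dec balanced? w) (inRows? rs w ×-dec balanced? w)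
          (λ (a , b) → narrow w all a , b) (λ (a , b) → All.map MemP.∈-++⁺ˡ a , b))
          (R.trans (R.sym (R.+-identityʳ _)) (R.+-congˡ (R.sym (all-letters-absent t _ w all))))
    where
    narrow : ∀ w → All (λ a → proj₁ a ≢ t) w → InRows (rs ++ t ∷ []) w → InRows rs w
    narrow []      _           _        = []
    narrow (a ∷ w) (a≢t ∷ all) (a∈ ∷ r) with MemP.∈-++⁻ rs a∈
    ... | inj₁ a∈rs        = a∈rs ∷ narrow w all r
    ... | inj₂ (here a≡t)  = ⊥-elim (a≢t a≡t)

  D : List (Fin m) → Ser
  D rs = det (map column rs) rs

  add-columns-∑ : ∀ v ps g x → add-columns column column-commute v ps g x ≈ v x + ∑ ps (λ p → column p x * g p)
  add-columns-∑ v []       g x = sym (+-identityʳ _)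
  add-columns-∑ v (p ∷ ps) g x = trans (+-congˡ (add-columns-∑ v ps g x))
    (trans (sym (+-assoc _ _ _)) (trans (+-congʳ (+-comm _ _)) (+-assoc _ _ _)))

  ∑-column : ∀ rs x (g : Fin m → Ser) → ∑ rs (λ p → column p x * g p) ≈ ∑ rs (λ p → kron x p * g p) - ∑ rs (λ p → letter x p * g p)
  ∑-column rs x g = trans (∑-cong rs λ {p} _ → [y-z]x≈yx-zx (g p) (kron x p) (letter x p)) (trans (∑-+ rs _ _) (+-congˡ (∑-neg rs _)))

  module _ (rs out : List (Fin m)) (all-rows : rs ++ out ≡ allFin m) where

    unique : Unique (rs ++ out)
    unique = ≡.subst Unique (≡.sym all-rows) (UniqueP.allFin⁺ m)

    unique-rs : Unique rs
    unique-rs = AllPairs-++⁻ˡ rs unique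

    disjoint : ∀ {x y} → x ∈ rs → y ∈ out → x ≢ y
    disjoint = Unique-++-≢ rs unique

    all-letters-split : ∀ i F → all-letters i F ≈ ∑ rs (λ q → letter i q * F q) + ∑ out (λ q → letter i q * F q)
    all-letters-split i F = trans (reflexive (≡.cong (λ xs → ∑ xs (λ q → letter i q * F q)) (≡.sym all-rows))) (∑-++ rs out _)

    outside : ∀ {q} → q ∈ out → ¬ (q ∈ rs)
    outside q∈ q∈′ = disjoint q∈′ q∈ ≡.refl

    all-letters-inside : ∀ i j → j ∈ rs → all-letters i (λ q → path rs q j) ≈ ∑ rs (λ q → letter i q * path rs q j)
    all-letters-inside i j j∈ = trans (all-letters-split i _) (trans (+-congˡ (∑-0 out λ q∈ →
      trans (*-congˡ (path-outside rs _ j (outside q∈) λ q≡j → disjoint j∈ q∈ (≡.sym q≡j))) (zeroʳ _))) (+-identityʳ _))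

    all-letters-outside : ∀ i j → j ∈ out →
      all-letters i (λ q → path rs q j) ≈ ∑ rs (λ q → letter i q * path rs q j) + letter i j * closed rs
    all-letters-outside i j j∈ = trans (all-letters-split i _) (+-congˡ (trans
      (select out j∈ (AllPairs-++⁻ʳ rs unique) (All.tabulate outside)) (*-congˡ (path-closed rs j))))
      where
      select : ∀ xs → j ∈ xs → Unique xs → All (λ q → ¬ (q ∈ rs)) xs →
        ∑ xs (λ q → letter i q * path rs q j) ≈ letter i j * path rs j j
      select (x ∷ xs) (here ≡.refl) (x∉ ∷ u) (o ∷ os) = trans (+-congˡ (∑-0 xs λ {q} q∈ →
        trans (*-congˡ (path-outside rs q j (All.lookup os q∈) λ q≡j → All.lookup x∉ q∈ (≡.sym q≡j))) (zeroʳ _))) (+-identityʳ _)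
      select (x ∷ xs) (there j∈) (x∉ ∷ u) (o ∷ os) = trans (+-cong
        (trans (*-congˡ (path-outside rs x j o λ { ≡.refl → All.lookup x∉ j∈ ≡.refl })) (zeroʳ _)) (select xs j∈ u os)) (+-identityˡ _)

  -- Cramer's rule for the system of `path-step`: the last column times `path rs⁺ t t`, plus the
  -- other columns times `path rs⁺ p t`, vanishes in the rows `rs`, and in row `t` it leaves
  -- `closed rs` by `closed-step`.
  D-step : ∀ rs t out → (rs ++ t ∷ []) ++ out ≡ allFin m → D (rs ++ t ∷ []) * closed (rs ++ t ∷ []) ≈ D rs * closed rs
  D-step rs t out all-rows = begin
    det (map column rs⁺) rs⁺ * closed rs⁺
      ≈⟨ *-cong (reflexive (≡.cong (λ cs → det cs rs⁺) (ListP.map-++ column rs (t ∷ [])))) (sym (path-closed rs⁺ t)) ⟩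
    det (map column rs ++ column t ∷ []) rs⁺ * g t
      ≈⟨ *-congʳ (Det-++ (map column rs) (column t ∷ []) rs⁺ _) ⟩
    Det (map column rs) rs⁺ (λ r → Alt r (λ x s → column t x * 1#)) * g t
      ≈⟨ Det-*ʳ (map column rs) rs⁺ _ (g t) ⟨
    Det (map column rs) rs⁺ (λ r → Alt r (λ x s → column t x * 1#) * g t)
      ≈⟨ Det-cong (map column rs) rs⁺ (λ r → trans (sym (Alt-*ʳ r (g t) _)) (Alt-cong r λ x s _ →
           trans (*-congʳ (*-identityʳ _)) (sym (*-identityʳ _)))) ⟩
    Det (map column rs) rs⁺ (λ r → Alt r (λ x s → v x * 1#))
      ≈⟨ Det-++ (map column rs) (v ∷ []) rs⁺ _ ⟨
    det (map column rs ++ v ∷ []) rs⁺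
      ≈⟨ det-last-column column column-commute rs v g rs t ≡.refl (unique-rs rs⁺ out all-rows) cleared ⟩
    D rs * add-columns column column-commute v rs g t
      ≈⟨ *-congˡ (trans (combined t (MemP.∈-++⁺ʳ rs (here ≡.refl))) remaining) ⟩
    D rs * closed rs ∎
    where
    rs⁺ = rs ++ t ∷ []
    g : Fin m → Ser
    g p = path rs⁺ p t
    v : Fin m → Ser
    v x = column t x * g t
    t∈ : t ∈ rs⁺
    t∈ = MemP.∈-++⁺ʳ rs (here ≡.refl)
    t∉ : ¬ (t ∈ rs)
    t∉ t∈rs = disjoint rs (t ∷ out) (≡.trans (≡.sym (ListP.++-assoc rs (t ∷ []) out)) all-rows) t∈rs (here ≡.refl) ≡.refl
    combined : ∀ x → x ∈ rs⁺ → add-columns column column-commute v rs g x ≈ g x - all-letters x g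
    combined x x∈ = begin
      add-columns column column-commute v rs g x             ≈⟨ add-columns-∑ v rs g x ⟩
      v x + ∑ rs (λ p → column p x * g p)                    ≈⟨ +-comm _ _ ⟩
      ∑ rs (λ p → column p x * g p) + v x                    ≈⟨ +-congˡ (+-identityʳ _) ⟨
      ∑ rs (λ p → column p x * g p) + (v x + 0#)             ≈⟨ ∑-++ rs (t ∷ []) _ ⟨
      ∑ rs⁺ (λ p → column p x * g p)                         ≈⟨ ∑-column rs⁺ x g ⟩
      ∑ rs⁺ (λ p → kron x p * g p) - ∑ rs⁺ (λ p → letter x p * g p)
        ≈⟨ +-cong (∑-kron rs⁺ g x∈ (unique-rs rs⁺ out all-rows)) (-‿cong (sym (all-letters-inside rs⁺ out all-rows x t t∈))) ⟩
      g x - all-letters x g                                  ∎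
    cleared : ∀ x → x ∈ rs → add-columns column column-commute v rs g x ≈ 0#
    cleared x x∈ = trans (combined x (MemP.∈-++⁺ˡ x∈)) (trans
      (+-congʳ (path-step rs⁺ (MemP.∈-++⁺ˡ x∈) λ { ≡.refl → t∉ x∈ })) (-‿inverseʳ _))
    remaining : g t - all-letters t g ≈ closed rs
    remaining = begin
      g t - all-letters t g                                        ≈⟨ +-congʳ (trans (path-closed rs⁺ t) (closed-step rs t∉)) ⟩
      closed rs + all-letters t g - all-letters t g                ≈⟨ +-assoc _ _ _ ⟩
      closed rs + (all-letters t g - all-letters t g)              ≈⟨ +-congˡ (-‿inverseʳ _) ⟩
      closed rs + 0#                                               ≈⟨ +-identityʳ _ ⟩
      closed rs                                                    ∎

  -- MacMahon's master theorem.
  D-closed : ∀ rs out → rs ++ out ≡ allFin m → D rs * closed rs ≈ 1#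
  D-closed rs out eq = go (reverseView rs) out eq
    where
    closed-[] : closed [] ≈ 1#
    closed-[] []      = ind-yes (inRows? [] [] ×-dec balanced? []) ([] , λ _ → ≡.refl)
    closed-[] (a ∷ w) = ind-no (inRows? [] (a ∷ w) ×-dec balanced? (a ∷ w)) λ { (() ∷ _ , _) }
    go : ∀ {rs} → Reverse rs → ∀ out → rs ++ out ≡ allFin m → D rs * closed rs ≈ 1#
    go []             out eq = trans (*-identityˡ _) closed-[]
    go (rs ∶ v ∶ʳ t) out eq = trans (D-step rs t out eq) (go v (t ∷ out) (≡.trans (≡.sym (ListP.++-assoc rs (t ∷ []) out)) eq))

  closed-1 : ∀ rs → closed rs [] R.≈ R.1#
  closed-1 rs = ind-yes (inRows? rs [] ×-dec balanced? []) ([] , λ _ → ≡.refl)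

  -- `closed rs` has constant term 1 and therefore a right inverse, with which its left inverse
  -- `D rs` must coincide.
  closed-D : ∀ rs out → rs ++ out ≡ allFin m → closed rs * D rs ≈ 1#
  closed-D rs out eq = trans (*-congˡ (left-inverse-unique (D-closed rs out eq) (⊛-inverse (closed rs) (closed-1 rs))))
    (⊛-inverse (closed rs) (closed-1 rs))

  D-1 : ∀ rs out → rs ++ out ≡ allFin m → D rs [] R.≈ R.1#
  D-1 rs out eq = R.trans (R.sym (R.*-identityʳ _)) (R.trans (R.*-congˡ (R.sym (closed-1 rs))) (D-closed rs out eq []))

  inverse-D : ∀ rs out → rs ++ out ≡ allFin m → inverse (D rs) ≈ closed rs
  inverse-D rs out eq = left-inverse-unique (inverse-⊛ (D rs) (D-1 rs out eq)) (D-closed rs out eq)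

  module _ (rs out : List (Fin m)) (all-rows : rs ++ out ≡ allFin m) where

    minus-letter : Fin m → Fin m → Ser
    minus-letter j x = - letter x j

    -- The solution y of (I - A) y = a_{*j} on the rows `rs`, for an outer height j: `path rs p j`
    -- solves the system up to the right factor `closed rs`, which `D rs` removes.
    reduction : Fin m → Fin m → Ser
    reduction j p = path rs p j * D rs

    reduced : Fin m → Fin m → Ser
    reduced j x = add-columns column column-commute (column j) rs (reduction j) x

    reduced-kron : ∀ j x → reduced j x ≈ kron x j + add-columns column column-commute (minus-letter j) rs (reduction j) x
    reduced-kron j x = trans (add-columns-∑ (column j) rs _ x) (trans (+-assoc _ _ _)
      (+-congˡ (sym (add-columns-∑ (minus-letter j) rs _ x))))

    minor-cleared : ∀ {j x} → j ∈ out → x ∈ rs → add-columns column column-commute (minus-letter j) rs (reduction j) x ≈ 0#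
    minor-cleared {j} {x} j∈ x∈ = begin
      add-columns column column-commute (minus-letter j) rs (reduction j) x
        ≈⟨ add-columns-∑ (minus-letter j) rs _ x ⟩
      - letter x j + ∑ rs (λ p → column p x * (path rs p j * D rs))
        ≈⟨ +-congˡ (trans (∑-cong rs λ _ → sym (*-assoc _ _ _)) (∑-*ʳ rs (D rs) _)) ⟩
      - letter x j + ∑ rs (λ p → column p x * path rs p j) * D rs
        ≈⟨ +-congˡ (*-congʳ (trans (∑-column rs x _) (+-congʳ (∑-kron rs _ x∈ (unique-rs rs out all-rows))))) ⟩
      - letter x j + (path rs x j - ∑ rs (λ p → letter x p * path rs p j)) * D rs
        ≈⟨ +-congˡ (*-congʳ (+-congʳ (trans (path-step rs x∈ (disjoint rs out all-rows x∈ j∈)) (trans (all-letters-outside rs out all-rows x j j∈) (+-comm _ _))))) ⟩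
      - letter x j + (letter x j * closed rs + ∑ rs (λ p → letter x p * path rs p j) - ∑ rs (λ p → letter x p * path rs p j)) * D rs
        ≈⟨ +-congˡ (*-congʳ (trans (+-assoc _ _ _) (trans (+-congˡ (-‿inverseʳ _)) (+-identityʳ _)))) ⟩
      - letter x j + letter x j * closed rs * D rs
        ≈⟨ +-congˡ (trans (*-assoc _ _ _) (trans (*-congˡ (closed-D rs out all-rows)) (*-identityʳ _))) ⟩
      - letter x j + letter x j ≈⟨ -‿inverseˡ _ ⟩
      0# ∎

    minor : ∀ {i j} → i ∈ out → j ∈ out →
      det (map column rs ++ minus-letter j ∷ []) (rs ++ i ∷ []) ≈
      D rs * add-columns column column-commute (minus-letter j) rs (reduction j) i
    minor {i} {j} i∈ j∈ = det-last-column column column-commute rs (minus-letter j) (reduction j) rs i ≡.refl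
      (UniqueP.++⁺ (unique-rs rs out all-rows) ([] ∷ []) λ { (x∈ , here ≡.refl) → disjoint rs out all-rows x∈ i∈ ≡.refl })
      λ x x∈ → minor-cleared j∈ x∈

    -- By `minor` the eliminated entry is the bordered determinant up to the left factor `D rs`,
    -- which `closed rs` cancels. So `reduced` holds the entries of I - C.
    reduced-minor : ∀ {i j} → i ∈ out → j ∈ out →
      reduced j i ≈ kron i j + closed rs * det (map column rs ++ minus-letter j ∷ []) (rs ++ i ∷ [])
    reduced-minor {i} {j} i∈ j∈ = trans (reduced-kron j i) (+-congˡ (begin
      u                                        ≈⟨ *-identityˡ _ ⟨
      1# * u                                   ≈⟨ *-congʳ (closed-D rs out all-rows) ⟨
      closed rs * D rs * u                     ≈⟨ *-assoc _ _ _ ⟩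
      closed rs * (D rs * u)                   ≈⟨ *-congˡ (minor i∈ j∈) ⟨
      closed rs * det (map column rs ++ minus-letter j ∷ []) (rs ++ i ∷ []) ∎))
      where u = add-columns column column-commute (minus-letter j) rs (reduction j) i

    -- Eliminating the columns `out` by means of `reduction` makes I - A block triangular, with
    -- `reduced` as the diagonal block on `out`.
    sylvester : D (allFin m) ≈ D rs * det (map reduced out) out
    sylvester = trans (reflexive (≡.cong D (≡.sym all-rows)))
      (det-eliminate column column-commute rs out reduction rs out ≡.refl ≡.refl (unique rs out all-rows) λ j j∈ x x∈ →
        trans (reduced-kron j x) (trans (+-cong (kron-no {i = x} {j} (disjoint rs out all-rows x∈ j∈)) (minor-cleared j∈ x∈)) (+-identityˡ _)))

    det-reduced : det (map reduced out) out ≈ closed rs * D (allFin m)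
    det-reduced = sym (begin
      closed rs * D (allFin m)                           ≈⟨ *-congˡ sylvester ⟩
      closed rs * (D rs * det (map reduced out) out)     ≈⟨ *-assoc _ _ _ ⟨
      closed rs * D rs * det (map reduced out) out       ≈⟨ *-congʳ (closed-D rs out all-rows) ⟩
      1# * det (map reduced out) out                     ≈⟨ *-identityˡ _ ⟩
      det (map reduced out) out                          ∎)

    det-reduced-1 : det (map reduced out) out [] R.≈ R.1#
    det-reduced-1 = R.trans (det-reduced []) (R.trans (R.*-cong (closed-1 rs) (D-1 (allFin m) [] (ListP.++-identityʳ _))) (R.*-identityʳ _))

    -- The generating function of the words without a final cycle inside rs.
    outermost : Ser
    outermost = closed (allFin m) * D rs

    outermost-inverse : outermost * det (map reduced out) out ≈ 1#
    outermost-inverse = begin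
      closed (allFin m) * D rs * det (map reduced out) out    ≈⟨ *-assoc _ _ _ ⟩
      closed (allFin m) * (D rs * det (map reduced out) out)  ≈⟨ *-congˡ sylvester ⟨
      closed (allFin m) * D (allFin m)                        ≈⟨ closed-D (allFin m) [] (ListP.++-identityʳ _) ⟩
      1#                                                      ∎

-- Reindexing determinants and splitting the set of heights

module Reindexing (A : Ring 0ℓ 0ℓ) {V W : Set} where
  open Ring A
  private
    module AV = Alternating A {V}
    module AW = Alternating A {W}

  Alt-map : ∀ (f : V → W) xs F → AW.Alt (map f xs) F ≈ AV.Alt xs (λ x r → F (f x) (map f r))
  Alt-map f []       F = refl
  Alt-map f (x ∷ xs) F = +-congˡ (-‿cong (Alt-map f xs (λ y r → F y (f x ∷ r))))

  Det-map : ∀ (f : V → W) cs rs K → AW.Det cs (map f rs) K ≈ AV.Det (map (_∘ f) cs) rs (K ∘ map f)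
  Det-map f []       rs K = refl
  Det-map f (c ∷ cs) rs K = trans (Alt-map f rs _) (AV.Alt-cong rs λ x r _ → *-congˡ (Det-map f cs r K))

allFin-suc : ∀ n → allFin (suc n) ≡ Fin.zero ∷ map Fin.suc (allFin n)
allFin-suc n = ≡.cong (Fin.zero ∷_) (≡.sym (ListP.map-tabulate (λ i → i) Fin.suc))

allFin-+ : ∀ n k → allFin (n ℕ.+ k) ≡ map (Fin._↑ˡ k) (allFin n) ++ map (n Fin.↑ʳ_) (allFin k)
allFin-+ zero    k = ≡.sym (ListP.map-id _)
allFin-+ (suc n) k = ≡.trans (allFin-suc (n ℕ.+ k)) (≡.trans
  (≡.cong (λ xs → Fin.zero ∷ map Fin.suc xs) (allFin-+ n k))
  (≡.trans (≡.cong (Fin.zero ∷_) (≡.trans (ListP.map-++ Fin.suc (map (Fin._↑ˡ k) (allFin n)) _)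
      (≡.cong₂ _++_ (≡.trans (≡.sym (ListP.map-∘ (allFin n))) (ListP.map-∘ (allFin n))) (≡.sym (ListP.map-∘ (allFin k))))))
    (≡.cong (λ xs → map (Fin._↑ˡ k) xs ++ map (suc n Fin.↑ʳ_) (allFin k)) (≡.sym (allFin-suc n)))))

allFin-cast : ∀ {k m} (eq : k ≡ m) → map (Fin.cast eq) (allFin k) ≡ allFin m
allFin-cast ≡.refl = ≡.trans (ListP.map-cong (FinP.cast-is-id ≡.refl) _) (ListP.map-id _)

-- The left-hand side in the quotient

module LeftHandSide (K : QAlgebra) (m n : ℕ) (n<m : n < m) where
  open QAlgebra K using (R)
  open Series K m
  open Matrices n n<m
  open PushSeries K m
  open Powers K m using ()
  open Walks K m
  open Sylvester K m
  open Ring ring⊛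
  open import Relation.Binary.Reasoning.Setoid setoid
  private
    module R = CommutativeRing R

  inner outer : List (Fin m)
  inner = map inj (allFin n)
  outer = map emb (allFin (m ∸ n))

  inner++outer : inner ++ outer ≡ allFin m
  inner++outer = ≡.trans (≡.cong (_++ outer) (ListP.map-cong inj≗ (allFin n))) (≡.trans
    (≡.cong₂ _++_ (ListP.map-∘ (allFin n)) (ListP.map-∘ (allFin (m ∸ n)))) (≡.trans
    (≡.sym (ListP.map-++ (Fin.cast eq) (map (Fin._↑ˡ (m ∸ n)) (allFin n)) _)) (≡.trans
    (≡.cong (map (Fin.cast eq)) (≡.sym (allFin-+ n (m ∸ n)))) (allFin-cast eq))))
    where
    eq : n ℕ.+ (m ∸ n) ≡ m
    eq = ℕP.m+[n∸m]≡n (ℕP.<⇒≤ n<m)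
    inj≗ : ∀ i → inj i ≡ Fin.cast eq (i Fin.↑ˡ (m ∸ n))
    inj≗ i = FinP.toℕ-injective (≡.trans (FinP.toℕ-inject≤ i _) (≡.sym (≡.trans (FinP.toℕ-cast eq _) (FinP.toℕ-↑ˡ i (m ∸ n)))))

  inj∈ : ∀ i → inj i ∈ inner
  inj∈ i = MemP.∈-map⁺ inj (MemP.∈-allFin i)

  emb∈ : ∀ p → emb p ∈ outer
  emb∈ p = MemP.∈-map⁺ emb (MemP.∈-allFin p)

  kron-injective : ∀ {N N′} (f : Fin N → Fin N′) → (∀ {i j} → f i ≡ f j → i ≡ j) → ∀ i j → kron i j ≈ kron (f i) (f j)
  kron-injective f f-inj i j with i FinP.≟ j
  ... | yes ≡.refl = sym (kron-yes (f i))
  ... | no  i≢j    = sym (kron-no λ e → i≢j (f-inj e))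

  inj-injective : ∀ {i j} → inj i ≡ inj j → i ≡ j
  inj-injective = FinP.inject≤-injective (ℕP.<⇒≤ n<m) (ℕP.<⇒≤ n<m) _ _

  emb-injective : ∀ {p q} → emb p ≡ emb q → p ≡ q
  emb-injective {p} {q} e = FinP.↑ʳ-injective n p q (FinP.toℕ-injective
    (≡.trans (≡.sym (FinP.toℕ-cast _ _)) (≡.trans (≡.cong toℕ e) (FinP.toℕ-cast _ _))))

  push-I-A₀ : ∀ r s → push (I-A₀ r s) ≈ column (inj s) (inj r)
  push-I-A₀ r s = trans (push--S- (kronS r s) (letter (inj r) (inj s)))
    (+-cong (trans (push-kronS r s) (kron-injective inj inj-injective r s)) (-‿cong (push-letter (inj r) (inj s))))

  push-det-I-A₀ : push (detS I-A₀) ≈ D inner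
  push-det-I-A₀ = begin
    push (detS I-A₀)                                                       ≈⟨ push-detS I-A₀ ⟩
    Alternating.det ring⊛ (map (λ q x → push (I-A₀ x q)) (allFin n)) (allFin n)
      ≈⟨ Alternating.Det-columns-cong ring⊛ _ _ (λ q x → push-I-A₀ x q) (allFin n) (allFin n) _ ⟩
    Alternating.det ring⊛ (map (λ q x → column (inj q) (inj x)) (allFin n)) (allFin n)
      ≡⟨ ≡.cong (λ cs → Alternating.det ring⊛ cs (allFin n)) (≡.trans (ListP.map-∘ (allFin n)) (ListP.map-∘ inner′)) ⟩
    Alternating.det ring⊛ (map (_∘ inj) (map column (map inj (allFin n)))) (allFin n)
      ≈⟨ Reindexing.Det-map ring⊛ inj (map column inner) (allFin n) _ ⟨
    D inner ∎
    where inner′ = map inj (allFin n)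

  toInner-all : ∀ N → map (toInner {N}) (allFin (suc N)) ≡ map just (allFin N) ++ nothing ∷ []
  toInner-all zero    = ≡.refl
  toInner-all (suc N) = ≡.trans (≡.cong (map toInner) (allFin-suc (suc N))) (≡.cong (just Fin.zero ∷_) (≡.trans
    (≡.sym (ListP.map-∘ (allFin (suc N)))) (≡.trans (ListP.map-∘ (allFin (suc N))) (≡.trans
    (≡.cong (map (Maybe.map Fin.suc)) (toInner-all N)) (≡.trans
    (ListP.map-++ (Maybe.map Fin.suc) (map just (allFin N)) _)
    (≡.cong (_++ nothing ∷ []) (≡.trans (≡.sym (ListP.map-∘ (allFin N))) (≡.trans (ListP.map-∘ (allFin N)) (
      ≡.cong (map just) (ListP.map-tabulate (λ i → i) Fin.suc))))))))))

  bordered : ∀ {X : Set} (f : Fin n → X) (x : X) →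
    map (λ r → maybe′ f x (toInner r)) (allFin (suc n)) ≡ map f (allFin n) ++ x ∷ []
  bordered f x = ≡.trans (ListP.map-∘ (allFin (suc n))) (≡.trans (≡.cong (map (maybe′ f x)) (toInner-all n))
    (≡.trans (ListP.map-++ (maybe′ f x) (map just (allFin n)) _) (≡.cong (_++ x ∷ []) (≡.sym (ListP.map-∘ (allFin n))))))

  module _ {i j : Fin m} (i∈ : i ∈ outer) where

    row : Fin (suc n) → Fin m
    row r = maybe′ inj i (toInner r)

    border : Fin (suc n) → Fin m → Ser
    border s = maybe′ (column ∘ inj) (minus-letter inner outer inner++outer j) (toInner s)

    push-block : ∀ r s → push (block i j r s) ≈ border s (row r)
    push-block r s with toInner r | toInner s
    ... | just r′ | just s′ = push-I-A₀ r′ s′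
    ... | just r′ | nothing = trans (push--S _) (-‿cong (push-letter _ _))
    -- `column` carries a Kronecker term that the bordered matrix does not show; it vanishes because
    -- `i` is an outer height and `inj s′` an inner one.
    ... | nothing | just s′ = trans (push--S _) (trans (-‿cong (push-letter _ _)) (trans (sym (+-identityˡ _))
          (+-congʳ (sym (kron-no {i = i} {inj s′} λ e → disjoint inner outer inner++outer (inj∈ s′) i∈ (≡.sym e))))))
    ... | nothing | nothing = trans (push--S _) (-‿cong (push-letter _ _))

    push-det-block : push (detS (block i j)) ≈
      Alternating.det ring⊛ (map column inner ++ minus-letter inner outer inner++outer j ∷ []) (inner ++ i ∷ [])
    push-det-block = begin
      push (detS (block i j))  ≈⟨ push-detS (block i j) ⟩
      Alternating.det ring⊛ (map (λ q x → push (block i j x q)) (allFin (suc n))) (allFin (suc n))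
        ≈⟨ Alternating.Det-columns-cong ring⊛ _ _ (λ q x → push-block x q) (allFin (suc n)) (allFin (suc n)) _ ⟩
      Alternating.det ring⊛ (map (λ q → border q ∘ row) (allFin (suc n))) (allFin (suc n))
        ≡⟨ ≡.cong (λ cs → Alternating.det ring⊛ cs (allFin (suc n))) (ListP.map-∘ (allFin (suc n))) ⟩
      Alternating.det ring⊛ (map (_∘ row) (map border (allFin (suc n)))) (allFin (suc n))
        ≈⟨ Reindexing.Det-map ring⊛ row (map border (allFin (suc n))) (allFin (suc n)) _ ⟨
      Alternating.det ring⊛ (map border (allFin (suc n))) (map row (allFin (suc n)))
        ≡⟨ ≡.cong₂ (Alternating.det ring⊛) (≡.trans (bordered (column ∘ inj) _) (≡.cong (_++ minus-letter inner outer inner++outer j ∷ []) (ListP.map-∘ (allFin n)))) (bordered inj i) ⟩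
      Alternating.det ring⊛ (map column inner ++ minus-letter inner outer inner++outer j ∷ []) (inner ++ i ∷ []) ∎

  reduced-outer : Fin m → Fin m → Ser
  reduced-outer = reduced inner outer inner++outer

  Z : Ser
  Z = Alternating.det ring⊛ (map reduced-outer outer) outer

  push-I-C : ∀ p q → push (I-C p q) ≈ reduced-outer (emb q) (emb p)
  push-I-C p q = begin
    push (I-C p q)
      ≈⟨ push--S- (kronS p q) (c (emb p) (emb q)) ⟩
    push (kronS p q) - push (c (emb p) (emb q))
      ≈⟨ +-cong (trans (push-kronS p q) (kron-injective emb emb-injective p q))
           (trans (-‿cong (push--S _)) (-‿involutive _)) ⟩
    kron (emb p) (emb q) + push (invS (detS I-A₀) *S detS (block (emb p) (emb q)))
      ≈⟨ +-congˡ (trans (push-*S _ _) (*-cong (trans (push-invS _) (trans (inverse-cong push-det-I-A₀)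
           (inverse-D inner outer inner++outer))) (push-det-block (emb∈ p)))) ⟩
    kron (emb p) (emb q) + closed inner * Alternating.det ring⊛ (map column inner ++ minus-letter inner outer inner++outer (emb q) ∷ []) (inner ++ emb p ∷ [])
      ≈⟨ reduced-minor inner outer inner++outer (emb∈ p) (emb∈ q) ⟨
    reduced-outer (emb q) (emb p) ∎
    where open import Algebra.Properties.Ring ring⊛ using (-‿involutive)

  push-det-I-C : push (detS I-C) ≈ Z
  push-det-I-C = begin
    push (detS I-C) ≈⟨ push-detS I-C ⟩
    Alternating.det ring⊛ (map (λ q x → push (I-C x q)) (allFin (m ∸ n))) (allFin (m ∸ n))
      ≈⟨ Alternating.Det-columns-cong ring⊛ _ _ (λ q x → push-I-C x q) (allFin (m ∸ n)) (allFin (m ∸ n)) _ ⟩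
    Alternating.det ring⊛ (map (λ q → reduced-outer (emb q) ∘ emb) (allFin (m ∸ n))) (allFin (m ∸ n))
      ≡⟨ ≡.cong (λ cs → Alternating.det ring⊛ cs (allFin (m ∸ n))) (≡.trans (ListP.map-∘ (allFin (m ∸ n))) (ListP.map-∘ outer)) ⟩
    Alternating.det ring⊛ (map (_∘ emb) (map reduced-outer outer)) (allFin (m ∸ n))
      ≈⟨ Reindexing.Det-map ring⊛ emb (map reduced-outer outer) (allFin (m ∸ n)) _ ⟨
    Z ∎

  push-lhs : ∀ β → push (lhs β) ≈ power β (1# - Z)
  push-lhs β = trans (push-powβ β _) (power-cong β (trans (push--S- oneS (detS I-C)) (+-cong push-oneS (-‿cong push-det-I-C))))

-- Commutation classes, and series supported on balanced words

module Invariance (K : QAlgebra) (m : ℕ) where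
  open QAlgebra K using (R)
  open CommutativeRing R
  open import Relation.Binary.Reasoning.Setoid setoid
  open RingSolving R using (solve; _:=_; _:+_; _:*_)
  open Series K m hiding (ind)
  open PushSeries K m
  open Walks K m
  open Sylvester K m using (D; D-closed; closed-1)
  open Powers K m using (⊛-inverse; left-inverse-unique)
  open Sums ring

  infix 4 _~_
  data _~_ : Word → Word → Set where
    ~refl  : ∀ {w} → w ~ w
    ~prep  : ∀ x {v w} → v ~ w → x ∷ v ~ x ∷ w
    ~swap  : ∀ {x y w} → proj₁ x ≢ proj₁ y → x ∷ y ∷ w ~ y ∷ x ∷ w
    ~trans : ∀ {u v w} → u ~ v → v ~ w → u ~ w

  ~⇒↭ : ∀ {v w} → v ~ w → v ↭ w
  ~⇒↭ ~refl        = Perm.refl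
  ~⇒↭ (~prep x p)  = Perm.prep x (~⇒↭ p)
  ~⇒↭ (~swap _)    = Perm.swap _ _ Perm.refl
  ~⇒↭ (~trans p q) = Perm.trans (~⇒↭ p) (~⇒↭ q)

  ~-sym : ∀ {v w} → v ~ w → w ~ v
  ~-sym ~refl        = ~refl
  ~-sym (~prep x p)  = ~prep x (~-sym p)
  ~-sym (~swap x≢y)  = ~swap λ e → x≢y (≡.sym e)
  ~-sym (~trans p q) = ~trans (~-sym q) (~-sym p)

  ~-++ˡ : ∀ u {v w} → v ~ w → u ++ v ~ u ++ w
  ~-++ˡ []      p = p
  ~-++ˡ (x ∷ u) p = ~prep x (~-++ˡ u p)

  Invariant : Ser → Set
  Invariant f = ∀ {v w} → v ~ w → f v ≈ f w

  clear-~ : ∀ x {v w} → v ~ w → ind (clear x v) ≈ ind (clear x w)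
  clear-~ x p = reflexive (≡.cong ind (all-↭ _ (~⇒↭ p)))

  -- When the two head letters are swapped, terms with both letters in the same factor agree by the
  -- invariance of `F`, and the two terms that separate the letters change places.
  CS-~ : ∀ {v w} → v ~ w → ∀ F → (∀ {S S′} T → S ~ S′ → F S T ≈ F S′ T) → (∀ S {T T′} → T ~ T′ → F S T ≈ F S T′) →
    CS v F ≈ CS w F
  CS-~ ~refl         F l r = refl
  CS-~ (~trans p q)  F l r = trans (CS-~ p F l r) (CS-~ q F l r)
  CS-~ (~prep x p)   F l r = CS-~ p _
    (λ T q → +-cong (l T (~prep x q)) (*-cong (clear-~ x q) (l (x ∷ T) q)))
    (λ S q → +-cong (r (x ∷ S) q) (*-congˡ (r S (~prep x q))))
  CS-~ (~swap {x} {y} {w} x≢y) F l r = CS-cong w λ {S} {T} _ → begin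
    (F (x ∷ y ∷ S) T + ind (apart y x ∧ clear x S) * F (y ∷ S) (x ∷ T))
      + ind (clear y S) * (F (x ∷ S) (y ∷ T) + ind (clear x S) * F S (x ∷ y ∷ T))
      ≈⟨ +-cong (+-cong (l T (~swap x≢y)) (*-congʳ (reflexive (≡.cong (λ b → ind (b ∧ clear x S)) (apart-yes {y} {x} λ e → x≢y (≡.sym e))))))
           (*-congˡ (+-congˡ (*-congˡ (r S (~swap x≢y))))) ⟩
    (F (y ∷ x ∷ S) T + ind (clear x S) * F (y ∷ S) (x ∷ T))
      + ind (clear y S) * (F (x ∷ S) (y ∷ T) + ind (clear x S) * F S (y ∷ x ∷ T))
      ≈⟨ solve 6 (λ A a B b C E → (A :+ a :* B) :+ b :* (C :+ a :* E) := (A :+ b :* C) :+ a :* (B :+ b :* E)) refl _ _ _ _ _ _ ⟩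
    (F (y ∷ x ∷ S) T + ind (clear y S) * F (x ∷ S) (y ∷ T))
      + ind (clear x S) * (F (y ∷ S) (x ∷ T) + ind (clear y S) * F S (y ∷ x ∷ T))
      ≈⟨ +-congʳ (+-congˡ (*-congʳ (reflexive (≡.cong (λ b → ind (b ∧ clear y S)) (apart-yes {x} {y} x≢y))))) ⟨
    (F (y ∷ x ∷ S) T + ind (apart x y ∧ clear y S) * F (x ∷ S) (y ∷ T))
      + ind (clear x S) * (F (y ∷ S) (x ∷ T) + ind (clear y S) * F S (y ∷ x ∷ T)) ∎

  count-++ : ∀ h xs ys → count h (xs ++ ys) ≡ count h xs ℕ.+ count h ys
  count-++ h xs ys = ≡.trans (≡.cong length (ListP.filter-++ (h FinP.≟_) xs ys)) (ListP.length-++ (filter (h FinP.≟_) xs))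

  count-↭ : ∀ h {xs ys} → xs ↭ ys → count h xs ≡ count h ys
  count-↭ h p = PermP.↭-length (PermP.filter-↭ (h FinP.≟_) p)

  rows-↭ : ∀ h {v w} → v ↭ w → rows h v ≡ rows h w
  rows-↭ h p = count-↭ h (PermP.map⁺ proj₁ p)

  cols-↭ : ∀ h {v w} → v ↭ w → cols h v ≡ cols h w
  cols-↭ h p = count-↭ h (PermP.map⁺ proj₂ p)

  rows-++ : ∀ h v w → rows h (v ++ w) ≡ rows h v ℕ.+ rows h w
  rows-++ h v w = ≡.trans (≡.cong (count h) (ListP.map-++ proj₁ v w)) (count-++ h (map proj₁ v) _)

  cols-++ : ∀ h v w → cols h (v ++ w) ≡ cols h v ℕ.+ cols h w
  cols-++ h v w = ≡.trans (≡.cong (count h) (ListP.map-++ proj₂ v w)) (count-++ h (map proj₂ v) _)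

  Balanced-↭ : ∀ {v w} → v ↭ w → Balanced v → Balanced w
  Balanced-↭ p b h = ≡.trans (≡.sym (rows-↭ h p)) (≡.trans (b h) (cols-↭ h p))

  Balanced-++ : ∀ v w → Balanced v → Balanced w → Balanced (v ++ w)
  Balanced-++ v w b b′ h = ≡.trans (rows-++ h v w) (≡.trans (≡.cong₂ ℕ._+_ (b h) (b′ h)) (≡.sym (cols-++ h v w)))

  Balanced-++⁻ʳ : ∀ v w → Balanced v → Balanced (v ++ w) → Balanced w
  Balanced-++⁻ʳ v w b b′ h = ℕP.+-cancelˡ-≡ (rows h v) _ _ (≡.trans (≡.sym (rows-++ h v w)) (≡.trans (b′ h)
    (≡.trans (cols-++ h v w) (≡.cong (ℕ._+ cols h w) (≡.sym (b h))))))

  Supported : Ser → Set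
  Supported f = ∀ w → ¬ Balanced w → f w ≈ 0#

  -- Invariance lets a word be replaced by the product of its cycles; support on balanced words lets
  -- each cycle be treated as an indivisible letter.
  Good : Ser → Set
  Good f = Invariant f × Supported f

  good-≋ : ∀ {f g} → f ≋ g → Good f → Good g
  good-≋ e (i , s) = (λ {v} {w} p → trans (sym (e v)) (trans (i p) (e w))) , λ w ¬b → trans (sym (e w)) (s w ¬b)

  good-one : Good one
  good-one = (λ p → inv (~⇒↭ p)) , λ { [] ¬b → ⊥-elim (¬b λ _ → ≡.refl) ; (_ ∷ _) _ → refl }
    where
    inv : ∀ {v w} → v ↭ w → one v ≈ one w
    inv {[]}    {[]}    p = refl
    inv {[]}    {_ ∷ _} p = ⊥-elim (PermP.¬x∷xs↭[] (Perm.↭-sym p))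
    inv {_ ∷ _} {[]}    p = ⊥-elim (PermP.¬x∷xs↭[] p)
    inv {_ ∷ _} {_ ∷ _} p = refl

  good-sub : ∀ {f g} → Good f → Good g → Good (f P.- g)
  good-sub (i , s) (i′ , s′) = (λ p → +-cong (i p) (-‿cong (i′ p))) ,
    λ w ¬b → trans (+-cong (s w ¬b) (-‿cong (s′ w ¬b))) (-‿inverseʳ 0#)

  good-⊛ : ∀ {f g} → Good f → Good g → Good (f ⊛ g)
  good-⊛ {f} {g} (i , s) (i′ , s′) =
    (λ p → CS-~ p _ (λ T q → *-congʳ (i q)) (λ S q → *-congˡ (i′ q))) , λ w ¬b → CS-0 w λ { {S} {T} j → term w S T ¬b (Int.toPermutation j) }
    where
    term : ∀ w S T → ¬ Balanced w → w ↭ S ++ T → f S * g T ≈ 0#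
    term w S T ¬b p with balanced? S
    ... | no ¬bS = trans (*-congʳ (s S ¬bS)) (zeroˡ _)
    ... | yes bS = trans (*-congˡ (s′ T λ bT → ¬b (Balanced-↭ (Perm.↭-sym p) (Balanced-++ S T bS bT)))) (zeroʳ _)

  good-⊛^ : ∀ {f} → Good f → ∀ k → Good (f ⊛^ k)
  good-⊛^ g zero    = good-one
  good-⊛^ g (suc k) = good-⊛ g (good-⊛^ g k)

  good-graded : ∀ (c : ℕ → Carrier) (f : ℕ → Ser) → (∀ r → Good (f r)) →
    Good (λ w → ∑ (upTo (suc (length w))) (λ r → c r * f r w))
  good-graded c f g = (λ {v} {w} p → trans
      (reflexive (≡.cong (λ k → ∑ (upTo (suc k)) (λ r → c r * f r v)) (PermP.↭-length (~⇒↭ p))))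
      (∑-cong (upTo (suc (length w))) λ {r} _ → *-congˡ (proj₁ (g r) p))) ,
    λ w ¬b → ∑-0 (upTo (suc (length w))) λ {r} _ → trans (*-congˡ (proj₂ (g r) w ¬b)) (zeroʳ _)

  good-power : ∀ β {s} → Good s → Good (power β s)
  good-power β g = good-graded _ _ (good-⊛^ g)

  good-inverse : ∀ {f} → Good f → Good (inverse f)
  good-inverse g = good-≋ (λ w → ∑-cong (upTo (suc (length w))) λ _ → *-identityˡ _)
    (good-graded (λ _ → 1#) _ (good-⊛^ (good-sub good-one g)))

  good-closed : ∀ rs → Good (closed rs)
  good-closed rs = (λ {v} {w} p → ind-⇔ (inRows? rs v ×-dec balanced? v) (inRows? rs w ×-dec balanced? w)
      (transport (~⇒↭ p)) (transport (Perm.↭-sym (~⇒↭ p)))) ,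
    λ w ¬b → ind-no (inRows? rs w ×-dec balanced? w) λ (_ , b) → ¬b b
    where
    transport : ∀ {v w} → v ↭ w → InRows rs v × Balanced v → InRows rs w × Balanced w
    transport p (r , b) = PermP.All-resp-↭ p r , Balanced-↭ p b

  -- The determinant does not display these properties, but as the inverse of `closed rs` it
  -- inherits them.
  good-D : ∀ rs out → rs ++ out ≡ allFin m → Good (D rs)
  good-D rs out eq = good-≋ (P.sym (left-inverse-unique (D-closed rs out eq) (⊛-inverse (closed rs) (closed-1 rs))))
    (good-inverse (good-closed rs))

-- Sorting words modulo the Cartier-Foata ideal

module NormalForm (K : QAlgebra) (m : ℕ) where
  open QAlgebra K using (R)
  open CommutativeRing R
  open import Relation.Binary.Reasoning.Setoid setoid
  open import Algebra.Properties.Ring ring using (x[y-z]≈xy-xz)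
  open RingSolving R using (solve; _:=_; _:+_; _:*_; _:-_; :-_)
  open Series K m hiding (ind)
  open PushSeries K m
  open Walks K m
  open Sums ring

  _≟ᴸ_ : (x y : Letter) → Dec (x ≡ y)
  _≟ᴸ_ = ProdP.≡-dec FinP._≟_ FinP._≟_

  ind-× : ∀ {A B : Set} (a : Dec A) (b : Dec B) → ind ⌊ a ×-dec b ⌋ ≈ ind ⌊ a ⌋ * ind ⌊ b ⌋
  ind-× (yes _) (yes _) = sym (*-identityˡ _)
  ind-× (yes _) (no _)  = sym (*-identityˡ _)
  ind-× (no _)  _       = sym (zeroˡ _)

  ==W-∷ : ∀ x y u w → ind ((x ∷ u) ==W (y ∷ w)) ≈ ind ⌊ x ≟ᴸ y ⌋ * ind (u ==W w)
  ==W-∷ x y u w = trans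
    (ind-⇔ ((x ∷ u) ≟W (y ∷ w)) ((x ≟ᴸ y) ×-dec (u ≟W w)) ListP.∷-injective (λ (e , e′) → ≡.cong₂ _∷_ e e′))
    (ind-× (x ≟ᴸ y) (u ≟W w))

  letters : List Letter
  letters = cartesianProduct (allFin m) (allFin m)

  ∑-letters : ∀ a (f : Letter → Carrier) → ∑ letters (λ x → ind ⌊ x ≟ᴸ a ⌋ * f x) ≈ f a
  ∑-letters a f = select letters (MemP.∈-cartesianProduct⁺ (MemP.∈-allFin _) (MemP.∈-allFin _))
    (UniqueP.cartesianProduct⁺ (UniqueP.allFin⁺ m) (UniqueP.allFin⁺ m))
    where
    none : ∀ xs → All (a ≢_) xs → ∑ xs (λ x → ind ⌊ x ≟ᴸ a ⌋ * f x) ≈ 0#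
    none xs all = ∑-0 xs λ {x} x∈ → trans (*-congʳ (ind-no (x ≟ᴸ a) λ x≡a → All.lookup all x∈ (≡.sym x≡a))) (zeroˡ _)
    select : ∀ xs → a ∈ xs → Unique xs → ∑ xs (λ x → ind ⌊ x ≟ᴸ a ⌋ * f x) ≈ f a
    select (x ∷ xs) (here ≡.refl) (x∉ ∷ u) = trans (+-cong (trans (*-congʳ (ind-yes (a ≟ᴸ a) ≡.refl)) (*-identityˡ _)) (none xs x∉)) (+-identityʳ _)
    select (x ∷ xs) (there a∈)    (x∉ ∷ u) = trans (+-cong (trans (*-congʳ (ind-no (x ≟ᴸ a) λ { ≡.refl → All.lookup x∉ a∈ ≡.refl })) (zeroˡ _)) (select xs a∈ u)) (+-identityˡ _)

  words : ℕ → List Word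
  words zero    = [] ∷ []
  words (suc N) = [] ∷ concatMap (λ x → map (x ∷_) (words N)) letters

  ∑-words : ∀ N w (f : Word → Carrier) → length w ≤ N → ∑ (words N) (λ s → f s * ind (s ==W w)) ≈ f w
  ∑-words zero    []      f _        = trans (+-identityʳ _) (*-identityʳ _)
  ∑-words (suc N) []      f _        = trans (+-cong (*-identityʳ _) (trans (∑-concatMap _ letters _)
    (∑-0 letters λ {x} _ → trans (reflexive (∑-map (x ∷_) (words N) _)) (∑-0 (words N) λ _ → zeroʳ _)))) (+-identityʳ _)
  ∑-words (suc N) (a ∷ w) f (s≤s le) = begin
    f [] * 0# + ∑ (concatMap (λ x → map (x ∷_) (words N)) letters) (λ s → f s * ind (s ==W (a ∷ w)))
      ≈⟨ +-cong (zeroʳ _) (∑-concatMap _ letters _) ⟩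
    0# + ∑ letters (λ x → ∑ (map (x ∷_) (words N)) (λ s → f s * ind (s ==W (a ∷ w))))
      ≈⟨ trans (+-identityˡ _) (∑-cong letters λ {x} _ → trans (reflexive (∑-map (x ∷_) (words N) _))
           (trans (∑-cong (words N) λ {s} _ → trans (*-congˡ (==W-∷ x a s w))
             (solve 3 (λ f i j → f :* (i :* j) := i :* (f :* j)) refl (f (x ∷ s)) _ _)) (∑-*ˡ (words N) _ _))) ⟩
    ∑ letters (λ x → ind ⌊ x ≟ᴸ a ⌋ * ∑ (words N) (λ s → f (x ∷ s) * ind (s ==W w)))
      ≈⟨ ∑-letters a _ ⟩
    ∑ (words N) (λ s → f (a ∷ s) * ind (s ==W w))
      ≈⟨ ∑-words N w (λ s → f (a ∷ s)) le ⟩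
    f (a ∷ w) ∎

  ∂ : Letter → Ser → Ser
  ∂ x h w = h (x ∷ w)

  -- Expansion by the first letter, which runs the projection along the recursion of `sorting`.
  push-∂ : ∀ h a w → push h (a ∷ w) ≈ ∑ letters (λ x → (letter (proj₁ x) (proj₂ x) ⊛ push (∂ x h)) (a ∷ w))
  push-∂ h a w = trans (push-cong (a ∷ w) λ { [] p → ⊥-elim (PermP.¬x∷xs↭[] p) ; (y ∷ v) _ → sym (expansion y v) })
    (trans (push-∑ (a ∷ w) letters _) (∑-cong letters λ {x} _ → trans (push-*S _ (∂ x h) (a ∷ w))
      (⊛-cong (push-letter (proj₁ x) (proj₂ x)) P.refl (a ∷ w))))
    where
    first : ∀ x y v → (letter (proj₁ x) (proj₂ x) *S ∂ x h) (y ∷ v) ≈ ind ⌊ x ≟ᴸ y ⌋ * h (x ∷ v)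
    first x y v = begin
      (letter (proj₁ x) (proj₂ x) *S ∂ x h) (y ∷ v)
        ≈⟨ ∑-splits (y ∷ v) (λ p q → letter (proj₁ x) (proj₂ x) p * h (x ∷ q)) ⟩
      0# * h (x ∷ y ∷ v) + SP v (λ p q → ind ((x ∷ []) ==W (y ∷ p)) * h (x ∷ q))
        ≈⟨ +-cong (zeroˡ _) (SP-cong v λ p q → trans (*-congʳ (==W-∷ x y [] p)) (*-assoc _ _ _)) ⟩
      0# + SP v (λ p q → ind ⌊ x ≟ᴸ y ⌋ * (ind ([] ==W p) * h (x ∷ q)))
        ≈⟨ trans (+-identityˡ _) (SP-* v _ _) ⟩
      ind ⌊ x ≟ᴸ y ⌋ * SP v (λ p q → ind ([] ==W p) * h (x ∷ q))
        ≈⟨ *-congˡ (unit v) ⟩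
      ind ⌊ x ≟ᴸ y ⌋ * h (x ∷ v) ∎
      where
      unit : ∀ v → SP v (λ p q → ind ([] ==W p) * h (x ∷ q)) ≈ h (x ∷ v)
      unit []      = *-identityˡ _
      unit (z ∷ v) = trans (+-cong (*-identityˡ _) (trans (SP-* v 0# (λ p q → h (x ∷ q))) (zeroˡ _))) (+-identityʳ _)
    expansion : ∀ y v → ∑ letters (λ x → (letter (proj₁ x) (proj₂ x) *S ∂ x h) (y ∷ v)) ≈ h (y ∷ v)
    expansion y v = trans (∑-cong letters λ {x} _ → first x y v) (∑-letters y _)

  Sorted : Word → Set
  Sorted = AllPairs (λ a b → proj₁ a Fin.≤ proj₁ b)

  sorted? : ∀ w → Dec (Sorted w)
  sorted? = AllPairs.allPairs? (λ a b → proj₁ a FinP.≤? proj₁ b)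

  -- Every commutation class contains exactly one word with non-decreasing rows; that word receives
  -- the sum of `h` over the class.
  normalForm : Ser → Ser
  normalForm h w = ind ⌊ sorted? w ⌋ * push h w

  -- The strict comparison stops `x` in front of the letters of its own row, with which it does not
  -- commute.
  insertRow : Letter → Word → Word
  insertRow x []      = x ∷ []
  insertRow x (y ∷ s) = if ⌊ proj₁ y FinP.<? proj₁ x ⌋ then y ∷ insertRow x s else x ∷ y ∷ s

  insertRow-pop : ∀ i q s → Pop i (insertRow (i , q) s) q s
  insertRow-pop i q []      = here
  insertRow-pop i q (y ∷ s) with proj₁ y FinP.<? i
  ... | yes y<i = there (λ { ≡.refl → FinP.<-irrefl ≡.refl y<i }) (insertRow-pop i q s)
  ... | no  _   = here

  insertRow-All : ∀ {Q : Letter → Set} x s → Q x → All Q s → All Q (insertRow x s)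
  insertRow-All x []      qx _        = qx ∷ []
  insertRow-All x (y ∷ s) qx (qy ∷ qs) with proj₁ y FinP.<? proj₁ x
  ... | yes _ = qy ∷ insertRow-All x s qx qs
  ... | no  _ = qx ∷ qy ∷ qs

  insertRow-sorted : ∀ x s → Sorted s → Sorted (insertRow x s)
  insertRow-sorted x []      _        = [] ∷ []
  insertRow-sorted x (y ∷ s) (y≤ ∷ σ) with proj₁ y FinP.<? proj₁ x
  ... | yes y<x = insertRow-All x s (ℕP.<⇒≤ y<x) y≤ ∷ insertRow-sorted x s σ
  ... | no  y≮x = (ℕP.≮⇒≥ y≮x ∷ All.map (FinP.≤-trans (ℕP.≮⇒≥ y≮x)) y≤) ∷ y≤ ∷ σ

  pop-functional : ∀ {i w q q′ r r′} → Pop i w q r → Pop i w q′ r′ → q ≡ q′ × r ≡ r′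
  pop-functional here          here           = ≡.refl , ≡.refl
  pop-functional here          (there a≢i _)  = ⊥-elim (a≢i ≡.refl)
  pop-functional (there a≢i _) here           = ⊥-elim (a≢i ≡.refl)
  pop-functional (there _ x)   (there _ y) with pop-functional x y
  ... | e , ≡.refl = e , ≡.refl

  pop-Allᴸ : ∀ {Q : Letter → Set} {i q w r} → Pop i w q r → All Q w → Q (i , q) × All Q r
  pop-Allᴸ here        (p ∷ ps) = p , ps
  pop-Allᴸ (there _ x) (p ∷ ps) with pop-Allᴸ x ps
  ... | qi , qr = qi , p ∷ qr

  pop-sorted : ∀ {i q w r} → Pop i w q r → Sorted w → Sorted r
  pop-sorted here        (_ ∷ σ)  = σ
  pop-sorted (there _ x) (a≤ ∷ σ) = proj₂ (pop-Allᴸ x a≤) ∷ pop-sorted x σ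

  pop-insertRow : ∀ {i q w r} → Pop i w q r → Sorted w → insertRow (i , q) r ≡ w
  pop-insertRow {r = []}    here _ = ≡.refl
  pop-insertRow {i} {q} {r = y ∷ r} here ((i≤y ∷ _) ∷ _) with proj₁ y FinP.<? i
  ... | yes y<i = ⊥-elim (ℕP.<⇒≱ y<i i≤y)
  ... | no  _   = ≡.refl
  pop-insertRow {i} (there {a} a≢i x) (a≤ ∷ σ) with proj₁ a FinP.<? i
  ... | yes _   = ≡.cong (a ∷_) (pop-insertRow x σ)
  ... | no  a≮i = ⊥-elim (a≮i (FinP.≤∧≢⇒< (proj₁ (pop-Allᴸ x a≤)) a≢i))

  -- Inserting a letter into a sorted word and popping its row are inverse to each other, so a
  -- sorted `w` arises from at most one sorted `s`.
  ∑-insertRow : ∀ N x (F : Ser) w → length w ≤ suc N →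
    ∑ (words N) (λ s → ind ⌊ sorted? s ⌋ * F s * ind (insertRow x s ==W w)) ≈
    ind ⌊ sorted? w ⌋ * (letter (proj₁ x) (proj₂ x) ⊛ F) w
  ∑-insertRow N (i , q) F w le with sorted? w
  ... | no ¬σ = trans (∑-0 (words N) (λ {s} _ → vanish s)) (sym (zeroˡ _))
    where
    vanish : ∀ s → ind ⌊ sorted? s ⌋ * F s * ind (insertRow (i , q) s ==W w) ≈ 0#
    vanish s with sorted? s
    ... | no _  = trans (*-congʳ (zeroˡ _)) (zeroˡ _)
    ... | yes σ = trans (*-congˡ (ind-no (insertRow (i , q) s ≟W w) λ { ≡.refl → ¬σ (insertRow-sorted (i , q) s σ) })) (zeroʳ _)
  ... | yes σ with pop? i w
  ...   | inj₁ all = trans (∑-0 (words N) λ {s} _ → trans (*-congˡ (ind-no (insertRow (i , q) s ≟W w)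
            λ { ≡.refl → absent (insertRow-pop i q s) all })) (zeroʳ _)) (sym (trans (*-identityˡ _) (letter-⊛-absent i q F w all)))
    where
    absent : ∀ {w q r} → Pop i w q r → ¬ All (λ a → proj₁ a ≢ i) w
    absent p all = proj₁ (pop-All {λ h → h ≢ i} p all) ≡.refl
  ...   | inj₂ (q′ , r , p) = begin
    ∑ (words N) (λ s → ind ⌊ sorted? s ⌋ * F s * ind (insertRow (i , q) s ==W w))
      ≈⟨ ∑-cong (words N) (λ {s} _ → match s) ⟩
    ∑ (words N) (λ s → (ind ⌊ q FinP.≟ q′ ⌋ * F s) * ind (s ==W r))
      ≈⟨ ∑-words N r _ (ℕP.≤-pred (≡.subst (_≤ suc N) (pop-length p) le)) ⟩
    ind ⌊ q FinP.≟ q′ ⌋ * F r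
      ≈⟨ trans (*-identityˡ _) (letter-⊛-pop q F p) ⟨
    1# * (letter i q ⊛ F) w ∎
    where
    pop-length : ∀ {w q r} → Pop i w q r → length w ≡ suc (length r)
    pop-length here        = ≡.refl
    pop-length (there _ x) = ≡.cong suc (pop-length x)
    match : ∀ s → ind ⌊ sorted? s ⌋ * F s * ind (insertRow (i , q) s ==W w) ≈ (ind ⌊ q FinP.≟ q′ ⌋ * F s) * ind (s ==W r)
    match s with s ≟W r
    ... | no s≢r = trans (*-congˡ (ind-no (insertRow (i , q) s ≟W w)
           λ { ≡.refl → s≢r (proj₂ (pop-functional (insertRow-pop i q s) p)) })) (trans (zeroʳ _) (sym (zeroʳ _)))
    ... | yes ≡.refl = trans (*-cong (trans (*-congʳ (ind-yes (sorted? s) (pop-sorted p σ))) (*-identityˡ _))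
           (ind-⇔ (insertRow (i , q) s ≟W w) (q FinP.≟ q′)
             (λ { ≡.refl → proj₁ (pop-functional (insertRow-pop i q s) p) }) (λ { ≡.refl → pop-insertRow p σ })))
           (trans (*-comm _ _) (sym (*-identityʳ _)))

  prefix : Letter → Gen → Gen
  prefix a g = record { coef = coef ; left = a ∷ left ; x = x ; y = y ; right = right ; rows≢ = rows≢ }
    where open Gen g

  evalGen-[] : ∀ g → evalGen [] g ≈ 0#
  evalGen-[] record { left = [] }    = trans (*-congˡ (-‿inverseʳ 0#)) (zeroʳ _)
  evalGen-[] record { left = _ ∷ _ } = trans (*-congˡ (-‿inverseʳ 0#)) (zeroʳ _)

  evalGen-prefix : ∀ a g b w → evalGen (b ∷ w) (prefix a g) ≈ ind ⌊ a ≟ᴸ b ⌋ * evalGen w g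
  evalGen-prefix a g b w = trans (*-congˡ (+-cong (==W-∷ a b _ w) (-‿cong (==W-∷ a b _ w))))
    (solve 4 (λ c i p q → c :* (i :* p :- i :* q) := i :* (c :* (p :- q))) refl _ _ _ _)

  evaluate : List Gen → Ser
  evaluate gs w = ∑ gs (evalGen w)

  evaluate-prefix : ∀ a gs b w → evaluate (map (prefix a) gs) (b ∷ w) ≈ ind ⌊ a ≟ᴸ b ⌋ * evaluate gs w
  evaluate-prefix a gs b w = trans (reflexive (∑-map (prefix a) gs _))
    (trans (∑-cong gs λ {g} _ → evalGen-prefix a g b w) (∑-*ˡ gs _ _))

  evaluate-[] : ∀ gs → evaluate gs [] ≈ 0#
  evaluate-[] gs = ∑-0 gs λ {g} _ → evalGen-[] g

  -- One generator for each letter that `x` passes on its way to its sorted place; their differences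
  -- telescope.
  moves : Carrier → Letter → Word → List Gen
  moves c x []      = []
  moves c x (y ∷ s) with proj₁ y FinP.<? proj₁ x
  ... | yes y<x = record { coef = c ; left = [] ; x = x ; y = y ; right = s ; rows≢ = λ x≡y → FinP.<-irrefl (≡.sym x≡y) y<x }
                  ∷ map (prefix y) (moves c x s)
  ... | no  _   = []

  evaluate-moves : ∀ c x s w → evaluate (moves c x s) w ≈ c * (ind ((x ∷ s) ==W w) - ind (insertRow x s ==W w))
  evaluate-moves c x []      w = sym (trans (*-congˡ (-‿inverseʳ _)) (zeroʳ _))
  evaluate-moves c x (y ∷ s) w with proj₁ y FinP.<? proj₁ x
  ... | no  _ = sym (trans (*-congˡ (-‿inverseʳ _)) (zeroʳ _))
  ... | yes _ = rest w
    where
    rest : ∀ w → c * (ind ((x ∷ y ∷ s) ==W w) - ind ((y ∷ x ∷ s) ==W w)) + evaluate (map (prefix y) (moves c x s)) w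
         ≈ c * (ind ((x ∷ y ∷ s) ==W w) - ind ((y ∷ insertRow x s) ==W w))
    rest []      = trans (+-congˡ (evaluate-[] (map (prefix y) (moves c x s)))) (+-identityʳ _)
    rest (b ∷ w) = begin
      c * (ind ((x ∷ y ∷ s) ==W (b ∷ w)) - ind ((y ∷ x ∷ s) ==W (b ∷ w))) + evaluate (map (prefix y) (moves c x s)) (b ∷ w)
        ≈⟨ +-cong (*-congˡ (+-congˡ (-‿cong (==W-∷ y b (x ∷ s) w))))
                  (trans (evaluate-prefix y (moves c x s) b w) (*-congˡ (evaluate-moves c x s w))) ⟩
      c * (ind ((x ∷ y ∷ s) ==W (b ∷ w)) - ind ⌊ y ≟ᴸ b ⌋ * ind ((x ∷ s) ==W w))
        + ind ⌊ y ≟ᴸ b ⌋ * (c * (ind ((x ∷ s) ==W w) - ind (insertRow x s ==W w)))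
        ≈⟨ solve 5 (λ c p i q r → c :* (p :- i :* q) :+ i :* (c :* (q :- r)) := c :* (p :- i :* r)) refl _ _ _ _ _ ⟩
      c * (ind ((x ∷ y ∷ s) ==W (b ∷ w)) - ind ⌊ y ≟ᴸ b ⌋ * ind (insertRow x s ==W w))
        ≈⟨ *-congˡ (+-congˡ (-‿cong (==W-∷ y b (insertRow x s) w))) ⟨
      c * (ind ((x ∷ y ∷ s) ==W (b ∷ w)) - ind ((y ∷ insertRow x s) ==W (b ∷ w))) ∎

  -- The tails behind a first letter `x` are sorted by recursion; then `x` is moved into every
  -- sorted tail, weighted by the coefficient that this tail has received.
  sortingFrom : ℕ → Ser → Letter → List Gen
  sorting     : ℕ → Ser → List Gen
  sorting zero    h = []
  sorting (suc N) h = concatMap (sortingFrom N h) letters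
  sortingFrom N h x = map (prefix x) (sorting N (∂ x h)) ++ concatMap (λ s → moves (normalForm (∂ x h) s) x s) (words N)

  -- The intermediate words, `x` followed by a sorted tail, cancel between the two lists of
  -- generators; what remains is the expansion `push-∂`.
  evaluate-sorting : ∀ N h w → length w ≤ N → h w - normalForm h w ≈ evaluate (sorting N h) w
  evaluate-sorting N h []      le = trans (trans (+-congˡ (-‿cong (*-identityˡ _))) (-‿inverseʳ _)) (sym (evaluate-[] (sorting N h)))
  evaluate-sorting (suc N) h (a ∷ w) (s≤s le) = sym (begin
    evaluate (sorting (suc N) h) (a ∷ w)
      ≈⟨ ∑-concatMap (sortingFrom N h) letters _ ⟩
    ∑ letters (λ x → evaluate (sortingFrom N h x) (a ∷ w))
      ≈⟨ ∑-cong letters (λ {x} _ → each x) ⟩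
    ∑ letters (λ x → ind ⌊ x ≟ᴸ a ⌋ * h (x ∷ w) - ind ⌊ sorted? (a ∷ w) ⌋ * (letter (proj₁ x) (proj₂ x) ⊛ push (∂ x h)) (a ∷ w))
      ≈⟨ trans (∑-+ letters _ _) (+-cong (∑-letters a _) (∑-neg letters _)) ⟩
    h (a ∷ w) - ∑ letters (λ x → ind ⌊ sorted? (a ∷ w) ⌋ * (letter (proj₁ x) (proj₂ x) ⊛ push (∂ x h)) (a ∷ w))
      ≈⟨ +-congˡ (-‿cong (trans (∑-*ˡ letters _ _) (*-congˡ (sym (push-∂ h a w))))) ⟩
    h (a ∷ w) - normalForm h (a ∷ w) ∎)
    where
    each : ∀ x → evaluate (sortingFrom N h x) (a ∷ w) ≈
      ind ⌊ x ≟ᴸ a ⌋ * h (x ∷ w) - ind ⌊ sorted? (a ∷ w) ⌋ * (letter (proj₁ x) (proj₂ x) ⊛ push (∂ x h)) (a ∷ w)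
    each x = begin
      evaluate (sortingFrom N h x) (a ∷ w)
        ≈⟨ ∑-++ (map (prefix x) (sorting N (∂ x h))) _ _ ⟩
      evaluate (map (prefix x) (sorting N (∂ x h))) (a ∷ w) + evaluate (concatMap (λ s → moves (nf s) x s) (words N)) (a ∷ w)
        ≈⟨ +-cong (trans (evaluate-prefix x (sorting N (∂ x h)) a w) (*-congˡ (sym (evaluate-sorting N (∂ x h) w le))))
             (trans (∑-concatMap _ (words N) _) (∑-cong (words N) λ {s} _ →
               trans (evaluate-moves (nf s) x s (a ∷ w)) (trans (x[y-z]≈xy-xz _ _ _) (+-congʳ (trans (*-congˡ (==W-∷ x a s w))
                 (solve 3 (λ f i j → f :* (i :* j) := i :* (f :* j)) refl _ _ _)))))) ⟩
      i * (h (x ∷ w) - nf w) + ∑ (words N) (λ s → i * (nf s * ind (s ==W w)) - nf s * ind (insertRow x s ==W (a ∷ w)))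
        ≈⟨ +-congˡ (trans (∑-+ (words N) _ _) (+-cong (trans (∑-*ˡ (words N) i _) (*-congˡ (∑-words N w nf le)))
             (trans (∑-neg (words N) _) (-‿cong (∑-insertRow N x (push (∂ x h)) (a ∷ w) (s≤s le)))))) ⟩
      i * (h (x ∷ w) - nf w) + (i * nf w - ind ⌊ sorted? (a ∷ w) ⌋ * (letter (proj₁ x) (proj₂ x) ⊛ push (∂ x h)) (a ∷ w))
        ≈⟨ solve 4 (λ i p q r → i :* (p :- q) :+ (i :* q :- r) := i :* p :- r) refl _ _ _ _ ⟩
      i * h (x ∷ w) - ind ⌊ sorted? (a ∷ w) ⌋ * (letter (proj₁ x) (proj₂ x) ⊛ push (∂ x h)) (a ∷ w) ∎
      where
      i : Carrier
      i = ind ⌊ x ≟ᴸ a ⌋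
      nf : Ser
      nf = normalForm (∂ x h)

  ≈CF-normalForm : ∀ {f g} → normalForm f ≋ g → f ≈CF g
  ≈CF-normalForm {f} {g} e N = sorting N f , λ w le → trans (+-congˡ (-‿cong (sym (e w)))) (evaluate-sorting N f w le)

-- The walks of φ and the disjoint cycle decomposition

take-++-length : ∀ {A : Set} (xs ys : List A) → take (length xs) (xs ++ ys) ≡ xs
take-++-length []       ys = ≡.refl
take-++-length (x ∷ xs) ys = ≡.cong (x ∷_) (take-++-length xs ys)

drop-++-length : ∀ {A : Set} (xs ys : List A) → drop (length xs) (xs ++ ys) ≡ ys
drop-++-length []       ys = ≡.refl
drop-++-length (x ∷ xs) ys = drop-++-length xs ys

module Cycles (K : QAlgebra) (m : ℕ) where
  open Series K m
  open Walks K m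
  open Invariance K m

  data Path : Fin m → Word → Fin m → Set where
    []   : ∀ {i} → Path i [] i
    step : ∀ {i j k w} → Path j w k → Path i ((i , j) ∷ w) k

  record SimpleCycle (x : Word) : Set where
    field
      base     : Fin m
      loop     : Path base x base
      unique   : Unique (map proj₁ x)
      nonempty : x ≢ []

  data ClosedWalks : Word → Set where
    []   : ClosedWalks []
    _∷_  : ∀ {h w γ} → Path h w h → ClosedWalks γ → ClosedWalks (w ++ γ)

  path-flow : ∀ {i j w} → Path i w j → Flow i j w
  path-flow []       h = ≡.refl
  path-flow (step p)   = pop-flow⁻ here (path-flow p)

  path-balanced : ∀ {h w} → Path h w h → Balanced w
  path-balanced {h} p k = ℕP.+-cancelʳ-≡ (δ k h) _ _ (path-flow p k)

  path-++ : ∀ {i j k v w} → Path i v j → Path j w k → Path i (v ++ w) k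
  path-++ []       q = q
  path-++ (step p) q = step (path-++ p q)

  path-++⁻ : ∀ {i j l k} v {w} → Path i (v ++ (l , j) ∷ w) k → Path i v l × Path l ((l , j) ∷ w) k
  path-++⁻ []      (step p) = [] , step p
  path-++⁻ (a ∷ v) (step p) with path-++⁻ v p
  ... | q , r = step q , r

  pop-~ : ∀ {i w q r} → Pop i w q r → w ~ (i , q) ∷ r
  pop-~ here          = ~refl
  pop-~ (there a≢i x) = ~trans (~prep _ (pop-~ x)) (~swap a≢i)

  ~-shift : ∀ v {x} w → All (λ a → proj₁ a ≢ proj₁ x) v → v ++ x ∷ w ~ x ∷ v ++ w
  ~-shift []      w []         = ~refl
  ~-shift (a ∷ v) w (a≢ ∷ all) = ~trans (~prep a (~-shift v w all)) (~swap a≢)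

  ~-shifts : ∀ v x w → All (λ b → All (λ a → proj₁ a ≢ proj₁ b) v) x → v ++ x ++ w ~ x ++ v ++ w
  ~-shifts v []      w []          = ~refl
  ~-shifts v (b ∷ x) w (all ∷ alls) = ~trans (~-shift v (x ++ w) all) (~prep b (~-shifts v x w alls))

  takeFirstFrom-pop : ∀ c w → (takeFirstFrom c w ≡ nothing × All (λ a → proj₁ a ≢ c) w)
    ⊎ ∃₂ λ q r → takeFirstFrom c w ≡ just ((c , q) , r) × Pop c w q r
  takeFirstFrom-pop c []            = inj₁ (≡.refl , [])
  takeFirstFrom-pop c ((h , q) ∷ w) with h FinP.≟ c
  ... | yes ≡.refl = inj₂ (q , w , ≡.refl , here)
  ... | no h≢c with takeFirstFrom-pop c w
  ...   | inj₁ (e , all)       = inj₁ (≡.cong (Maybe.map _) e , h≢c ∷ all)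
  ...   | inj₂ (p , r , e , x) = inj₂ (p , (h , q) ∷ r , ≡.cong (Maybe.map _) e , there h≢c x)

  walk-spec : ∀ f c α → length α ≤ f → let (w , r) = walk f c α in
    α ~ w ++ r × ∃ λ k → Path c w k × All (λ a → proj₁ a ≢ k) r
  walk-spec zero    c []  _  = ~refl , c , [] , []
  walk-spec (suc f) c α   le with takeFirstFrom c α | takeFirstFrom-pop c α
  ... | _ | inj₁ (≡.refl , all)       = ~refl , c , [] , all
  ... | _ | inj₂ (q , r , ≡.refl , x) with walk f q r | walk-spec f q r (ℕP.≤-pred (≡.subst (_≤ suc f) (PermP.↭-length (~⇒↭ (pop-~ x))) le))
  ...   | w , r′ | e , k , p , all = ~trans (pop-~ x) (~prep (c , q) e) , k , step p , all

  walk-closed : ∀ f h α → length α ≤ f → Balanced α → let (w , r) = walk f h α in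
    α ~ w ++ r × Path h w h × All (λ a → proj₁ a ≢ h) r × Balanced r
  walk-closed f h α le b with walk f h α | walk-spec f h α le
  ... | w , r | e , k , p , all with k FinP.≟ h
  ...   | yes ≡.refl = e , p , all , Balanced-++⁻ʳ w r (path-balanced p) (Balanced-↭ (~⇒↭ e) b)
  ...   | no  k≢h    = ⊥-elim (ℕP.m+1+n≢m (rows k w ℕ.+ 0) (≡.sym (≡.trans surplus (≡.trans (≡.cong (rows k w ℕ.+_) (ℕP.+-comm (cols k r) 1))
          (≡.cong (ℕ._+ suc (cols k r)) (≡.sym (ℕP.+-identityʳ (rows k w))))))))
    where
    arrivals : rows k w ℕ.+ 1 ≡ cols k w
    arrivals = ≡.trans (≡.subst₂ (λ a b → rows k w ℕ.+ a ≡ cols k w ℕ.+ b) (δ-yes k) (δ-no k≢h) (path-flow p k)) (ℕP.+-identityʳ _)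
    surplus : rows k w ℕ.+ 0 ≡ rows k w ℕ.+ (cols k r ℕ.+ 1)
    surplus = ≡.trans (≡.cong (rows k w ℕ.+_) (≡.sym (rows-absent k r all))) (≡.trans (≡.sym (rows-++ k w r))
      (≡.trans (Balanced-↭ (~⇒↭ e) b k) (≡.trans (cols-++ k w r) (≡.trans (≡.cong (ℕ._+ cols k r) (≡.sym arrivals))
        (≡.trans (ℕP.+-assoc (rows k w) 1 _) (≡.cong (rows k w ℕ.+_) (ℕP.+-comm 1 _)))))))

  allWalks : Word → List (Fin m) → Word → Word
  allWalks α []       r = []
  allWalks α (h ∷ hs) r with walk (length α) h r
  ... | w , r′ = w ++ allWalks α hs r′

  mutual
    private
      -- φ's local function cannot be named, so unification has to find it.
      where-go : ∀ α hs r → _ ≡ allWalks α hs r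

    φ-allWalks : ∀ α → φ α ≡ allWalks α (allFin m) α
    φ-allWalks α with allFin m
    ... | []     = ≡.refl
    ... | h ∷ hs with walk (length α) h α
    ...   | w , r = ≡.cong (w ++_) (where-go α hs r)

    where-go α []       r = ≡.refl
    where-go α (h ∷ hs) r with walk (length α) h r
    ... | w , r′ = ≡.cong (w ++_) (where-go α hs r′)

  -- When the walk from `h` stops, no letter of row `h` is left, so the remaining rows lie in `hs`.
  allWalks-spec : ∀ α hs r → length r ≤ length α → Balanced r → InRows hs r →
    ClosedWalks (allWalks α hs r) × r ~ allWalks α hs r
  allWalks-spec α []       []      le b in-hs = [] , ~refl
  allWalks-spec α []       (_ ∷ _) le b (() ∷ _)
  allWalks-spec α (h ∷ hs) r       le b in-hs with walk (length α) h r | walk-closed (length α) h r le b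
  ... | w , r′ | e , p , all , b′ with allWalks-spec α hs r′ le′ b′ (narrow r′ all (AllP.++⁻ʳ w (PermP.All-resp-↭ (~⇒↭ e) in-hs)))
    where
    le′ : length r′ ≤ length α
    le′ = ℕP.≤-trans (ℕP.≤-trans (ℕP.m≤n+m _ (length w)) (ℕP.≤-reflexive (≡.sym (≡.trans (PermP.↭-length (~⇒↭ e)) (ListP.length-++ w))))) le
    narrow : ∀ v → All (λ a → proj₁ a ≢ h) v → InRows (h ∷ hs) v → InRows hs v
    narrow []      _           _               = []
    narrow (a ∷ v) (a≢h ∷ all) (here a≡h ∷ _)  = ⊥-elim (a≢h a≡h)
    narrow (a ∷ v) (a≢h ∷ all) (there a∈ ∷ is) = a∈ ∷ narrow v all is
  ...   | ws , e′ = p ∷ ws , ~trans e (~-++ˡ w e′)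

  φ-spec : ∀ α → Balanced α → ClosedWalks (φ α) × α ~ φ α
  φ-spec α b rewrite φ-allWalks α = allWalks-spec α (allFin m) α ℕP.≤-refl b (All.tabulate λ _ → MemP.∈-allFin _)

  firstRepFrom : List (Fin m) → ℕ → List (Fin m) → Maybe (ℕ × ℕ)
  firstRepFrom seen t [] = nothing
  firstRepFrom seen t (v ∷ vs) with indexOf v seen
  ... | just s  = just (s , t)
  ... | nothing = firstRepFrom (seen ++ v ∷ []) (suc t) vs

  mutual
    private
      where-go′ : ∀ vs seen t r → _ ≡ firstRepFrom seen t r

    firstRep-from : ∀ vs → firstRep vs ≡ firstRepFrom [] 0 vs
    firstRep-from []       = ≡.refl
    -- The arguments of the local function of `firstRep` are turned into variables, so that
    -- unification can recover that function.
    firstRep-from (v ∷ vs) with v ∷ vs | [ v ] | 1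
    ... | x | y | z = where-go′ x y z vs

    where-go′ x seen t []       = ≡.refl
    where-go′ x seen t (v ∷ vs) with indexOf v seen
    ... | just s  = ≡.refl
    ... | nothing = where-go′ x (seen ++ v ∷ []) (suc t) vs

  indexOf-spec : ∀ v (p : Word) → (indexOf v (map proj₁ p) ≡ nothing × All (λ a → proj₁ a ≢ v) p)
    ⊎ ∃ λ a → ∃₂ λ j x → indexOf v (map proj₁ p) ≡ just (length a) × p ≡ a ++ (v , j) ∷ x
  indexOf-spec v []            = inj₁ (≡.refl , [])
  indexOf-spec v ((h , j) ∷ p) with h FinP.≟ v
  ... | yes ≡.refl = inj₂ ([] , j , p , ≡.refl , ≡.refl)
  ... | no h≢v with indexOf-spec v p
  ...   | inj₁ (e , all)                  = inj₁ (≡.cong (Maybe.map suc) e , h≢v ∷ all)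
  ...   | inj₂ (a , j′ , x , e , ≡.refl) = inj₂ ((h , j) ∷ a , j′ , x , ≡.cong (Maybe.map suc) e , ≡.refl)

  -- `apart` allows the cycle to be moved to the front by commutations, and `rest` restores the
  -- hypothesis for the next round.
  record FirstCycle (st : Maybe (ℕ × ℕ)) (γ : Word) : Set where
    field
      before cycle after : Word
      position : st ≡ just (length before , length (before ++ cycle))
      split    : γ ≡ before ++ cycle ++ after
      simple   : SimpleCycle cycle
      apart    : All (λ b → All (λ a → proj₁ a ≢ proj₁ b) before) cycle
      rest     : ClosedWalks (before ++ after)

  -- `p` is the part of the current walk already scanned, without repeated starting heights, and `q`
  -- the part ahead. The scan never leaves this walk: on its return to `h` it meets a height already
  -- seen.
  firstCycle : ∀ {h c} p q γ → Path h p c → Path c q h → Unique (map proj₁ p) → p ++ q ≢ [] → ClosedWalks γ →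
    FirstCycle (firstRepFrom (map proj₁ p) (length p) (c ∷ map proj₂ (q ++ γ))) ((p ++ q) ++ γ)
  firstCycle {h} {c} p q γ path-p path-q u ne ws with indexOf c (map proj₁ p) | indexOf-spec c p
  ... | _ | inj₂ (a , j , x , ≡.refl , ≡.refl) = record
    { before = a ; cycle = (c , j) ∷ x ; after = q ++ γ
    ; position = ≡.refl
    ; split = ≡.trans (ListP.++-assoc (a ++ (c , j) ∷ x) q γ) (ListP.++-assoc a ((c , j) ∷ x) (q ++ γ))
    ; simple = record { base = c ; loop = proj₂ (path-++⁻ a path-p) ; unique = AllPairs-++⁻ʳ (map proj₁ a) u′ ; nonempty = λ () }
    ; apart = All.tabulate λ b∈ → All.tabulate λ a∈ → Unique-++-≢ (map proj₁ a) u′ (MemP.∈-map⁺ proj₁ a∈) (MemP.∈-map⁺ proj₁ b∈)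
    ; rest = ≡.subst ClosedWalks (ListP.++-assoc a q γ) (path-++ (proj₁ (path-++⁻ a path-p)) path-q ∷ ws)
    }
    where
    u′ : Unique (map proj₁ a ++ map proj₁ ((c , j) ∷ x))
    u′ = ≡.subst Unique (ListP.map-++ proj₁ a ((c , j) ∷ x)) u
  firstCycle {h} {c} [] [] γ [] [] u ne ws | _ | inj₁ (≡.refl , all) = ⊥-elim (ne ≡.refl)
  firstCycle {h} {c} (_ ∷ p) [] γ (step _) [] u ne ws | _ | inj₁ (≡.refl , h≢c ∷ all) = ⊥-elim (h≢c ≡.refl)
  firstCycle {h} {c} p ((c , d) ∷ q) γ path-p (step path-q) u ne ws | _ | inj₁ (≡.refl , all) =
    ≡.subst₂ FirstCycle
      (≡.cong₂ (λ seen t → firstRepFrom seen t (d ∷ map proj₂ (q ++ γ))) (ListP.map-++ proj₁ p ((c , d) ∷ []))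
        (≡.trans (ListP.length-++ p) (ℕP.+-comm (length p) 1)))
      (≡.cong (_++ γ) (ListP.++-assoc p ((c , d) ∷ []) q))
      (firstCycle (p ++ (c , d) ∷ []) q γ (path-++ path-p (step [])) path-q
        (≡.subst Unique (≡.sym (ListP.map-++ proj₁ p ((c , d) ∷ [])))
          (UniqueP.++⁺ u ([] ∷ []) λ { (x∈ , here ≡.refl) → not-in x∈ }))
        (λ e → ne (≡.trans (≡.sym (ListP.++-assoc p ((c , d) ∷ []) q)) e)) ws)
    where
    not-in : ¬ (c ∈ map proj₁ p)
    not-in c∈ with MemP.∈-map⁻ proj₁ c∈
    ... | a , a∈ , ≡.refl = All.lookup all a∈ ≡.refl

  firstRep-cycle : ∀ x γ → ClosedWalks (x ∷ γ) → FirstCycle (firstRep (heights (x ∷ γ))) (x ∷ γ)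
  firstRep-cycle x γ ws = ≡.subst (λ st → FirstCycle st (x ∷ γ)) (≡.sym (firstRep-from (heights (x ∷ γ)))) (go ws ≡.refl)
    where
    go : ∀ {v} → ClosedWalks v → v ≡ x ∷ γ → FirstCycle (firstRepFrom [] 0 (heights (x ∷ γ))) (x ∷ γ)
    go (_∷_ {w = []}    []       ws) e      = go ws e
    go (_∷_ {h} {w = w@(_ ∷ _)} {γ = γ′} p@(step _) ws) ≡.refl = firstCycle [] w γ′ [] p [] (λ ()) ws

  private
    module Removal (a y b : Word) where
      open ≡ using (cong; cong₂; trans; sym)

      taken : take (length (a ++ y) ∸ length a) (drop (length a) (a ++ y ++ b)) ≡ y
      taken = trans (cong₂ take (trans (cong (_∸ length a) (ListP.length-++ a)) (ℕP.m+n∸m≡n (length a) (length y))) (drop-++-length a (y ++ b)))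
                    (take-++-length y b)

      left : take (length a) (a ++ y ++ b) ++ drop (length (a ++ y)) (a ++ y ++ b) ≡ a ++ b
      left = cong₂ _++_ (take-++-length a (y ++ b))
        (trans (cong (drop (length (a ++ y))) (sym (ListP.++-assoc a y b))) (drop-++-length (a ++ y) b))

      shorter : y ≢ [] → length (a ++ b) < length (a ++ y ++ b)
      shorter ne = ≡.subst₂ _<_ (sym (ListP.length-++ a)) (sym (ListP.length-++ a)) (ℕP.+-monoʳ-< (length a) (suffix y ne))
        where
        suffix : ∀ y → y ≢ [] → length b < length (y ++ b)
        suffix []      ne = ⊥-elim (ne ≡.refl)
        suffix (_ ∷ y) ne = s≤s (≡.subst (length b ≤_) (sym (ListP.length-++ y)) (ℕP.m≤n+m _ (length y)))

  decompose-spec : ∀ f γ → length γ ≤ f → ClosedWalks γ → All SimpleCycle (decompose f γ) × concat (decompose f γ) ~ γ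
  decompose-spec zero    []      le ws = [] , ~refl
  decompose-spec (suc f) []      le ws = [] , ~refl
  decompose-spec (suc f) (x ∷ γ) le ws with firstRep (heights (x ∷ γ)) | firstRep-cycle x γ ws
  ... | _ | record { before = a ; cycle = y ; after = b ; position = ≡.refl ; split = split ; simple = simple ; apart = apart ; rest = rest } =
    remove (x ∷ γ) le split
    where
    open Removal a y b
    remove : ∀ v → length v ≤ suc f → v ≡ a ++ y ++ b →
      let u = take (length (a ++ y) ∸ length a) (drop (length a) v) ∷ decompose f (take (length a) v ++ drop (length (a ++ y)) v)
      in All SimpleCycle u × concat u ~ v
    remove _ le ≡.refl rewrite taken | left
      with decompose-spec f (a ++ b) (ℕP.≤-pred (ℕP.≤-trans (shorter (SimpleCycle.nonempty simple)) le)) rest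
    ... | simples , e = simple ∷ simples , ~trans (~-++ˡ y e) (~-sym (~-shifts a y b apart))

  cycles-spec : ∀ μ {α} → mkWord (sortW μ) μ ≡ α → length μ ≡ length α → Balanced α →
    All SimpleCycle (cycles μ) × concat (cycles μ) ~ α
  cycles-spec μ {α} ≡.refl eq b with φ-spec α b
  ... | ws , e with decompose-spec (length μ) (φ α) (ℕP.≤-reflexive (≡.trans (≡.sym (PermP.↭-length (~⇒↭ e))) (≡.sym eq))) ws
  ...   | simple , e′ = simple , ~trans e′ (~-sym e)

true≢false : true ≢ false
true≢false ()

true-or-false : ∀ b → b ≡ true ⊎ b ≡ false
true-or-false true  = inj₁ ≡.refl
true-or-false false = inj₂ ≡.refl

all-++ : ∀ {A : Set} (f : A → Bool) xs ys → all f (xs ++ ys) ≡ all f xs ∧ all f ys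
all-++ f []       ys = ≡.refl
all-++ f (x ∷ xs) ys = ≡.trans (≡.cong (f x ∧_) (all-++ f xs ys)) (≡.sym (∧-assoc (f x) _ _))

all-cong : ∀ {A : Set} {f g : A → Bool} → (∀ x → f x ≡ g x) → ∀ xs → all f xs ≡ all g xs
all-cong e []       = ≡.refl
all-cong e (x ∷ xs) = ≡.cong₂ _∧_ (e x) (all-cong e xs)

all-true : ∀ {A : Set} (f : A → Bool) xs → All (λ x → f x ≡ true) xs → all f xs ≡ true
all-true f []       []       = ≡.refl
all-true f (x ∷ xs) (e ∷ es) = ≡.cong₂ _∧_ e (all-true f xs es)

all-∧ : ∀ {A : Set} (f g : A → Bool) xs → all (λ x → f x ∧ g x) xs ≡ all f xs ∧ all g xs
all-∧ f g []       = ≡.refl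
all-∧ f g (x ∷ xs) with f x | g x
... | true  | true  = all-∧ f g xs
... | true  | false = ≡.sym (∧-zeroʳ (all f xs))
... | false | _     = ≡.refl

all-swap : ∀ {A B : Set} (f : A → B → Bool) xs ys → all (λ x → all (f x) ys) xs ≡ all (λ y → all (λ x → f x y) xs) ys
all-swap f []       ys = ≡.sym (all-true _ ys (All.tabulate λ _ → ≡.refl))
all-swap f (x ∷ xs) ys = ≡.trans (≡.cong (all (f x) ys ∧_) (all-swap f xs ys)) (≡.sym (all-∧ (f x) _ ys))

not-any : ∀ {A : Set} (f : A → Bool) xs → not (any f xs) ≡ all (λ x → not (f x)) xs
not-any f []       = ≡.refl
not-any f (x ∷ xs) with f x
... | true  = ≡.refl
... | false = not-any f xs

-- Cycles as indivisible blocks of balanced factorisations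

module CycleBlocks (K : QAlgebra) (m : ℕ) where
  open QAlgebra K using (R)
  open CommutativeRing R
  open import Relation.Binary.Reasoning.Setoid setoid
  open RingSolving R using (solve; _:=_; _:+_; _:*_; :1)
  open Series K m hiding (ind)
  open PushSeries K m
  open Walks K m
  open Invariance K m
  open Cycles K m

  bal : Ser
  bal w = ind ⌊ balanced? w ⌋

  SUB : Word → (Word → Word → Carrier) → Carrier
  SUB []      F = F [] []
  SUB (a ∷ x) F = SUB x (λ p q → F (a ∷ p) q + F p (a ∷ q))

  SUB-cong : ∀ x {F G} → (∀ {p q} → Interleaving p q x → F p q ≈ G p q) → SUB x F ≈ SUB x G
  SUB-cong []      e = e []
  SUB-cong (a ∷ x) e = SUB-cong x λ i → +-cong (e (consˡ i)) (e (consʳ i))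

  SUB-unmixed : ∀ x {F} → x ≢ [] → (∀ {p q} → Interleaving p q x → p ≢ [] → q ≢ [] → F p q ≈ 0#) → SUB x F ≈ F x [] + F [] x
  SUB-unmixed []          ne z = ⊥-elim (ne ≡.refl)
  SUB-unmixed (a ∷ [])    ne z = refl
  SUB-unmixed (a ∷ b ∷ x) {F} ne z = begin
    SUB (b ∷ x) (λ p q → F (a ∷ p) q + F p (a ∷ q))
      ≈⟨ SUB-unmixed (b ∷ x) (λ ()) (λ i p≢ q≢ → trans (+-cong (z (consˡ i) (λ ()) q≢) (z (consʳ i) p≢ (λ ()))) (+-identityʳ 0#)) ⟩
    (F (a ∷ b ∷ x) [] + F (b ∷ x) (a ∷ [])) + (F (a ∷ []) (b ∷ x) + F [] (a ∷ b ∷ x))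
      ≈⟨ +-cong (trans (+-congˡ (z (consʳ (leftmost (b ∷ x))) (λ ()) (λ ()))) (+-identityʳ _))
                (trans (+-congʳ (z (consˡ (rightmost (b ∷ x))) (λ ()) (λ ()))) (+-identityˡ _)) ⟩
    F (a ∷ b ∷ x) [] + F [] (a ∷ b ∷ x) ∎
    where
    leftmost : ∀ (v : Word) → Interleaving v [] v
    leftmost []      = []
    leftmost (_ ∷ v) = consˡ (leftmost v)
    rightmost : ∀ (v : Word) → Interleaving [] v v
    rightmost []      = []
    rightmost (_ ∷ v) = consʳ (rightmost v)

  clearAll : Word → Word → Bool
  clearAll x S = all (λ a → clear a S) x

  clear-distinct : ∀ a p → All (λ b → proj₁ b ≢ proj₁ a) p → clear a p ≡ true
  clear-distinct a p all = all-true _ p (All.map (λ {b} b≢a → apart-yes {b} {a} b≢a) all)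

  All-interleavingˡ : ∀ {A : Set} {Q : A → Set} {p q x : List A} → Interleaving p q x → All Q x → All Q p
  All-interleavingˡ []        []       = []
  All-interleavingˡ (consˡ i) (q ∷ qs) = q ∷ All-interleavingˡ i qs
  All-interleavingˡ (consʳ i) (q ∷ qs) = All-interleavingˡ i qs

  -- The letters of `x` lie in distinct rows and pass each other freely, so `x` is distributed over
  -- the two factors without inner constraints; only the letters going right have to pass `S`.
  CS-block : ∀ x v H → Unique (map proj₁ x) →
    CS (x ++ v) H ≈ CS v (λ S T → SUB x (λ p q → ind (clearAll q S) * H (p ++ S) (q ++ T)))
  CS-block []      v H _        = CS-cong v λ _ → sym (*-identityˡ _)
  CS-block (a ∷ x) v H (a∉ ∷ u) = trans (CS-block x v _ u) (CS-cong v λ {S} {T} _ → SUB-cong x λ {p} {q} i → begin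
    ind (clearAll q S) * (H (a ∷ p ++ S) (q ++ T) + ind (clear a (p ++ S)) * H (p ++ S) (a ∷ q ++ T))
      ≈⟨ *-congˡ (+-congˡ (*-congʳ (reflexive (≡.cong ind (≡.trans (all-++ _ p S)
           (≡.cong (_∧ clear a S) (clear-distinct a p (All.map (λ a≢b b≡a → a≢b (≡.sym b≡a)) (All-interleavingˡ i (AllP.map⁻ a∉)))))))))) ⟩
    ind (clearAll q S) * (H (a ∷ p ++ S) (q ++ T) + ind (clear a S) * H (p ++ S) (a ∷ q ++ T))
      ≈⟨ solve 4 (λ c h d k → c :* (h :+ d :* k) := c :* h :+ (d :* c) :* k) refl _ _ _ _ ⟩
    ind (clearAll q S) * H (a ∷ p ++ S) (q ++ T) + (ind (clear a S) * ind (clearAll q S)) * H (p ++ S) (a ∷ q ++ T)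
      ≈⟨ +-congˡ (*-congʳ (ind-∧ (clear a S) (clearAll q S))) ⟨
    ind (clearAll q S) * H (a ∷ p ++ S) (q ++ T) + ind (clear a S ∧ clearAll q S) * H (p ++ S) (a ∷ q ++ T) ∎)

  count-∈ : ∀ h xs → count h xs ≢ 0 → h ∈ xs
  count-∈ h []       ne = ⊥-elim (ne ≡.refl)
  count-∈ h (x ∷ xs) ne with h FinP.≟ x
  ... | yes h≡x = here h≡x
  ... | no  _   = there (count-∈ h xs ne)

  ∈-count : ∀ h xs → h ∈ xs → count h xs ≢ 0
  ∈-count h (x ∷ xs) h∈ with h FinP.≟ x
  ∈-count h (x ∷ xs) h∈           | yes _   = λ ()
  ∈-count h (x ∷ xs) (here h≡x)   | no  h≢x = ⊥-elim (h≢x h≡x)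
  ∈-count h (x ∷ xs) (there h∈)   | no  _   = ∈-count h xs h∈

  module _ {Q : Fin m → Set} where

    path-end : ∀ {i w k} → Path i w k → (∀ {a} → a ∈ w → Q (proj₁ a) → Q (proj₂ a)) → Q i → Q k
    path-end []       c qi = qi
    path-end (step p) c qi = path-end p (λ a∈ → c (there a∈)) (c (here ≡.refl) qi)

    path-end-from : ∀ {i w k a} → Path i w k → (∀ {a} → a ∈ w → Q (proj₁ a) → Q (proj₂ a)) → a ∈ w → Q (proj₁ a) → Q k
    path-end-from p@(step _) c (here ≡.refl) qa = path-end p c qa
    path-end-from (step p)   c (there a∈)    qa = path-end-from p (λ b∈ → c (there b∈)) a∈ qa

    path-starts : ∀ {i w k} → Path i w k → (∀ {a} → a ∈ w → Q (proj₁ a) → Q (proj₂ a)) → Q i → ∀ {b} → b ∈ w → Q (proj₁ b)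
    path-starts (step p) c qi (here ≡.refl) = qi
    path-starts (step p) c qi (there b∈)    = path-starts p (λ a∈ → c (there a∈)) (c (here ≡.refl) qi) b∈

  path-next : ∀ {i w k a} → Path i w k → a ∈ w → proj₂ a ∈ map proj₁ w ⊎ proj₂ a ≡ k
  path-next (step [])       (here ≡.refl) = inj₂ ≡.refl
  path-next (step (step _)) (here ≡.refl) = inj₁ (there (here ≡.refl))
  path-next (step p)        (there a∈) with path-next p a∈
  ... | inj₁ j∈ = inj₁ (there j∈)
  ... | inj₂ e  = inj₂ e

  cycle-next : ∀ {x} → SimpleCycle x → ∀ {a} → a ∈ x → proj₂ a ∈ map proj₁ x
  cycle-next s {a} a∈ with path-next (SimpleCycle.loop s) a∈
  ... | inj₁ j∈ = j∈
  ... | inj₂ e  = ≡.subst (_∈ _) (≡.sym e) (origin (SimpleCycle.loop s) a∈)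
    where
    origin : ∀ {i w k} → Path i w k → a ∈ w → i ∈ map proj₁ w
    origin (step _) _ = here ≡.refl

  -- A balanced word containing one letter of a cycle must contain the next
  -- one, unless that row is used elsewhere.
  mixed-unbalanced : ∀ {x p q} S → SimpleCycle x → Interleaving p q x → p ≢ [] → q ≢ [] →
    (∀ {b} → b ∈ q → ¬ (proj₁ b ∈ map proj₁ S)) → ¬ Balanced (p ++ S)
  mixed-unbalanced {x} {p} {q} S s i p≢ q≢ clear b = contradiction (pick p≢) (pick q≢)
    where
    x↭ : x ↭ p ++ q
    x↭ = Int.toPermutation i
    u : Unique (map proj₁ p ++ map proj₁ q)
    u = ≡.subst Unique (ListP.map-++ proj₁ p q)
      (PermSetoidP.Unique-resp-↭ (≡.setoid _) (Perm.↭⇒↭ₛ (PermP.map⁺ proj₁ x↭)) (SimpleCycle.unique s))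
    separate : ∀ {h} → h ∈ map proj₁ p → ¬ (h ∈ map proj₁ q)
    separate h∈ h∈′ = Unique-++-≢ (map proj₁ p) u h∈ h∈′ ≡.refl
    pick : ∀ {w : Word} → w ≢ [] → ∃ λ a → a ∈ w
    pick {[]}    ne = ⊥-elim (ne ≡.refl)
    pick {a ∷ w} ne = a , here ≡.refl
    from-x : ∀ {a} → a ∈ x → a ∈ p ⊎ a ∈ q
    from-x a∈ = MemP.∈-++⁻ p (PermP.∈-resp-↭ x↭ a∈)
    to-x : ∀ {a} → a ∈ p ++ q → a ∈ x
    to-x a∈ = PermP.∈-resp-↭ (Perm.↭-sym x↭) a∈
    closure : ∀ {a} → a ∈ x → proj₁ a ∈ map proj₁ p → proj₂ a ∈ map proj₁ p
    closure {a} a∈ i∈ with from-x a∈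
    ... | inj₂ a∈q = ⊥-elim (separate i∈ (MemP.∈-map⁺ proj₁ a∈q))
    ... | inj₁ a∈p with MemP.∈-map⁻ proj₁ (cycle-next s a∈)
    ...   | c , c∈ , e with from-x c∈
    ...     | inj₁ c∈p = ≡.subst (_∈ _) (≡.sym e) (MemP.∈-map⁺ proj₁ c∈p)
    ...     | inj₂ c∈q with MemP.∈-++⁻ (map proj₁ p) (≡.subst (proj₂ a ∈_) (ListP.map-++ proj₁ p S) (count-∈ (proj₂ a) _
                (λ none → ∈-count (proj₂ a) _ (MemP.∈-map⁺ proj₂ (MemP.∈-++⁺ˡ a∈p)) (≡.trans (≡.sym (b (proj₂ a))) none))))
    ...       | inj₁ j∈p = j∈p
    ...       | inj₂ j∈S = ⊥-elim (clear c∈q (≡.subst (_∈ _) e j∈S))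
    contradiction : (∃ λ a → a ∈ p) → (∃ λ a → a ∈ q) → ⊥
    contradiction (a , a∈) (c , c∈) = separate
      (path-starts {Q = _∈ map proj₁ p} loop closure (path-end-from {Q = _∈ map proj₁ p} loop closure (to-x (MemP.∈-++⁺ˡ a∈)) (MemP.∈-map⁺ proj₁ a∈))
        (to-x (MemP.∈-++⁺ʳ p c∈)))
      (MemP.∈-map⁺ proj₁ c∈)
      where loop = SimpleCycle.loop s

  clear-true : ∀ a S → clear a S ≡ true → ¬ (proj₁ a ∈ map proj₁ S)
  clear-true a (b ∷ S) e i∈ with proj₁ b FinP.≟ proj₁ a
  clear-true a (b ∷ S) e (here i≡)  | no b≢a = b≢a (≡.sym i≡)
  clear-true a (b ∷ S) e (there i∈) | no _   = clear-true a S e i∈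

  clearAll-true : ∀ q S → clearAll q S ≡ true → ∀ {b} → b ∈ q → ¬ (proj₁ b ∈ map proj₁ S)
  clearAll-true (a ∷ q) S e b∈ with clear a S in eq
  clearAll-true (a ∷ q) S e (here ≡.refl) | true = clear-true a S eq
  clearAll-true (a ∷ q) S e (there b∈)    | true = clearAll-true q S e b∈

  -- A cycle acts as a single letter: by `mixed-unbalanced` a balanced left factor contains all of
  -- it or nothing, and to go right it must pass `S` as a whole.
  CS-cycle : ∀ x v (F : Word → Word → Carrier) → SimpleCycle x →
    CS (x ++ v) (λ S T → bal S * F S T) ≈ CS v (λ S T → bal S * (F (x ++ S) T + ind (clearAll x S) * F S (x ++ T)))
  CS-cycle x v F s = trans (CS-block x v _ (SimpleCycle.unique s)) (CS-cong v λ {S} {T} _ → trans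
    (SUB-unmixed x (SimpleCycle.nonempty s) λ i p≢ q≢ → trans (sym (*-assoc _ _ _)) (trans (*-congʳ (mixed S i p≢ q≢)) (zeroˡ _)))
    (begin
      1# * (bal (x ++ S) * F (x ++ S) T) + ind (clearAll x S) * (bal S * F S (x ++ T))
        ≈⟨ +-congʳ (*-congˡ (*-congʳ (ind-⇔ (balanced? (x ++ S)) (balanced? S)
             (Balanced-++⁻ʳ x S (path-balanced (SimpleCycle.loop s))) (Balanced-++ x S (path-balanced (SimpleCycle.loop s)))))) ⟩
      1# * (bal S * F (x ++ S) T) + ind (clearAll x S) * (bal S * F S (x ++ T))
        ≈⟨ solve 4 (λ b f c g → :1 :* (b :* f) :+ c :* (b :* g) := b :* (f :+ c :* g)) refl _ _ _ _ ⟩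
      bal S * (F (x ++ S) T + ind (clearAll x S) * F S (x ++ T)) ∎))
    where
    mixed : ∀ S {p q} → Interleaving p q x → p ≢ [] → q ≢ [] → ind (clearAll q S) * bal (p ++ S) ≈ 0#
    mixed S {p} {q} i p≢ q≢ with clearAll q S in eq
    ... | false = zeroˡ _
    ... | true  = trans (*-identityˡ _) (ind-no (balanced? (p ++ S)) (mixed-unbalanced S s i p≢ q≢ (clearAll-true q S eq)))

-- From words of letters to sequences of cycle labels

module Labels (K : QAlgebra) (m n : ℕ) (n<m : n < m) (μ : List (Fin m)) where
  open QAlgebra K using (R)
  open CommutativeRing R
  open import Relation.Binary.Reasoning.Setoid setoid
  open Series K m hiding (ind; insertAll; perms)
  open Coeff n μ
  open PushSeries K m
  open Walks K m
  open Sylvester K m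
  open Invariance K m
  open Cycles K m
  open CycleBlocks K m
  open LeftHandSide K m n n<m using (inner; outer; inner++outer; inj∈)
  module H = Trace R disj

  word : List (Fin k) → Word
  word us = concat (map cyc us)

  allNonJ : List (Fin k) → Bool
  allNonJ = all (λ p → not (inJ p))

  clearAll-cycle : ∀ p S → clearAll (cyc p) (word S) ≡ H.clear p S
  clearAll-cycle p []      = all-true _ (cyc p) (All.tabulate λ _ → ≡.refl)
  clearAll-cycle p (q ∷ S) = ≡.trans (all-cong (λ a → all-++ _ (cyc q) (word S)) (cyc p))
    (≡.trans (all-∧ _ _ (cyc p)) (≡.cong₂ _∧_ one-cycle (clearAll-cycle p S)))
    where
    one-cycle : all (λ a → clear a (cyc q)) (cyc p) ≡ disj q p
    one-cycle = ≡.trans (all-swap (λ a y → apart y a) (cyc p) (cyc q)) (≡.sym (≡.trans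
      (not-any _ (cyc q)) (all-cong (λ s → not-any _ (cyc p)) (cyc q))))

  disj-sym : ∀ p q → disj p q ≡ disj q p
  disj-sym p q = ≡.trans (≡.trans (not-any _ (cyc p)) (all-cong (λ s → not-any _ (cyc q)) (cyc p)))
    (≡.trans (all-swap (λ s s′ → not ⌊ proj₁ s FinP.≟ proj₁ s′ ⌋) (cyc p) (cyc q))
      (≡.trans (all-cong (λ s′ → all-cong (λ s → ≡.cong not (≟-sym s s′)) (cyc p)) (cyc q))
        (≡.sym (≡.trans (not-any _ (cyc q)) (all-cong (λ s → not-any _ (cyc p)) (cyc q))))))
    where
    ≟-sym : ∀ (s s′ : Letter) → ⌊ proj₁ s FinP.≟ proj₁ s′ ⌋ ≡ ⌊ proj₁ s′ FinP.≟ proj₁ s ⌋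
    ≟-sym s s′ with proj₁ s FinP.≟ proj₁ s′
    ... | yes e = ≡.sym (⌊⌋-yes (proj₁ s′ FinP.≟ proj₁ s) (≡.sym e))
    ... | no ¬e = ≡.sym (⌊⌋-no (proj₁ s′ FinP.≟ proj₁ s) λ e → ¬e (≡.sym e))

  module _ (simple : ∀ p → SimpleCycle (cyc p)) where

    word-balanced : ∀ us → Balanced (word us)
    word-balanced []       h = ≡.refl
    word-balanced (p ∷ us) = Balanced-++ (cyc p) (word us) (path-balanced (SimpleCycle.loop (simple p))) (word-balanced us)

    -- Factorisations with a balanced left factor are those of the heap of cycles, by `CS-cycle`
    -- applied to one cycle at a time.
    CS-word : ∀ us (F : Word → Word → Carrier) → CS (word us) (λ S T → bal S * F S T) ≈ H.CS us (λ S T → F (word S) (word T))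
    CS-word []       F = trans (*-congʳ (ind-yes (balanced? []) λ _ → ≡.refl)) (*-identityˡ _)
    CS-word (p ∷ us) F = trans (CS-cycle (cyc p) (word us) F (simple p)) (trans (CS-word us _)
      (H.CS-cong us λ {S} _ → +-congˡ (*-congʳ (reflexive (≡.cong ind (clearAll-cycle p S))))))

    ⊛-word : ∀ {f g} us → Supported f → (f ⊛ g) (word us) ≈ H.CS us (λ S T → f (word S) * g (word T))
    ⊛-word {f} {g} us supp = trans (CS-cong (word us) λ {S} {T} _ → trans (*-congʳ (support S)) (*-assoc _ _ _)) (CS-word us (λ S T → f S * g T))
      where
      support : ∀ S → f S ≈ bal S * f S
      support S with balanced? S
      ... | yes b = sym (*-identityˡ _)
      ... | no ¬b = trans (supp S ¬b) (sym (zeroˡ _))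

    one-word : ∀ us → one (word us) ≈ H.one us
    one-word []       = refl
    one-word (p ∷ us) with cyc p | SimpleCycle.nonempty (simple p)
    ... | []    | ne = ⊥-elim (ne ≡.refl)
    ... | _ ∷ _ | ne = refl

    inner⇒< : ∀ {h} → h ∈ inner → toℕ h < n
    inner⇒< h∈ with MemP.∈-map⁻ _ h∈
    ... | i , _ , ≡.refl = ≡.subst (_< n) (≡.sym (FinP.toℕ-inject≤ i _)) (FinP.toℕ<n i)

    <⇒inner : ∀ {h} → toℕ h < n → h ∈ inner
    <⇒inner {h} h<n = ≡.subst (_∈ inner) (FinP.toℕ-injective (≡.trans (FinP.toℕ-inject≤ (Fin.fromℕ< h<n) _) (FinP.toℕ-fromℕ< h<n)))
      (inj∈ (Fin.fromℕ< h<n))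

    high : Letter → Bool
    high s = ⌊ n ℕ.≤? toℕ (proj₁ s) ⌋ ∨ ⌊ n ℕ.≤? toℕ (proj₂ s) ⌋

    any-false : ∀ x → any high x ≡ false → InRows inner x
    any-false []            _ = []
    any-false ((i , j) ∷ x) e with n ℕ.≤? toℕ i | n ℕ.≤? toℕ j
    ... | no n≰i | no _ = <⇒inner (ℕP.≰⇒> n≰i) ∷ any-false x e

    false-any : ∀ x → InRows inner x → All (λ a → proj₂ a ∈ inner) x → any high x ≡ false
    false-any []            _        _        = ≡.refl
    false-any ((i , j) ∷ x) (i∈ ∷ r) (j∈ ∷ c) with n ℕ.≤? toℕ i | n ℕ.≤? toℕ j
    ... | yes n≤i | _       = ⊥-elim (ℕP.<⇒≱ (inner⇒< i∈) n≤i)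
    ... | no _    | yes n≤j = ⊥-elim (ℕP.<⇒≱ (inner⇒< j∈) n≤j)
    ... | no _    | no _    = false-any x r c

    cycle-cols : ∀ {x} → SimpleCycle x → InRows inner x → All (λ a → proj₂ a ∈ inner) x
    cycle-cols {x} s r = All.tabulate λ a∈ → All.lookup (AllP.map⁺ {f = proj₁} r) (cycle-next s a∈)

    -- A product of cycles is balanced, so only the rows matter. `inJ` also tests end heights, but
    -- every end height of a cycle is one of its starting heights.
    closed-inner-word : ∀ us → closed inner (word us) ≈ ind (allNonJ us)
    closed-inner-word us = trans
      (ind-⇔ (inRows? inner (word us) ×-dec balanced? (word us)) (inRows? inner (word us)) proj₁ (λ r → r , word-balanced us))
      (rows-only us)
      where
      rows-only : ∀ us → ind ⌊ inRows? inner (word us) ⌋ ≈ ind (allNonJ us)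
      rows-only []       = ind-yes (inRows? inner []) []
      rows-only (p ∷ us) with inJ p in eq
      ... | true  = ind-no (inRows? inner (word (p ∷ us))) λ r → true≢false (≡.trans (≡.sym eq)
                      (false-any (cyc p) (AllP.++⁻ˡ (cyc p) r) (cycle-cols (simple p) (AllP.++⁻ˡ (cyc p) r))))
      ... | false = trans (ind-⇔ (inRows? inner (word (p ∷ us))) (inRows? inner (word us)) (AllP.++⁻ʳ (cyc p))
                      (λ r → AllP.++⁺ (any-false (cyc p) eq) r)) (rows-only us)

    closed-all-word : ∀ S → closed (allFin m) S ≈ bal S
    closed-all-word S = ind-⇔ (inRows? (allFin m) S ×-dec balanced? S) (balanced? S) proj₂
      (λ b → All.tabulate (λ _ → MemP.∈-allFin _) , b)

    outermost-inner : Ser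
    outermost-inner = outermost inner outer inner++outer

    module _ (X Y : List (Fin k) → Carrier) (Good-labels : List (Fin k) → Set)
             (good-split : ∀ {S T us} → Interleaving S T us → Good-labels us → Good-labels S × Good-labels T)
             (push-Y : ∀ us → Good-labels us → H.push Y us ≈ ind (allNonJ us))
             (push-XY : ∀ us → Good-labels us → H.push (X H.⋆ Y) us ≈ 1#) where

      -- Since `X ⋆ Y` counts every heap once and `Y` projects to `closed inner`, the series of all
      -- balanced words is the product of the projection of `X` with `closed inner`; the right
      -- factor `D inner` then cancels the latter.
      outermost-word : ∀ us → Good-labels us → outermost-inner (word us) ≈ H.push X us
      outermost-word us good = begin
        (closed (allFin m) ⊛ D inner) (word us)
          ≈⟨ CS-cong (word us) (λ {S} _ → *-congʳ (closed-all-word S)) ⟩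
        CS (word us) (λ S T → bal S * D inner T)
          ≈⟨ CS-word us (λ _ T → D inner T) ⟩
        H.CS us (λ S T → D inner (word T))
          ≈⟨ H.CS-cong us (λ {S} {T} i → trans (sym (*-identityˡ _)) (*-congʳ (sym (all-words S (proj₁ (good-split i good)))))) ⟩
        H.CS us (λ S T → H.CS S (λ S₁ S₂ → H.push X S₁ * closed inner (word S₂)) * D inner (word T))
          ≈⟨ H.CS-cong us (λ {S} _ → sym (H.CS-*ʳ S _ _)) ⟩
        H.CS us (λ S T → H.CS S (λ S₁ S₂ → H.push X S₁ * closed inner (word S₂) * D inner (word T)))
          ≈⟨ H.CS-assoc us (λ S₁ S₂ T → H.push X S₁ * closed inner (word S₂) * D inner (word T)) ⟩
        H.CS us (λ S T → H.CS T (λ T₁ T₂ → H.push X S * closed inner (word T₁) * D inner (word T₂)))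
          ≈⟨ H.CS-cong us (λ {S} {T} _ → trans (H.CS-cong T λ _ → *-assoc _ _ _) (trans (H.CS-*ˡ T _ _) (*-congˡ (cancel T)))) ⟩
        H.CS us (λ S T → H.push X S * H.one T)
          ≈⟨ H.⊛-identityʳ (H.push X) us ⟩
        H.push X us ∎
        where
        all-words : ∀ S → Good-labels S → H.CS S (λ S₁ S₂ → H.push X S₁ * closed inner (word S₂)) ≈ 1#
        all-words S good = trans (H.CS-cong S λ {S₁} {S₂} i → *-congˡ (trans (closed-inner-word S₂)
          (sym (push-Y S₂ (proj₂ (good-split i good)))))) (trans (sym (H.push-SP S X Y)) (push-XY S good))
        cancel : ∀ T → H.CS T (λ T₁ T₂ → closed inner (word T₁) * D inner (word T₂)) ≈ H.one T
        cancel T = trans (sym (⊛-word T (proj₂ (good-closed inner)))) (trans (closed-D inner outer inner++outer (word T)) (one-word T))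

      outermost-powers : (Xs : ℕ → List (Fin k) → Carrier) → Xs 0 H.≋ H.one → (∀ r → Xs (suc r) H.≋ X H.⋆ Xs r) →
        ∀ r us → Good-labels us → (outermost-inner ⊛^ r) (word us) ≈ H.push (Xs r) us
      outermost-powers Xs X₀ X₊ zero    us good = trans (one-word us) (sym (trans (H.push-cong us λ π _ → X₀ π) (push-one us)))
        where
        push-one : ∀ us → H.push H.one us ≈ H.one us
        push-one []       = refl
        push-one (p ∷ us) = H.push-0 (p ∷ us) λ { [] e → ⊥-elim (PermP.¬x∷xs↭[] e) ; (_ ∷ _) _ → refl }
      outermost-powers Xs X₀ X₊ (suc r) us good = begin
        (outermost-inner ⊛ (outermost-inner ⊛^ r)) (word us)
          ≈⟨ ⊛-word us (proj₂ (good-⊛ (good-closed (allFin m)) (good-D inner outer inner++outer))) ⟩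
        H.CS us (λ S T → outermost-inner (word S) * (outermost-inner ⊛^ r) (word T))
          ≈⟨ H.CS-cong us (λ {S} {T} i → *-cong (outermost-word S (proj₁ (good-split i good)))
               (outermost-powers Xs X₀ X₊ r T (proj₂ (good-split i good)))) ⟩
        H.CS us (λ S T → H.push X S * H.push (Xs r) T)
          ≈⟨ H.push-SP us X (Xs r) ⟨
        H.push (X H.⋆ Xs r) us
          ≈⟨ H.push-cong us (λ π _ → X₊ r π) ⟨
        H.push (Xs (suc r)) us ∎

-- Orders satisfying (2)-(4) and their cuts

module LabelWords (K : QAlgebra) (m n : ℕ) (μ : List (Fin m))
  (disj-sym : ∀ p q → Series.Coeff.disj K m n μ p q ≡ Series.Coeff.disj K m n μ q p) where
  open QAlgebra K using (R)
  open CommutativeRing R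
  open import Relation.Binary.Reasoning.Setoid setoid
  open RingSolving R using (solve; _:=_; _:+_; _:*_; :1)
  open Series K m using (_<ᵇF_; module Coeff)
  open Coeff n μ using (k; inJ; disj; cond2; cond3; cond4; takeThroughJ)
  open Trace R disj

  J : List (Fin k) → List (Fin k)
  J = filter (λ p → inJ p Bool.≟ true)

  valid : List (Fin k) → Bool
  valid π = cond2 π ∧ cond3 π ∧ cond4 π

  increasing : List (Fin k) → Bool
  increasing []          = true
  increasing (x ∷ [])    = true
  increasing (x ∷ y ∷ ρ) = not (y <ᵇF x) ∧ increasing (y ∷ ρ)

  allNonJ : List (Fin k) → Bool
  allNonJ = all (λ p → not (inJ p))

  links : Fin k → List (Fin k) → Bool
  links x π = any (λ y → not (disj x y)) (takeThroughJ π)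

  -- The condition for putting a cycle `x` outside 𝒥 in front of a valid order: (3) holds because
  -- `x` meets a cycle of the first segment, and (4) holds at the new first place.
  joins : Fin k → List (Fin k) → Bool
  joins x []      = false
  joins x (y ∷ π) = links x (y ∷ π) ∧ not (y <ᵇF x)

  J-yes : ∀ x π → inJ x ≡ true → J (x ∷ π) ≡ x ∷ J π
  J-yes x π e = ListP.filter-accept (λ p → inJ p Bool.≟ true) e

  J-no : ∀ x π → inJ x ≡ false → J (x ∷ π) ≡ J π
  J-no x π e = ListP.filter-reject (λ p → inJ p Bool.≟ true) λ e′ → true≢false (≡.trans (≡.sym e′) e)

  private
    cond3-J : ∀ x π → inJ x ≡ true → cond3 (x ∷ π) ≡ cond3 π
    cond3-J x π e rewrite e = ≡.refl

    cond4-J : ∀ x π → inJ x ≡ true → cond4 (x ∷ π) ≡ cond4 π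
    cond4-J x []      e = ≡.refl
    cond4-J x (y ∷ π) e rewrite e | ∨-zeroʳ (not (y <ᵇF x)) = ≡.refl

    cond4-nonJ : ∀ x y π → inJ x ≡ false → cond4 (x ∷ y ∷ π) ≡ not (y <ᵇF x) ∧ cond4 (y ∷ π)
    cond4-nonJ x y π e rewrite e | ∨-identityʳ (not (y <ᵇF x)) = ≡.refl

  valid-J : ∀ x π → inJ x ≡ true → valid (x ∷ π) ≡ valid π
  valid-J x π e = ≡.cong₂ _∧_ (cond2-J e) (≡.cong₂ _∧_ (cond3-J x π e) (cond4-J x π e))
    where
    cond2-J : inJ x ≡ true → cond2 (x ∷ π) ≡ cond2 π
    cond2-J e rewrite e = ≡.refl

  valid-nonJ : ∀ x π → inJ x ≡ false → valid (x ∷ π) ≡ joins x π ∧ valid π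
  valid-nonJ x []      e rewrite e = ≡.refl
  valid-nonJ x (y ∷ π) e rewrite e | ∨-identityʳ (not (y <ᵇF x)) =
    rearrange (any inJ (y ∷ π)) (cond2 π) (links x (y ∷ π)) (cond3 (y ∷ π)) (not (y <ᵇF x)) (cond4 (y ∷ π))
    where
    rearrange : ∀ a c l t h f → (a ∧ (a ∧ c)) ∧ ((not a ∨ l) ∧ t) ∧ (h ∧ f) ≡ (l ∧ h) ∧ (a ∧ c) ∧ t ∧ f
    rearrange false c     false t     h     f = ≡.refl
    rearrange false c     true  t     true  f = ≡.refl
    rearrange false c     true  t     false f = ≡.refl
    rearrange true  true  true  true  h     f = ≡.refl
    rearrange true  true  true  false true  f = ≡.refl
    rearrange true  true  true  false false f = ≡.refl
    rearrange true  true  false t     h     f = ≡.refl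
    rearrange true  false true  t     true  f = ≡.refl
    rearrange true  false true  t     false f = ≡.refl
    rearrange true  false false t     h     f = ≡.refl

  valid-any : ∀ x π → valid (x ∷ π) ≡ true → any inJ (x ∷ π) ≡ true
  valid-any x π e with any inJ (x ∷ π)
  ... | true  = ≡.refl

  takeThroughJ-++ : ∀ p q → any inJ p ≡ true → takeThroughJ (p ++ q) ≡ takeThroughJ p
  takeThroughJ-++ (x ∷ p) q e with inJ x
  ... | true  = ≡.refl
  ... | false = ≡.cong (x ∷_) (takeThroughJ-++ p q e)

  -- A valid nonempty prefix contains a cycle of 𝒥, so the segment that `x` has to meet ends inside
  -- the prefix.
  joins-prefix : ∀ x y p q → ind (joins x (y ∷ p)) * ind (valid (y ∷ p)) ≈ ind (joins x (y ∷ p ++ q)) * ind (valid (y ∷ p))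
  joins-prefix x y p q with valid (y ∷ p) in eq
  ... | false = trans (zeroʳ _) (sym (zeroʳ _))
  ... | true  = *-congʳ (reflexive (≡.cong (λ t → ind (any (λ z → not (disj x z)) t ∧ not (y <ᵇF x)))
                  (≡.sym (takeThroughJ-++ (y ∷ p) q (valid-any y p eq)))))

  SP-cong-++ : ∀ w {F G : List (Fin k) → List (Fin k) → Carrier} → (∀ p q → p ++ q ≡ w → F p q ≈ G p q) → SP w F ≈ SP w G
  SP-cong-++ []      e = e [] [] ≡.refl
  SP-cong-++ (x ∷ w) e = +-cong (e [] _ ≡.refl) (SP-cong-++ w λ p q eq → e (x ∷ p) q (≡.cong (x ∷_) eq))

  SP-0 : ∀ w {F : List (Fin k) → List (Fin k) → Carrier} → (∀ p q → p ++ q ≡ w → F p q ≈ 0#) → SP w F ≈ 0#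
  SP-0 []      e = e [] [] ≡.refl
  SP-0 (x ∷ w) e = trans (+-cong (e [] _ ≡.refl) (SP-0 w λ p q eq → e (x ∷ p) q (≡.cong (x ∷_) eq))) (+-identityʳ 0#)

  private
    head-nonJ : ∀ x y π (G : List (Fin k) → List (Fin k) → Carrier) → inJ x ≡ false →
      SP (y ∷ π) (λ p q → ind (valid (x ∷ p)) * G (J (x ∷ p)) q) ≈
      ind (joins x (y ∷ π)) * SP π (λ p q → ind (valid (y ∷ p)) * G (J (y ∷ p)) q)
    head-nonJ x y π G e = begin
      ind (valid (x ∷ [])) * G (J (x ∷ [])) (y ∷ π) + SP π (λ p q → ind (valid (x ∷ y ∷ p)) * G (J (x ∷ y ∷ p)) q)
        ≈⟨ trans (+-congʳ (trans (*-congʳ (reflexive (≡.cong ind (valid-nonJ x [] e)))) (zeroˡ _))) (+-identityˡ _) ⟩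
      SP π (λ p q → ind (valid (x ∷ y ∷ p)) * G (J (x ∷ y ∷ p)) q)
        ≈⟨ SP-cong-++ π (λ p q eq → trans (*-cong (trans (reflexive (≡.cong ind (valid-nonJ x (y ∷ p) e)))
             (trans (ind-∧ (joins x (y ∷ p)) _) (trans (joins-prefix x y p q) (*-congʳ (reflexive (≡.cong (λ v → ind (joins x (y ∷ v))) eq))))))
             (reflexive (≡.cong (λ j → G j q) (J-no x (y ∷ p) e)))) (*-assoc _ _ _)) ⟩
      SP π (λ p q → ind (joins x (y ∷ π)) * (ind (valid (y ∷ p)) * G (J (y ∷ p)) q))
        ≈⟨ SP-* π _ _ ⟩
      ind (joins x (y ∷ π)) * SP π (λ p q → ind (valid (y ∷ p)) * G (J (y ∷ p)) q) ∎

  -- A valid order is a sequence of segments, each ending in its only cycle of 𝒥, and validity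
  -- concerns every segment separately. Hence its cuts into two valid orders are the cuts of its
  -- 𝒥-subword.
  SP-valid : ∀ π (g : List (Fin k) → List (Fin k) → Carrier) →
    SP π (λ p q → ind (valid p) * (ind (valid q) * g (J p) (J q))) ≈ ind (valid π) * SP (J π) g
  SP-valid []      g = *-identityˡ _
  SP-valid (x ∷ π) g with true-or-false (inJ x)
  ... | inj₁ eq = begin
    1# * (ind (valid (x ∷ π)) * g [] (J (x ∷ π))) + SP π (λ p q → ind (valid (x ∷ p)) * (ind (valid q) * g (J (x ∷ p)) (J q)))
      ≈⟨ +-cong (trans (*-identityˡ _) (*-cong (reflexive (≡.cong ind (valid-J x π eq))) (reflexive (≡.cong (g []) (J-yes x π eq)))))
           (trans (SP-cong π λ p q → *-cong (reflexive (≡.cong ind (valid-J x p eq))) (*-congˡ (reflexive (≡.cong (λ j → g j (J q)) (J-yes x p eq)))))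
             (SP-valid π (λ a b → g (x ∷ a) b))) ⟩
    ind (valid π) * g [] (x ∷ J π) + ind (valid π) * SP (J π) (λ a b → g (x ∷ a) b)
      ≈⟨ distribˡ _ _ _ ⟨
    ind (valid π) * SP (x ∷ J π) g
      ≈⟨ *-cong (reflexive (≡.cong ind (valid-J x π eq))) (reflexive (≡.cong (λ j → SP j g) (J-yes x π eq))) ⟨
    ind (valid (x ∷ π)) * SP (J (x ∷ π)) g ∎
  SP-valid (x ∷ [])      g | inj₂ eq rewrite eq = trans (+-cong (trans (*-identityˡ _) (zeroˡ _)) (zeroˡ _)) (trans (+-identityʳ _) (sym (zeroˡ _)))
  SP-valid (x ∷ y ∷ π) g | inj₂ eq = begin
    1# * (ind (valid (x ∷ y ∷ π)) * g [] (J (x ∷ y ∷ π))) + SP (y ∷ π) (λ p q → ind (valid (x ∷ p)) * (ind (valid q) * g (J (x ∷ p)) (J q)))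
      ≈⟨ +-cong (*-congˡ (*-cong (trans (reflexive (≡.cong ind (valid-nonJ x (y ∷ π) eq))) (ind-∧ (joins x (y ∷ π)) _)) (reflexive (≡.cong (g []) (J-no x (y ∷ π) eq)))))
                (head-nonJ x y π (λ a q → ind (valid q) * g a (J q)) eq) ⟩
    1# * ((c * ind (valid (y ∷ π))) * g [] (J (y ∷ π))) + c * SP π (λ p q → ind (valid (y ∷ p)) * (ind (valid q) * g (J (y ∷ p)) (J q)))
      ≈⟨ solve 4 (λ c v g r → :1 :* ((c :* v) :* g) :+ c :* r := c :* (:1 :* (v :* g) :+ r)) refl _ _ _ _ ⟩
    c * SP (y ∷ π) (λ p q → ind (valid p) * (ind (valid q) * g (J p) (J q)))
      ≈⟨ *-congˡ (SP-valid (y ∷ π) g) ⟩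
    c * (ind (valid (y ∷ π)) * SP (J (y ∷ π)) g)
      ≈⟨ *-assoc _ _ _ ⟨
    (c * ind (valid (y ∷ π))) * SP (J (y ∷ π)) g
      ≈⟨ *-cong (trans (sym (ind-∧ (joins x (y ∷ π)) _)) (reflexive (≡.cong ind (≡.sym (valid-nonJ x (y ∷ π) eq)))))
                (reflexive (≡.cong (λ j → SP j g) (≡.sym (J-no x (y ∷ π) eq)))) ⟩
    ind (valid (x ∷ y ∷ π)) * SP (J (x ∷ y ∷ π)) g ∎
    where c = ind (joins x (y ∷ π))

  -- This counts the ways to cut a word into `r` increasing blocks, empty blocks allowed.
  cuts : ℕ → List (Fin k) → Carrier
  cuts zero    ρ = one ρ
  cuts (suc r) ρ = SP ρ (λ a b → ind (increasing a) * cuts r b)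

  X : ℕ → List (Fin k) → Carrier
  X r π = ind (valid π) * cuts r (J π)

  cuts-1 : ∀ ρ → cuts 1 ρ ≈ ind (increasing ρ)
  cuts-1 ρ = collapse ρ (λ a → ind (increasing a))
    where
    collapse : ∀ ρ (f : List (Fin k) → Carrier) → SP ρ (λ a b → f a * one b) ≈ f ρ
    collapse []      f = *-identityʳ _
    collapse (x ∷ ρ) f = trans (+-cong (zeroʳ _) (collapse ρ (λ a → f (x ∷ a)))) (+-identityˡ _)

  X-0 : X 0 ≋ one
  X-0 []      = *-identityˡ _
  X-0 (x ∷ π) with true-or-false (inJ x)
  ... | inj₁ eq = trans (*-congˡ (reflexive (≡.cong one (J-yes x π eq)))) (zeroʳ _)
  ... | inj₂ eq = begin
    ind (valid (x ∷ π)) * one (J (x ∷ π))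
      ≈⟨ *-cong (trans (reflexive (≡.cong ind (valid-nonJ x π eq))) (ind-∧ (joins x π) _)) (reflexive (≡.cong one (J-no x π eq))) ⟩
    (ind (joins x π) * ind (valid π)) * one (J π)  ≈⟨ *-assoc _ _ _ ⟩
    ind (joins x π) * X 0 π            ≈⟨ *-congˡ (X-0 π) ⟩
    ind (joins x π) * one π            ≈⟨ empty π ⟩
    0#                                 ∎
    where
    empty : ∀ π → ind (joins x π) * one π ≈ 0#
    empty []      = zeroˡ _
    empty (_ ∷ _) = zeroʳ _

  -- By `SP-valid`, splitting the first of r + 1 blocks off the 𝒥-subword splits the whole order
  -- into two valid ones.
  X-suc : ∀ r → X (suc r) ≋ X 1 ⋆ X r
  X-suc r π = trans (sym (SP-valid π (λ a b → ind (increasing a) * cuts r b))) (SP-cong π λ p q →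
    trans (solve 4 (λ v u i c → v :* (u :* (i :* c)) := (v :* i) :* (u :* c)) refl _ _ _ _)
          (*-congʳ (*-congˡ (sym (cuts-1 (J p))))))

  Y : List (Fin k) → Carrier
  Y q = ind (allNonJ q ∧ increasing q)

  -- Validity without (2): cycles outside 𝒥 may follow the last cycle of 𝒥.
  lax : List (Fin k) → Bool
  lax π = cond3 π ∧ cond4 π

  private
    record NoJ (π : List (Fin k)) : Set where
      field
        J-[]     : J π ≡ []
        allNonJ≡ : allNonJ π ≡ true
        cond3≡   : cond3 π ≡ true
        cond4≡   : cond4 π ≡ increasing π

    noJ : ∀ π → any inJ π ≡ false → NoJ π
    noJ []      e = record { J-[] = ≡.refl ; allNonJ≡ = ≡.refl ; cond3≡ = ≡.refl ; cond4≡ = ≡.refl }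
    noJ (x ∷ π) e with true-or-false (inJ x)
    ... | inj₁ eq = ⊥-elim (true≢false (≡.trans (≡.sym (≡.cong (_∨ any inJ π) eq)) e))
    ... | inj₂ eq = record
      { J-[] = ≡.trans (J-no x π eq) J-[]
      ; allNonJ≡ = ≡.cong₂ (λ a b → not a ∧ b) eq allNonJ≡
      ; cond3≡ = ≡.trans (≡.cong₂ (λ a b → (a ∨ not b ∨ links x π) ∧ cond3 π) eq tail) cond3≡
      ; cond4≡ = cond4-step π cond4≡ }
      where
      tail : any inJ π ≡ false
      tail = ≡.trans (≡.sym (≡.cong (_∨ any inJ π) eq)) e
      open NoJ (noJ π tail)
      cond4-step : ∀ π → cond4 π ≡ increasing π → cond4 (x ∷ π) ≡ increasing (x ∷ π)
      cond4-step []      _  = ≡.refl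
      cond4-step (y ∷ π) ih = ≡.trans (cond4-nonJ x y π eq) (≡.cong (not (y <ᵇF x) ∧_) ih)

    any-prefix : ∀ p q → any inJ (p ++ q) ≡ false → any inJ p ≡ false
    any-prefix []      q e = ≡.refl
    any-prefix (x ∷ p) q e with inJ x
    ... | false = any-prefix p q e

    any-allNonJ : ∀ π → any inJ π ≡ true → allNonJ π ≡ false
    any-allNonJ (x ∷ π) e with inJ x
    ... | true  = ≡.refl
    ... | false = any-allNonJ π e

  private
   SP-lax-nonJ : ∀ x y π (g : List (Fin k) → Carrier) → inJ x ≡ false →
     SP (y ∷ π) (λ p q → ind (valid p) * (Y q * g (J p))) ≈ ind (lax (y ∷ π)) * g (J (y ∷ π)) →
     SP (x ∷ y ∷ π) (λ p q → ind (valid p) * (Y q * g (J p))) ≈ ind (lax (x ∷ y ∷ π)) * g (J (x ∷ y ∷ π))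
   SP-lax-nonJ x y π g eq ih with true-or-false (any inJ (y ∷ π))
   ... | inj₁ any≡ = begin
     1# * (Y (x ∷ y ∷ π) * g []) + SP (y ∷ π) (λ p q → ind (valid (x ∷ p)) * (Y q * g (J (x ∷ p))))
       ≈⟨ +-cong (trans (*-identityˡ _) (trans (*-congʳ Y-x) (zeroˡ _))) (head-nonJ x y π (λ a q → Y q * g a) eq) ⟩
     0# + c * SP π (λ p q → ind (valid (y ∷ p)) * (Y q * g (J (y ∷ p))))
       ≈⟨ trans (+-identityˡ _) (*-congˡ (sym (trans (+-congʳ (trans (*-identityˡ _) (trans (*-congʳ Y-y) (zeroˡ _)))) (+-identityˡ _)))) ⟩
     c * SP (y ∷ π) (λ p q → ind (valid p) * (Y q * g (J p)))
       ≈⟨ trans (*-congˡ ih) (sym (*-assoc _ _ _)) ⟩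
     (c * ind (lax (y ∷ π))) * g (J (y ∷ π))
       ≈⟨ *-cong (trans (sym (ind-∧ (joins x (y ∷ π)) _)) (reflexive (≡.cong ind (≡.trans
            (rearrange (links x (y ∷ π)) (not (y <ᵇF x)) (cond3 (y ∷ π)) (cond4 (y ∷ π)))
            (≡.cong₂ _∧_ (≡.sym cond3-x) (≡.sym (cond4-nonJ x y π eq)))))))
            (reflexive (≡.cong g (≡.sym (J-no x (y ∷ π) eq)))) ⟩
     ind (lax (x ∷ y ∷ π)) * g (J (x ∷ y ∷ π)) ∎
     where
     c = ind (joins x (y ∷ π))
     Y-y : Y (y ∷ π) ≈ 0#
     Y-y = reflexive (≡.cong (λ b → ind (b ∧ increasing (y ∷ π))) (any-allNonJ (y ∷ π) any≡))
     Y-x : Y (x ∷ y ∷ π) ≈ 0#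
     Y-x = reflexive (≡.cong₂ (λ a b → ind ((not a ∧ b) ∧ increasing (x ∷ y ∷ π))) eq (any-allNonJ (y ∷ π) any≡))
     cond3-x : cond3 (x ∷ y ∷ π) ≡ links x (y ∷ π) ∧ cond3 (y ∷ π)
     cond3-x = ≡.cong₂ (λ a b → (a ∨ not b ∨ links x (y ∷ π)) ∧ cond3 (y ∷ π)) eq any≡
     rearrange : ∀ l h t f → (l ∧ h) ∧ t ∧ f ≡ (l ∧ t) ∧ (h ∧ f)
     rearrange false h     t     f = ≡.refl
     rearrange true  true  t     f = ≡.refl
     rearrange true  false true  f = ≡.refl
     rearrange true  false false f = ≡.refl
   ... | inj₂ any≡ = begin
     1# * (Y (x ∷ y ∷ π) * g []) + SP (y ∷ π) (λ p q → ind (valid (x ∷ p)) * (Y q * g (J (x ∷ p))))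
       ≈⟨ +-cong (*-identityˡ _) (trans (head-nonJ x y π (λ a q → Y q * g a) eq) (trans (*-congˡ (SP-0 π none)) (zeroʳ _))) ⟩
     Y (x ∷ y ∷ π) * g [] + 0#
       ≈⟨ +-identityʳ _ ⟩
     Y (x ∷ y ∷ π) * g []
       ≈⟨ *-cong (reflexive (≡.cong ind (≡.trans (≡.cong (_∧ increasing (x ∷ y ∷ π)) N.allNonJ≡)
            (≡.sym (≡.cong₂ _∧_ N.cond3≡ N.cond4≡))))) (reflexive (≡.cong g (≡.sym N.J-[]))) ⟩
     ind (lax (x ∷ y ∷ π)) * g (J (x ∷ y ∷ π)) ∎
     where
     module N = NoJ (noJ (x ∷ y ∷ π) (≡.cong₂ _∨_ eq any≡))
     none : ∀ p q → p ++ q ≡ π → ind (valid (y ∷ p)) * (Y q * g (J (y ∷ p))) ≈ 0#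
     none p q ≡.refl = trans (*-congʳ (reflexive (≡.cong (λ b → ind ((b ∧ cond2 p) ∧ cond3 (y ∷ p) ∧ cond4 (y ∷ p))) (any-prefix (y ∷ p) q any≡)))) (zeroˡ _)

  -- A nonempty left part must end in a cycle of 𝒥 by (2), and `Y` allows none in the right part, so
  -- a single cut contributes.
  SP-lax : ∀ π (g : List (Fin k) → Carrier) → SP π (λ p q → ind (valid p) * (Y q * g (J p))) ≈ ind (lax π) * g (J π)
  SP-lax []      g = *-identityˡ _
  SP-lax (x ∷ π) g with true-or-false (inJ x)
  ... | inj₁ eq = begin
    1# * (Y (x ∷ π) * g []) + SP π (λ p q → ind (valid (x ∷ p)) * (Y q * g (J (x ∷ p))))
      ≈⟨ +-cong (trans (*-identityˡ _) (trans (*-congʳ (reflexive (≡.cong (λ b → ind ((not b ∧ allNonJ π) ∧ increasing (x ∷ π))) eq))) (zeroˡ _)))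
           (trans (SP-cong π λ p q → *-cong (reflexive (≡.cong ind (valid-J x p eq))) (*-congˡ (reflexive (≡.cong g (J-yes x p eq)))))
             (SP-lax π (λ a → g (x ∷ a)))) ⟩
    0# + ind (lax π) * g (x ∷ J π)
      ≈⟨ +-identityˡ _ ⟩
    ind (lax π) * g (x ∷ J π)
      ≈⟨ *-cong (reflexive (≡.cong ind (≡.cong₂ _∧_ (cond3-J x π eq) (cond4-J x π eq)))) (reflexive (≡.cong g (J-yes x π eq))) ⟨
    ind (lax (x ∷ π)) * g (J (x ∷ π)) ∎
  SP-lax (x ∷ [])    g | inj₂ eq rewrite eq = trans (+-cong (trans (*-identityˡ _) (*-identityˡ _)) (zeroˡ _)) (trans (+-identityʳ _) (sym (*-identityˡ _)))
  SP-lax (x ∷ y ∷ π) g | inj₂ eq = SP-lax-nonJ x y π g eq (SP-lax (y ∷ π) g)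

  -- The orders of which every heap has exactly one.
  clean : List (Fin k) → Bool
  clean π = lax π ∧ increasing (J π)

  -- An order meeting (3) and (4) is cut uniquely after its last cycle of 𝒥.
  X⋆Y : ∀ π → (X 1 ⋆ Y) π ≈ ind (clean π)
  X⋆Y π = begin
    SP π (λ p q → ind (valid p) * cuts 1 (J p) * Y q)
      ≈⟨ SP-cong π (λ p q → trans (*-assoc _ _ _) (*-congˡ (trans (*-comm _ _) (*-congˡ (cuts-1 (J p)))))) ⟩
    SP π (λ p q → ind (valid p) * (Y q * ind (increasing (J p))))
      ≈⟨ SP-lax π (λ a → ind (increasing a)) ⟩
    ind (lax π) * ind (increasing (J π))
      ≈⟨ ind-∧ (lax π) (increasing (J π)) ⟨
    ind (clean π) ∎

-- Inserting the smallest label: uniqueness of orders, condition (1), and the binomial coefficient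

module LabelInsertions (K : QAlgebra) (m n : ℕ) (μ : List (Fin m))
  (disj-sym : ∀ p q → Series.Coeff.disj K m n μ p q ≡ Series.Coeff.disj K m n μ q p) where
  open QAlgebra K using (R)
  open CommutativeRing R
  open import Relation.Binary.Reasoning.Setoid setoid
  open RingSolving R using (solve; _:=_; _:+_; _:*_; _:-_; :-_; :0; :1; natR-+)
  open Series K m using (_<ᵇF_; module Coeff; insertAll; perms; binomR)
  open Coeff n μ using (k; inJ; disj; cond1; cond3; cond4; takeThroughJ; descents)
  open Trace R disj
  open LabelWords K m n μ disj-sym
  open Permutations K m using (insertAll-↭; perms-↭)
  open Binomial K m
  open Sums ring

  <ᵇ-true : ∀ {x y : Fin k} → x Fin.< y → (x <ᵇF y) ≡ true
  <ᵇ-true {x} {y} x<y = ⌊⌋-yes (x Fin.<? y) x<y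

  <ᵇ-false : ∀ {x y : Fin k} → x Fin.< y → (y <ᵇF x) ≡ false
  <ᵇ-false {x} {y} x<y = ⌊⌋-no (y Fin.<? x) (FinP.<-asym x<y)

  private
    ∧-trueʳ : ∀ a b → a ∧ b ≡ true → b ≡ true
    ∧-trueʳ true b e = e

    ind-false : ∀ {b} → b ≡ false → ind b ≈ 0#
    ind-false e = reflexive (≡.cong ind e)

  data Ins (a : Fin k) : List (Fin k) → List (Fin k) → Set where
    here  : ∀ {π} → Ins a π (a ∷ π)
    there : ∀ {y π ρ} → Ins a π ρ → Ins a (y ∷ π) (y ∷ ρ)

  INS-cong-Ins : ∀ a π {F G} → (∀ {ρ} → Ins a π ρ → F ρ ≈ G ρ) → INS a π F ≈ INS a π G
  INS-cong-Ins a []      e = e here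
  INS-cong-Ins a (y ∷ π) e = +-cong (e here) (*-congˡ (INS-cong-Ins a π λ i → e (there i)))

  INS-0 : ∀ a π {F} → (∀ {ρ} → Ins a π ρ → F ρ ≈ 0#) → INS a π F ≈ 0#
  INS-0 a π e = trans (INS-cong-Ins a π λ i → trans (e i) (sym (zeroˡ 0#))) (trans (INS-* a π 0# (λ _ → 0#)) (zeroˡ _))

  head-≥ : Fin k → List (Fin k) → Bool
  head-≥ y []      = true
  head-≥ y (z ∷ _) = not (z <ᵇF y)

  head-≥-minimum : ∀ a π → All (a Fin.<_) π → head-≥ a π ≡ true
  head-≥-minimum a []      _         = ≡.refl
  head-≥-minimum a (z ∷ π) (a<z ∷ _) = ≡.cong not (<ᵇ-false a<z)

  increasing-∷ : ∀ y ρ → increasing (y ∷ ρ) ≡ head-≥ y ρ ∧ increasing ρ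
  increasing-∷ y []      = ≡.refl
  increasing-∷ y (z ∷ ρ) = ≡.refl

  insert-not-increasing : ∀ {a y π ρ} → Ins a π ρ → a Fin.< y → All (a Fin.<_) π → increasing (y ∷ ρ) ≡ false
  insert-not-increasing {a} {π = π} here a<y all = ≡.cong (λ b → not b ∧ increasing (a ∷ π)) (<ᵇ-true a<y)
  insert-not-increasing {y = y} (there {z} i) a<y (a<z ∷ all) rewrite insert-not-increasing i a<z all = ∧-zeroʳ (not (z <ᵇF y))

  -- A smallest label can stand only at the front of an increasing word.
  INS-Y : ∀ a π → All (a Fin.<_) π → INS a π Y ≈ ind (not (inJ a)) * Y π
  INS-Y a []      _               = trans (ind-∧ (not (inJ a) ∧ true) true) (trans (*-identityʳ _) (ind-∧ (not (inJ a)) true))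
  INS-Y a (y ∷ π) all@(a<y ∷ all′) = begin
    Y (a ∷ y ∷ π) + ind (disj y a) * INS a π (λ ρ → Y (y ∷ ρ))
      ≈⟨ +-cong (reflexive (≡.cong (λ b → ind ((not (inJ a) ∧ allNonJ (y ∷ π)) ∧ (b ∧ increasing (y ∷ π)))) (head-≥-minimum a (y ∷ π) all)))
           (trans (*-congˡ (INS-0 a π λ {ρ} i → ind-false (≡.trans (≡.cong (allNonJ (y ∷ ρ) ∧_) (insert-not-increasing i a<y all′)) (∧-zeroʳ _)))) (zeroʳ _)) ⟩
    ind ((not (inJ a) ∧ allNonJ (y ∷ π)) ∧ increasing (y ∷ π)) + 0#
      ≈⟨ +-identityʳ _ ⟩
    ind ((not (inJ a) ∧ allNonJ (y ∷ π)) ∧ increasing (y ∷ π))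
      ≈⟨ trans (reflexive (≡.cong ind (∧-assoc (not (inJ a)) _ _))) (ind-∧ (not (inJ a)) _) ⟩
    ind (not (inJ a)) * Y (y ∷ π) ∎

  -- The increasing sequence `us` is its own only increasing rearrangement, so `Y` counts each heap
  -- outside 𝒥 once.
  push-Y : ∀ us → AllPairs Fin._<_ us → push Y us ≈ ind (allNonJ us)
  push-Y []       _           = refl
  push-Y (a ∷ us) (a< ∷ inc) = begin
    push (λ π → INS a π Y) us                  ≈⟨ push-cong us (λ π p → INS-Y a π (PermP.All-resp-↭ p a<)) ⟩
    push (λ π → ind (not (inJ a)) * Y π) us    ≈⟨ push-* us _ Y ⟩
    ind (not (inJ a)) * push Y us              ≈⟨ *-congˡ (push-Y us inc) ⟩
    ind (not (inJ a)) * ind (allNonJ us)       ≈⟨ ind-∧ (not (inJ a)) (allNonJ us) ⟨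
    ind (allNonJ (a ∷ us))                     ∎

  linked : Fin k → List (Fin k) → Bool
  linked y ρ = not (any inJ ρ) ∨ links y ρ

  clean-J : ∀ y ρ → inJ y ≡ true → clean (y ∷ ρ) ≡ head-≥ y (J ρ) ∧ clean ρ
  clean-J y ρ e = ≡.trans (≡.cong₂ _∧_ (lax-J ρ) (≡.trans (≡.cong increasing (J-yes y ρ e)) (increasing-∷ y (J ρ))))
    (rearrange (lax ρ) (head-≥ y (J ρ)) (increasing (J ρ)))
    where
    lax-J : ∀ ρ → lax (y ∷ ρ) ≡ lax ρ
    lax-J []      rewrite e = ≡.refl
    lax-J (z ∷ ρ) rewrite e | ∨-zeroʳ (not (z <ᵇF y)) = ≡.refl
    rearrange : ∀ l h i → l ∧ (h ∧ i) ≡ h ∧ (l ∧ i)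
    rearrange true  h     i = ≡.refl
    rearrange false true  i = ≡.refl
    rearrange false false i = ≡.refl

  clean-nonJ : ∀ y ρ → inJ y ≡ false → clean (y ∷ ρ) ≡ (linked y ρ ∧ head-≥ y ρ) ∧ clean ρ
  clean-nonJ y ρ e = ≡.trans (≡.cong₂ _∧_ (≡.cong₂ _∧_ cond3-y (cond4-y ρ)) (≡.cong increasing (J-no y ρ e)))
    (rearrange (linked y ρ) (cond3 ρ) (head-≥ y ρ) (cond4 ρ) (increasing (J ρ)))
    where
    cond3-y : cond3 (y ∷ ρ) ≡ linked y ρ ∧ cond3 ρ
    cond3-y rewrite e = ≡.refl
    cond4-y : ∀ ρ → cond4 (y ∷ ρ) ≡ head-≥ y ρ ∧ cond4 ρ
    cond4-y []      = ≡.refl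
    cond4-y (z ∷ ρ) rewrite e | ∨-identityʳ (not (z <ᵇF y)) = ≡.refl
    rearrange : ∀ l t h f i → ((l ∧ t) ∧ h ∧ f) ∧ i ≡ (l ∧ h) ∧ (t ∧ f) ∧ i
    rearrange false t     h     f i = ≡.refl
    rearrange true  true  true  f i = ≡.refl
    rearrange true  true  false f i = ≡.refl
    rearrange true  false true  f i = ≡.refl
    rearrange true  false false f i = ≡.refl

  C : List (Fin k) → Carrier
  C π = ind (clean π)

  clean-tail : ∀ y ρ → clean (y ∷ ρ) ≡ true → clean ρ ≡ true
  clean-tail y ρ e with true-or-false (inJ y)
  ... | inj₁ j = ∧-trueʳ (head-≥ y (J ρ)) _ (≡.trans (≡.sym (clean-J y ρ j)) e)
  ... | inj₂ j = ∧-trueʳ (linked y ρ ∧ head-≥ y ρ) _ (≡.trans (≡.sym (clean-nonJ y ρ j)) e)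

  not-clean-∷ : ∀ y ρ → clean ρ ≡ false → clean (y ∷ ρ) ≡ false
  not-clean-∷ y ρ e with true-or-false (clean (y ∷ ρ))
  ... | inj₂ e′ = e′
  ... | inj₁ e′ = ⊥-elim (true≢false (≡.trans (≡.sym (clean-tail y ρ e′)) e))

  not-clean-descent : ∀ {y a π} → inJ y ≡ false → a Fin.< y → clean (y ∷ a ∷ π) ≡ false
  not-clean-descent {y} {a} {π} j a<y = ≡.trans (clean-nonJ y (a ∷ π) j)
    (≡.cong (_∧ clean (a ∷ π)) (≡.trans (≡.cong (λ b → linked y (a ∷ π) ∧ not b) (<ᵇ-true a<y)) (∧-zeroʳ _)))

  -- Away from the front, a smallest label of 𝒥 follows either a cycle of 𝒥, which gives a descent
  -- of the 𝒥-subword, or one outside 𝒥, against (4).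
  insert-J-not-clean : ∀ {a y π ρ} → inJ a ≡ true → Ins a π ρ → a Fin.< y → All (a Fin.<_) π → clean (y ∷ ρ) ≡ false
  insert-J-not-clean {a} {y} {π} ja here a<y all with true-or-false (inJ y)
  ... | inj₁ j = ≡.trans (clean-J y (a ∷ π) j) (≡.trans (≡.cong (λ v → head-≥ y v ∧ clean (a ∷ π)) (J-yes a π ja))
                   (≡.cong (λ b → not b ∧ clean (a ∷ π)) (<ᵇ-true a<y)))
  ... | inj₂ j = not-clean-descent j a<y
  insert-J-not-clean {y = y} ja (there {z} {ρ = ρ} i) a<y (a<z ∷ all) = not-clean-∷ y (z ∷ ρ) (insert-J-not-clean ja i a<z all)

  INS-clean-J : ∀ a π → inJ a ≡ true → All (a Fin.<_) π → INS a π C ≈ C π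
  INS-clean-J a [] ja _ = reflexive (≡.cong ind (clean-J a [] ja))
  INS-clean-J a (y ∷ π) ja all@(a<y ∷ all′) = begin
    C (a ∷ y ∷ π) + ind (disj y a) * INS a π (λ ρ → C (y ∷ ρ))
      ≈⟨ +-cong (reflexive (≡.cong ind (≡.trans (clean-J a (y ∷ π) ja) (≡.cong (_∧ clean (y ∷ π))
             (head-≥-minimum a (J (y ∷ π)) (AllP.filter⁺ (λ p → inJ p Bool.≟ true) all))))))
           (trans (*-congˡ (INS-0 a π λ i → ind-false (insert-J-not-clean ja i a<y all′))) (zeroʳ _)) ⟩
    C (y ∷ π) + 0# ≈⟨ +-identityʳ _ ⟩
    C (y ∷ π) ∎

  J-Ins : ∀ {a π ρ} → inJ a ≡ false → Ins a π ρ → J ρ ≡ J π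
  J-Ins {a} {π} ja here = J-no a π ja
  J-Ins ja (there {y} {π} {ρ} i) with true-or-false (inJ y)
  ... | inj₁ j = ≡.trans (J-yes y ρ j) (≡.trans (≡.cong (y ∷_) (J-Ins ja i)) (≡.sym (J-yes y π j)))
  ... | inj₂ j = ≡.trans (J-no y ρ j) (≡.trans (J-Ins ja i) (≡.sym (J-no y π j)))

  any-Ins : ∀ {a π ρ} → inJ a ≡ false → Ins a π ρ → any inJ ρ ≡ any inJ π
  any-Ins {π = π} ja here  = ≡.cong (_∨ any inJ π) ja
  any-Ins ja (there {y} i) = ≡.cong (inJ y ∨_) (any-Ins ja i)

  -- Behind `z` the smaller `a` cannot stand before the next cycle of 𝒥, since a cycle outside 𝒥
  -- would then be followed by a smaller label. So the segment is unchanged.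
  takeThroughJ-Ins : ∀ {a z π ρ} → inJ z ≡ false → Ins a π ρ → a Fin.< z → All (a Fin.<_) π → clean (z ∷ ρ) ≡ true →
    takeThroughJ ρ ≡ takeThroughJ π
  takeThroughJ-Ins jz here a<z all e = ⊥-elim (true≢false (≡.trans (≡.sym e) (not-clean-descent jz a<z)))
  takeThroughJ-Ins {z = z} jz (there {y} {ρ = ρ} i) a<z (a<y ∷ all) e with true-or-false (inJ y)
  ... | inj₁ j rewrite j = ≡.refl
  ... | inj₂ j with takeThroughJ-Ins j i a<y all (clean-tail z (y ∷ ρ) e)
  ...   | ih rewrite j = ≡.cong (y ∷_) ih

  linked-Ins : ∀ {a y z π ρ} → inJ a ≡ false → Ins a π ρ → a Fin.< z → All (a Fin.<_) π → clean (z ∷ ρ) ≡ true →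
    linked y (z ∷ ρ) ≡ linked y (z ∷ π)
  linked-Ins {y = y} {z} {π} {ρ} ja i a<z all e = ≡.cong₂ (λ b t → not (inJ z ∨ b) ∨ any (λ x → not (disj y x)) t) (any-Ins ja i) through
    where
    through : takeThroughJ (z ∷ ρ) ≡ takeThroughJ (z ∷ π)
    through with true-or-false (inJ z)
    ... | inj₁ j rewrite j = ≡.refl
    ... | inj₂ j with takeThroughJ-Ins j i a<z all e
    ...   | ih rewrite j = ≡.cong (z ∷_) ih

  private
   -- The place right behind `y` is excluded by (4). Let `c` say whether `y` may stand in front of
   -- `z ∷ π`. The insertions behind `z` give `c` times those into `z ∷ π`, which by induction are
   -- what the front of `z ∷ π` leaves over. If `a` meets `y`, only the very front is possible;
   -- otherwise being linked to `y ∷ z ∷ π` and to `z ∷ π` is the same, and the two counts add up to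
   -- one.
   INS-clean-step : ∀ a y z π → inJ a ≡ false → inJ y ≡ false → All (a Fin.<_) (y ∷ z ∷ π) →
     INS a (z ∷ π) C ≈ C (z ∷ π) → INS a (y ∷ z ∷ π) C ≈ C (y ∷ z ∷ π)
   INS-clean-step a y z π ja j all@(a<y ∷ all′@(a<z ∷ all″)) ih = begin
     C (a ∷ y ∷ z ∷ π) + ind (disj y a) * (C (y ∷ a ∷ z ∷ π) + ind (disj z a) * INS a π (λ ρ → C (y ∷ z ∷ ρ)))
       ≈⟨ +-cong (front (y ∷ z ∷ π) all) (*-congˡ (trans (+-cong (ind-false (not-clean-descent j a<y))
            (*-congˡ (trans (INS-cong-Ins a π later) (INS-* a π _ _)))) (+-identityˡ _))) ⟩
     ind (linked a (y ∷ z ∷ π)) * C (y ∷ z ∷ π) + ind (disj y a) * (ind (disj z a) * (c * I))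
       ≈⟨ +-cong (*-congʳ (reflexive (≡.cong ind linked-y)))
            (*-congˡ (trans (solve 3 (λ d c i → d :* (c :* i) := c :* (d :* i)) refl _ _ _) (*-congˡ remaining))) ⟩
     ind (not N ∨ not (disj y a) ∨ B) * C (y ∷ z ∷ π) + ind (disj y a) * (c * (C (z ∷ π) - ind (not N ∨ B) * C (z ∷ π)))
       ≈⟨ +-cong (*-congˡ C-y) (*-congˡ (solve 3 (λ c w b → c :* (w :- b :* w) := (:1 :- b) :* (c :* w)) refl _ _ _)) ⟩
     ind (not N ∨ not (disj y a) ∨ B) * (c * C (z ∷ π)) + ind (disj y a) * ((1# - ind (not N ∨ B)) * (c * C (z ∷ π)))
       ≈⟨ balance N (disj y a) B (c * C (z ∷ π)) ⟩
     c * C (z ∷ π)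
       ≈⟨ C-y ⟨
     C (y ∷ z ∷ π) ∎
     where
     N B : Bool
     N = any inJ (z ∷ π)
     B = links a (z ∷ π)
     c I : Carrier
     c = ind (linked y (z ∷ π) ∧ head-≥ y (z ∷ π))
     I = INS a π (λ ρ → C (z ∷ ρ))
     front : ∀ π → All (a Fin.<_) π → C (a ∷ π) ≈ ind (linked a π) * C π
     front π all = trans (reflexive (≡.cong ind (clean-nonJ a π ja))) (trans (ind-∧ (linked a π ∧ head-≥ a π) _)
       (*-congʳ (trans (ind-∧ (linked a π) _) (trans (*-congˡ (reflexive (≡.cong ind (head-≥-minimum a π all)))) (*-identityʳ _)))))
     C-y : C (y ∷ z ∷ π) ≈ c * C (z ∷ π)
     C-y = trans (reflexive (≡.cong ind (clean-nonJ y (z ∷ π) j))) (ind-∧ (linked y (z ∷ π) ∧ head-≥ y (z ∷ π)) _)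
     later : ∀ {ρ} → Ins a π ρ → C (y ∷ z ∷ ρ) ≈ c * C (z ∷ ρ)
     later {ρ} i = trans (trans (reflexive (≡.cong ind (clean-nonJ y (z ∷ ρ) j))) (ind-∧ (linked y (z ∷ ρ) ∧ head-≥ y (z ∷ ρ)) _)) same
       where
       same : ind (linked y (z ∷ ρ) ∧ head-≥ y (z ∷ ρ)) * C (z ∷ ρ) ≈ c * C (z ∷ ρ)
       same with clean (z ∷ ρ) in e
       ... | false = trans (zeroʳ _) (sym (zeroʳ _))
       ... | true  = *-congʳ (reflexive (≡.cong (λ b → ind (b ∧ head-≥ y (z ∷ ρ))) (linked-Ins {y = y} ja i a<z all″ e)))
     remaining : ind (disj z a) * I ≈ C (z ∷ π) - ind (not N ∨ B) * C (z ∷ π)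
     remaining = begin
       ind (disj z a) * I
         ≈⟨ solve 2 (λ x f → x := (f :+ x) :- f) refl _ (C (a ∷ z ∷ π)) ⟩
       INS a (z ∷ π) C - C (a ∷ z ∷ π)
         ≈⟨ +-cong ih (-‿cong (front (z ∷ π) all′)) ⟩
       C (z ∷ π) - ind (not N ∨ B) * C (z ∷ π) ∎
     linked-y : linked a (y ∷ z ∷ π) ≡ not N ∨ not (disj y a) ∨ B
     linked-y rewrite j | disj-sym a y = ≡.refl
     balance : ∀ N D B w → ind (not N ∨ not D ∨ B) * w + ind D * ((1# - ind (not N ∨ B)) * w) ≈ w
     balance false true  B     w = solve 1 (λ w → :1 :* w :+ :1 :* ((:1 :- :1) :* w) := w) refl w
     balance false false B     w = solve 1 (λ w → :1 :* w :+ :0 :* ((:1 :- :1) :* w) := w) refl w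
     balance true  true  true  w = solve 1 (λ w → :1 :* w :+ :1 :* ((:1 :- :1) :* w) := w) refl w
     balance true  true  false w = solve 1 (λ w → :0 :* w :+ :1 :* ((:1 :- :0) :* w) := w) refl w
     balance true  false B     w = solve 2 (λ w b → :1 :* w :+ :0 :* ((:1 :- b) :* w) := w) refl w (ind B)

  -- A smallest label outside J has to go to the front of the first segment
  -- that contains a cycle meeting it.
  INS-clean-nonJ : ∀ a π → inJ a ≡ false → All (a Fin.<_) π → INS a π C ≈ C π
  INS-clean-nonJ a [] ja _ = reflexive (≡.cong ind (clean-nonJ a [] ja))
  INS-clean-nonJ a (y ∷ π) ja all@(a<y ∷ all′) with true-or-false (inJ y)
  ... | inj₁ j = begin
    C (a ∷ y ∷ π) + ind (disj y a) * INS a π (λ ρ → C (y ∷ ρ))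
      ≈⟨ +-cong (trans (reflexive (≡.cong ind (clean-nonJ a (y ∷ π) ja))) (trans (ind-∧ (linked a (y ∷ π) ∧ head-≥ a (y ∷ π)) _) (*-congʳ (reflexive (≡.cong ind front)))))
           (*-congˡ (INS-cong-Ins a π λ {ρ} i → trans (reflexive (≡.cong ind (≡.trans (clean-J y ρ j) (≡.cong (λ v → head-≥ y v ∧ clean ρ) (J-Ins ja i)))))
             (ind-∧ (head-≥ y (J π)) (clean ρ)))) ⟩
    ind (not (disj y a)) * C (y ∷ π) + ind (disj y a) * INS a π (λ ρ → ind (head-≥ y (J π)) * C ρ)
      ≈⟨ +-congˡ (*-congˡ (trans (INS-* a π _ C) (trans (*-congˡ (INS-clean-nonJ a π ja all′))
           (trans (sym (ind-∧ (head-≥ y (J π)) (clean π))) (reflexive (≡.cong ind (≡.sym (clean-J y π j)))))))) ⟩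
    ind (not (disj y a)) * C (y ∷ π) + ind (disj y a) * C (y ∷ π)
      ≈⟨ complement (disj y a) (C (y ∷ π)) ⟩
    C (y ∷ π) ∎
    where
    front : linked a (y ∷ π) ∧ head-≥ a (y ∷ π) ≡ not (disj y a)
    front rewrite head-≥-minimum a (y ∷ π) all | j | disj-sym a y with disj y a
    ... | true  = ≡.refl
    ... | false = ≡.refl
    complement : ∀ b c → ind (not b) * c + ind b * c ≈ c
    complement true  c = trans (+-cong (zeroˡ _) (*-identityˡ _)) (+-identityˡ _)
    complement false c = trans (+-cong (*-identityˡ _) (zeroˡ _)) (+-identityʳ _)
  INS-clean-nonJ a (y ∷ []) ja all@(a<y ∷ _) | inj₂ j = begin
    C (a ∷ y ∷ []) + ind (disj y a) * C (y ∷ a ∷ [])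
      ≈⟨ +-cong (reflexive (≡.cong ind (≡.trans (clean-nonJ a (y ∷ []) ja) (≡.cong (_∧ clean (y ∷ [])) front))))
           (trans (*-congˡ (ind-false (not-clean-descent j a<y))) (zeroʳ _)) ⟩
    C (y ∷ []) + 0# ≈⟨ +-identityʳ _ ⟩
    C (y ∷ []) ∎
    where
    front : linked a (y ∷ []) ∧ head-≥ a (y ∷ []) ≡ true
    front rewrite head-≥-minimum a (y ∷ []) all | j = ≡.refl
  INS-clean-nonJ a (y ∷ z ∷ π) ja all@(_ ∷ all′) | inj₂ j = INS-clean-step a y z π ja j all (INS-clean-nonJ a (z ∷ π) ja all′)

  INS-clean : ∀ a π → All (a Fin.<_) π → INS a π C ≈ C π
  INS-clean a π all with true-or-false (inJ a)
  ... | inj₁ ja = INS-clean-J a π ja all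
  ... | inj₂ ja = INS-clean-nonJ a π ja all

  push-clean : ∀ us → AllPairs Fin._<_ us → push C us ≈ 1#
  push-clean []       _          = refl
  push-clean (a ∷ us) (a< ∷ inc) = trans (push-cong us λ π p → INS-clean a π (PermP.All-resp-↭ p a<)) (push-clean us inc)

  push-X⋆Y : ∀ us → AllPairs Fin._<_ us → push (X 1 ⋆ Y) us ≈ 1#
  push-X⋆Y us inc = trans (push-cong us λ π _ → X⋆Y π) (push-clean us inc)

  -- For the smallest label `a`, condition (1) asks that it be disjoint from every cycle in front of
  -- it, which is what `INS` requires of the letters that `a` passes.
  ∑-insertAll-cond1 : ∀ a π (F : List (Fin k) → Carrier) → All (a Fin.<_) π →
    ∑ (insertAll a π) (λ ρ → ind (cond1 ρ) * F ρ) ≈ ind (cond1 π) * INS a π F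
  ∑-insertAll-cond1 a []      F _ = +-identityʳ _
  ∑-insertAll-cond1 a (y ∷ π) F a<π@(a<y ∷ all′) = begin
    ind (cond1 (a ∷ y ∷ π)) * F (a ∷ y ∷ π) + ∑ (map (y ∷_) (insertAll a π)) (λ ρ → ind (cond1 ρ) * F ρ)
      ≈⟨ +-cong (*-congʳ (reflexive (≡.cong (λ b → ind (b ∧ cond1 (y ∷ π))) (all-true _ (y ∷ π)
             (All.map (λ {z} a<z → ≡.cong (λ b → not b ∨ disj a z) (<ᵇ-false a<z)) a<π)))))
           (trans (reflexive (∑-map (y ∷_) (insertAll a π) _)) (∑-cong (insertAll a π) λ {ρ} ρ∈ → term ρ (insertAll-↭ a π ρ∈))) ⟩
    ind (cond1 (y ∷ π)) * F (a ∷ y ∷ π) + ∑ (insertAll a π) (λ ρ → (ind (disj y a) * b) * (ind (cond1 ρ) * F (y ∷ ρ)))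
      ≈⟨ +-cong (*-congʳ (ind-∧ (all ok π) (cond1 π))) (trans (∑-*ˡ (insertAll a π) _ _) (*-congˡ (∑-insertAll-cond1 a π (λ ρ → F (y ∷ ρ)) all′))) ⟩
    (b * ind (cond1 π)) * F (a ∷ y ∷ π) + (ind (disj y a) * b) * (ind (cond1 π) * INS a π (λ ρ → F (y ∷ ρ)))
      ≈⟨ solve 5 (λ b p f d i → (b :* p) :* f :+ (d :* b) :* (p :* i) := (b :* p) :* (f :+ d :* i)) refl _ _ _ _ _ ⟩
    (b * ind (cond1 π)) * INS a (y ∷ π) F
      ≈⟨ *-congʳ (ind-∧ (all ok π) (cond1 π)) ⟨
    ind (cond1 (y ∷ π)) * INS a (y ∷ π) F ∎
    where
    ok : Fin k → Bool
    ok z = not (z <ᵇF y) ∨ disj y z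
    b : Carrier
    b = ind (all ok π)
    term : ∀ ρ → a ∷ π ↭ ρ → ind (cond1 (y ∷ ρ)) * F (y ∷ ρ) ≈ (ind (disj y a) * b) * (ind (cond1 ρ) * F (y ∷ ρ))
    term ρ p = begin
      ind (all ok ρ ∧ cond1 ρ) * F (y ∷ ρ)
        ≈⟨ *-congʳ (trans (ind-∧ (all ok ρ) _) (*-congʳ (trans (reflexive (≡.cong ind (≡.trans (≡.sym (all-↭ ok p))
             (≡.cong (λ t → (not t ∨ disj y a) ∧ all ok π) (<ᵇ-true a<y))))) (ind-∧ (disj y a) _)))) ⟩
      ((ind (disj y a) * b) * ind (cond1 ρ)) * F (y ∷ ρ) ≈⟨ *-assoc _ _ _ ⟩
      (ind (disj y a) * b) * (ind (cond1 ρ) * F (y ∷ ρ)) ∎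

  -- The orders with (1) are those reached from the increasing one by commuting disjoint cycles.
  ∑-perms-cond1 : ∀ us (F : List (Fin k) → Carrier) → AllPairs Fin._<_ us →
    ∑ (perms us) (λ π → ind (cond1 π) * F π) ≈ push F us
  ∑-perms-cond1 []       F _          = trans (+-identityʳ _) (*-identityˡ _)
  ∑-perms-cond1 (a ∷ us) F (a< ∷ inc) = begin
    ∑ (concatMap (insertAll a) (perms us)) (λ π → ind (cond1 π) * F π)
      ≈⟨ ∑-concatMap (insertAll a) (perms us) _ ⟩
    ∑ (perms us) (λ π → ∑ (insertAll a π) (λ ρ → ind (cond1 ρ) * F ρ))
      ≈⟨ ∑-cong (perms us) (λ {π} π∈ → ∑-insertAll-cond1 a π F (PermP.All-resp-↭ (perms-↭ us π∈) a<)) ⟩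
    ∑ (perms us) (λ π → ind (cond1 π) * INS a π F)
      ≈⟨ ∑-perms-cond1 us (λ π → INS a π F) inc ⟩
    push (λ π → INS a π F) us ∎

  -- The binomial coefficient of e_μ for an order with 𝒥-subword `ρ`.
  choose : Carrier → List (Fin k) → Carrier
  choose x ρ = binomR (x + natR R (length ρ) - 1# - natR R (descents ρ)) (length ρ)

  descents-≤ : ∀ x ρ → descents (x ∷ ρ) ≤ length ρ
  descents-≤ x []      = z≤n
  descents-≤ x (y ∷ ρ) with y <ᵇF x
  ... | true  = s≤s (descents-≤ y ρ)
  ... | false = ℕP.m≤n⇒m≤1+n (descents-≤ y ρ)

  choose-[] : ∀ x → choose x [] ≈ 1#
  choose-[] x = binom-0 (x + 0# - 1# - 0#)

  -- The first block is empty or starts with `x`. At a descent behind `x` it can only be `x` alone;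
  -- otherwise `x` is prepended to the first block, possibly empty, of a cut of the rest into r + 1
  -- blocks. Both cases add up by Pascal's rule.
  cuts-choose : ∀ r ρ → cuts r ρ ≈ choose (natR R r) ρ
  cuts-choose zero    []      = sym (choose-[] 0#)
  -- A word of length L > 0 has at most L - 1 descents, so the upper entry L - 1 - d is a natural
  -- number below L and the coefficient is zero.
  cuts-choose zero    (x ∷ ρ) = sym (trans (binom-cong (suc (length ρ)) value)
    (binom-natR-0 (length ρ ∸ descents (x ∷ ρ)) (suc (length ρ)) (s≤s (ℕP.m∸n≤m _ (descents (x ∷ ρ))))))
    where
    value : 0# + (1# + natR R (length ρ)) - 1# - natR R (descents (x ∷ ρ)) ≈ natR R (length ρ ∸ descents (x ∷ ρ))
    value = begin
      0# + (1# + natR R (length ρ)) - 1# - natR R (descents (x ∷ ρ))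
        ≈⟨ +-congʳ (+-congʳ (+-congˡ (+-congˡ (trans (reflexive (≡.cong (natR R) (≡.sym (ℕP.m∸n+n≡m (descents-≤ x ρ)))))
             (natR-+ (length ρ ∸ descents (x ∷ ρ)) (descents (x ∷ ρ))))))) ⟩
      0# + (1# + (natR R (length ρ ∸ descents (x ∷ ρ)) + natR R (descents (x ∷ ρ)))) - 1# - natR R (descents (x ∷ ρ))
        ≈⟨ solve 2 (λ a d → :0 :+ (:1 :+ (a :+ d)) :- :1 :- d := a) refl _ _ ⟩
      natR R (length ρ ∸ descents (x ∷ ρ)) ∎
  cuts-choose (suc r) []      = trans (*-identityˡ _) (trans (cuts-choose r []) (trans (choose-[] (natR R r)) (sym (choose-[] (natR R (suc r))))))
  cuts-choose (suc r) (x ∷ []) = begin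
    1# * cuts r (x ∷ []) + 1# * cuts r []
      ≈⟨ +-cong (trans (*-identityˡ _) (cuts-choose r (x ∷ []))) (trans (*-identityˡ _) (trans (cuts-choose r []) (trans (choose-[] (natR R r)) (sym (binom-0 (natR R r)))))) ⟩
    binomR (natR R r + (1# + 0#) - 1# - 0#) 1 + binomR (natR R r) 0
      ≈⟨ +-congʳ (binom-cong 1 (solve 1 (λ r → r :+ (:1 :+ :0) :- :1 :- :0 := r) refl (natR R r))) ⟩
    binomR (natR R r) 1 + binomR (natR R r) 0
      ≈⟨ pascal (natR R r) 0 ⟨
    binomR (natR R r + 1#) 1
      ≈⟨ binom-cong 1 (solve 1 (λ r → r :+ :1 := :1 :+ r :+ (:1 :+ :0) :- :1 :- :0) refl (natR R r)) ⟩
    choose (natR R (suc r)) (x ∷ []) ∎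
  cuts-choose (suc r) (x ∷ y ∷ ρ) = begin
    1# * cuts r (x ∷ y ∷ ρ) + (1# * cuts r (y ∷ ρ) + SP ρ (λ a b → ind (not (y <ᵇF x) ∧ increasing (y ∷ a)) * cuts r b))
      ≈⟨ +-cong (*-identityˡ _) (+-congˡ (trans (SP-cong ρ λ a b → trans (*-congʳ (ind-∧ (not (y <ᵇF x)) _)) (*-assoc _ _ _)) (SP-* ρ _ _))) ⟩
    cuts r (x ∷ y ∷ ρ) + (1# * cuts r (y ∷ ρ) + ind (not (y <ᵇF x)) * SP ρ (λ a b → ind (increasing (y ∷ a)) * cuts r b))
      ≈⟨ +-congʳ (cuts-choose r (x ∷ y ∷ ρ)) ⟩
    choose (natR R r) (x ∷ y ∷ ρ) + (1# * cuts r (y ∷ ρ) + ind (not (y <ᵇF x)) * SP ρ (λ a b → ind (increasing (y ∷ a)) * cuts r b))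
      ≈⟨ cases (cuts-choose r (y ∷ ρ)) (cuts-choose (suc r) (y ∷ ρ)) (y <ᵇF x) ⟩
    choose (natR R (suc r)) (x ∷ y ∷ ρ) ∎
    where
    L : ℕ
    L = length (y ∷ ρ)
    q dd ll : Carrier
    q = natR R r
    dd = natR R (descents (y ∷ ρ))
    ll = natR R L
    cases : cuts r (y ∷ ρ) ≈ choose q (y ∷ ρ) → cuts (suc r) (y ∷ ρ) ≈ choose (1# + q) (y ∷ ρ) → ∀ b →
      binomR (q + (1# + ll) - 1# - natR R ((if b then 1 else 0) ℕ.+ descents (y ∷ ρ))) (suc L)
        + (1# * cuts r (y ∷ ρ) + ind (not b) * SP ρ (λ a b → ind (increasing (y ∷ a)) * cuts r b)) ≈
      binomR (1# + q + (1# + ll) - 1# - natR R ((if b then 1 else 0) ℕ.+ descents (y ∷ ρ))) (suc L)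
    cases ih ih′ true = begin
      binomR (q + (1# + ll) - 1# - (1# + dd)) (suc L) + (1# * cuts r (y ∷ ρ) + 0# * SP ρ (λ a b → ind (increasing (y ∷ a)) * cuts r b))
        ≈⟨ +-cong (binom-cong (suc L) (solve 3 (λ q l d → q :+ (:1 :+ l) :- :1 :- (:1 :+ d) := q :+ l :- :1 :- d) refl q ll dd))
             (trans (+-cong (*-identityˡ _) (zeroˡ _)) (trans (+-identityʳ _) ih)) ⟩
      binomR (q + ll - 1# - dd) (suc L) + binomR (q + ll - 1# - dd) L
        ≈⟨ pascal _ L ⟨
      binomR (q + ll - 1# - dd + 1#) (suc L)
        ≈⟨ binom-cong (suc L) (solve 3 (λ q l d → q :+ l :- :1 :- d :+ :1 := :1 :+ q :+ (:1 :+ l) :- :1 :- (:1 :+ d)) refl q ll dd) ⟩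
      binomR (1# + q + (1# + ll) - 1# - (1# + dd)) (suc L) ∎
    cases ih ih′ false = begin
      binomR (q + (1# + ll) - 1# - dd) (suc L) + (1# * cuts r (y ∷ ρ) + 1# * SP ρ (λ a b → ind (increasing (y ∷ a)) * cuts r b))
        ≈⟨ +-congˡ (trans (+-congˡ (*-identityˡ _)) ih′) ⟩
      binomR (q + (1# + ll) - 1# - dd) (suc L) + binomR (1# + q + ll - 1# - dd) L
        ≈⟨ +-cong (binom-cong (suc L) (solve 3 (λ q l d → q :+ (:1 :+ l) :- :1 :- d := q :+ l :- d) refl q ll dd))
             (binom-cong L (solve 3 (λ q l d → :1 :+ q :+ l :- :1 :- d := q :+ l :- d) refl q ll dd)) ⟩
      binomR (q + ll - dd) (suc L) + binomR (q + ll - dd) L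
        ≈⟨ pascal _ L ⟨
      binomR (q + ll - dd + 1#) (suc L)
        ≈⟨ binom-cong (suc L) (solve 3 (λ q l d → q :+ l :- d :+ :1 := :1 :+ q :+ (:1 :+ l) :- :1 :- d) refl q ll dd) ⟩
      binomR (1# + q + (1# + ll) - 1# - dd) (suc L) ∎

-- Polynomial functions that agree at all natural numbers

module Polynomials (K : QAlgebra) (m : ℕ) where
  open QAlgebra K
  open CommutativeRing R
  open import Relation.Binary.Reasoning.Setoid setoid
  open RingSolving R
  open Series K m using (binomR; falling; invFact)
  open Sums ring

  eval : List Carrier → Carrier → Carrier
  eval []       x = 0#
  eval (c ∷ cs) x = c + x * eval cs x

  Polynomial : (Carrier → Carrier) → Set
  Polynomial p = ∃ λ cs → ∀ x → p x ≈ eval cs x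

  polynomial-cong : ∀ {p q} → (∀ x → p x ≈ q x) → Polynomial q → Polynomial p
  polynomial-cong e (cs , eq) = cs , λ x → trans (e x) (eq x)

  polynomial-const : ∀ c → Polynomial (λ _ → c)
  polynomial-const c = c ∷ [] , λ x → sym (trans (+-congˡ (zeroʳ x)) (+-identityʳ c))

  polynomial-+ : ∀ {p q} → Polynomial p → Polynomial q → Polynomial (λ x → p x + q x)
  polynomial-+ (cs , e) (ds , e′) = add cs ds , λ x → trans (+-cong (e x) (e′ x)) (eval-add cs ds x)
    where
    add : List Carrier → List Carrier → List Carrier
    add []       ds       = ds
    add (c ∷ cs) []       = c ∷ cs
    add (c ∷ cs) (d ∷ ds) = c + d ∷ add cs ds
    eval-add : ∀ cs ds x → eval cs x + eval ds x ≈ eval (add cs ds) x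
    eval-add []       ds       x = +-identityˡ _
    eval-add (c ∷ cs) []       x = +-identityʳ _
    eval-add (c ∷ cs) (d ∷ ds) x = trans
      (solve 5 (λ c d x p q → (c :+ x :* p) :+ (d :+ x :* q) := (c :+ d) :+ x :* (p :+ q)) refl _ _ _ _ _)
      (+-congˡ (*-congˡ (eval-add cs ds x)))

  polynomial-* : ∀ {p} c → Polynomial p → Polynomial (λ x → c * p x)
  polynomial-* c (cs , e) = map (c *_) cs , λ x → trans (*-congˡ (e x)) (eval-scale cs x)
    where
    eval-scale : ∀ cs x → c * eval cs x ≈ eval (map (c *_) cs) x
    eval-scale []       x = zeroʳ c
    eval-scale (d ∷ cs) x = trans (solve 4 (λ c d x p → c :* (d :+ x :* p) := c :* d :+ x :* (c :* p)) refl _ _ _ _)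
      (+-congˡ (*-congˡ (eval-scale cs x)))

  polynomial-x : ∀ {p} → Polynomial p → Polynomial (λ x → x * p x)
  polynomial-x (cs , e) = 0# ∷ cs , λ x → trans (*-congˡ (e x)) (sym (+-identityˡ _))

  polynomial-∑ : ∀ {A : Set} (xs : List A) {f : A → Carrier → Carrier} → (∀ a → Polynomial (f a)) →
    Polynomial (λ x → ∑ xs (λ a → f a x))
  polynomial-∑ []       e = [] , λ _ → refl
  polynomial-∑ (a ∷ xs) e = polynomial-+ (e a) (polynomial-∑ xs e)

  polynomial-falling : ∀ c l → Polynomial (λ x → falling (x + c) l)
  polynomial-falling c zero    = polynomial-const 1#
  polynomial-falling c (suc l) = polynomial-cong
    (λ x → solve 4 (λ f x c n → f :* ((x :+ c) :- n) := x :* f :+ (c :- n) :* f) refl _ x c (natR R l))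
    (polynomial-+ (polynomial-x (polynomial-falling c l)) (polynomial-* (c - natR R l) (polynomial-falling c l)))

  polynomial-binom : ∀ c l → Polynomial (λ x → binomR (x + c) l)
  polynomial-binom c l = polynomial-cong (λ x → *-comm _ _) (polynomial-* (invFact l) (polynomial-falling c l))

  -- Horner's scheme: `quotient a cs` is the quotient of `c ∷ cs` by x - a for every constant term
  -- `c`.
  quotient : Carrier → List Carrier → List Carrier
  quotient a []       = []
  quotient a (c ∷ cs) = eval (c ∷ cs) a ∷ quotient a cs

  length-quotient : ∀ a cs → length (quotient a cs) ≡ length cs
  length-quotient a []       = ≡.refl
  length-quotient a (c ∷ cs) = ≡.cong suc (length-quotient a cs)

  factor : ∀ a c cs x → eval (c ∷ cs) x ≈ eval (c ∷ cs) a + (x - a) * eval (quotient a cs) x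
  factor a c []       x = solve 3 (λ c x a → c :+ x :* :0 := c :+ a :* :0 :+ (x :- a) :* :0) refl c x a
  factor a c (d ∷ cs) x = begin
    c + x * eval (d ∷ cs) x
      ≈⟨ +-congˡ (*-congˡ (factor a d cs x)) ⟩
    c + x * (eval (d ∷ cs) a + (x - a) * eval (quotient a cs) x)
      ≈⟨ solve 5 (λ c x a e q → c :+ x :* (e :+ (x :- a) :* q) := (c :+ a :* e) :+ (x :- a) :* (e :+ x :* q)) refl c x a _ _ ⟩
    eval (c ∷ d ∷ cs) a + (x - a) * eval (quotient a (d ∷ cs)) x ∎

  natR-cancel : ∀ k x → natR R (suc k) * x ≈ 0# → x ≈ 0#
  natR-cancel k x e = begin
    x                                   ≈⟨ *-identityˡ x ⟨
    1# * x                              ≈⟨ *-congʳ (invSuc-inv k) ⟨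
    natR R (suc k) * invSuc k * x       ≈⟨ solve 3 (λ n i x → n :* i :* x := i :* (n :* x)) refl _ _ _ ⟩
    invSuc k * (natR R (suc k) * x)     ≈⟨ trans (*-congˡ e) (zeroʳ _) ⟩
    0#                                  ∎

  -- Division by x - a leaves a shorter list that still vanishes at a + 1, a + 2, ..., because x - a
  -- is a positive integer there, hence invertible in `R` even in the presence of zero divisors.
  eval-0 : ∀ N cs a → length cs ≡ N → (∀ j → eval cs (natR R (a ℕ.+ j)) ≈ 0#) → ∀ x → eval cs x ≈ 0#
  eval-0 zero    []       a eq z x = refl
  eval-0 (suc N) (c ∷ cs) a eq z x = begin
    eval (c ∷ cs) x
      ≈⟨ factor (natR R a) c cs x ⟩
    eval (c ∷ cs) (natR R a) + (x - natR R a) * eval ds x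
      ≈⟨ +-cong root (*-congˡ (eval-0 N ds (suc a) (≡.trans (length-quotient _ cs) (ℕP.suc-injective eq)) next x)) ⟩
    0# + (x - natR R a) * 0#
      ≈⟨ trans (+-identityˡ _) (zeroʳ _) ⟩
    0# ∎
    where
    ds = quotient (natR R a) cs
    root : eval (c ∷ cs) (natR R a) ≈ 0#
    root = ≡.subst (λ b → eval (c ∷ cs) (natR R b) ≈ 0#) (ℕP.+-identityʳ a) (z 0)
    next : ∀ j → eval ds (natR R (suc a ℕ.+ j)) ≈ 0#
    next j = natR-cancel j _ (begin
      natR R (suc j) * eval ds y
        ≈⟨ *-congʳ (trans (solve 2 (λ a j → j := (a :+ j) :- a) refl (natR R a) (natR R (suc j)))
             (+-congʳ (trans (sym (natR-+ a (suc j))) (reflexive (≡.cong (natR R) (ℕP.+-suc a j)))))) ⟩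
      (y - natR R a) * eval ds y
        ≈⟨ trans (+-congʳ root) (+-identityˡ _) ⟨
      eval (c ∷ cs) (natR R a) + (y - natR R a) * eval ds y
        ≈⟨ factor (natR R a) c cs y ⟨
      eval (c ∷ cs) y
        ≈⟨ ≡.subst (λ b → eval (c ∷ cs) (natR R b) ≈ 0#) (ℕP.+-suc a j) (z (suc j)) ⟩
      0# ∎)
      where y = natR R (suc a ℕ.+ j)

  polynomial-≈ : ∀ {p q} → Polynomial p → Polynomial q → (∀ j → p (natR R j) ≈ q (natR R j)) → ∀ x → p x ≈ q x
  polynomial-≈ {p} {q} P Q e x = begin
    p x                     ≈⟨ solve 2 (λ p q → p := (p :+ :- :1 :* q) :+ q) refl _ _ ⟩
    (p x + - 1# * q x) + q x  ≈⟨ +-congʳ (trans (proj₂ D x) (eval-0 _ (proj₁ D) 0 ≡.refl (λ j → trans (sym (proj₂ D (natR R j)))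
                                 (trans (+-congʳ (e j)) (solve 1 (λ q → q :+ :- :1 :* q := :0) refl _))) x)) ⟩
    0# + q x                ≈⟨ +-identityˡ _ ⟩
    q x                     ∎
    where
    D : Polynomial (λ x → p x + - 1# * q x)
    D = polynomial-+ P (polynomial-* (- 1#) Q)

-- O-sequences as sorted balanced words

module SortedWords (K : QAlgebra) (m : ℕ) where
  open Series K m using (Word; count; sortW; mkWord)
  open Walks K m using (Balanced; δ; count-∷)
  open Invariance K m using (count-++; count-↭)
  open CycleBlocks K m using (count-∈; ∈-count)
  open NormalForm K m using (Sorted)

  Ascending : List (Fin m) → Set
  Ascending = AllPairs Fin._≤_

  count-replicate : ∀ h c h′ → count h (replicate c h′) ≡ (if ⌊ h FinP.≟ h′ ⌋ then c else 0)
  count-replicate h zero    h′ with h FinP.≟ h′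
  ... | yes _ = ≡.refl
  ... | no  _ = ≡.refl
  count-replicate h (suc c) h′ with h FinP.≟ h′ | count-replicate h c h′
  ... | yes _ | e = ≡.cong suc e
  ... | no  _ | e = e

  count-sortW : ∀ h μ → count h (sortW μ) ≡ count h μ
  count-sortW h μ = once (allFin m) (MemP.∈-allFin h) (UniqueP.allFin⁺ m)
    where
    block : Fin m → List (Fin m)
    block h = replicate (count h μ) h
    other : ∀ {h′} → h ≢ h′ → count h (block h′) ≡ 0
    other {h′} ne = ≡.trans (count-replicate h (count h′ μ) h′) (≡.cong (λ b → if b then count h′ μ else 0) (⌊⌋-no (h FinP.≟ h′) ne))
    none : ∀ hs → All (h ≢_) hs → count h (concatMap block hs) ≡ 0
    none []        _          = ≡.refl
    none (h′ ∷ hs) (ne ∷ all) = ≡.trans (count-++ h (block h′) _) (≡.cong₂ ℕ._+_ (other ne) (none hs all))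
    once : ∀ hs → h ∈ hs → Unique hs → count h (concatMap block hs) ≡ count h μ
    once (_ ∷ hs) (here ≡.refl) (h∉ ∷ u) = ≡.trans (count-++ h (block h) _) (≡.trans (≡.cong₂ ℕ._+_
      (≡.trans (count-replicate h (count h μ) h) (≡.cong (λ b → if b then count h μ else 0) (⌊⌋-yes (h FinP.≟ h) ≡.refl)))
      (none hs h∉)) (ℕP.+-identityʳ _))
    once (h′ ∷ hs) (there h∈) (h′∉ ∷ u) = ≡.trans (count-++ h (block h′) _)
      (≡.cong₂ ℕ._+_ (other λ { ≡.refl → All.lookup h′∉ h∈ ≡.refl }) (once hs h∈ u))

  sortW-ascending : ∀ μ → Ascending (sortW μ)
  sortW-ascending μ = AllPairsP.concat⁺
    (AllP.map⁺ (All.tabulate λ {h} _ → constant (count h μ) h))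
    (AllPairsP.map⁺ (AllPairsP.tabulate⁺-< λ {i} {j} i<j → All.map (λ { ≡.refl → AllP.replicate⁺ (count j μ) (ℕP.<⇒≤ i<j) }) (AllP.replicate⁺ {P = i ≡_} (count i μ) ≡.refl)))
    where
    constant : ∀ c h → Ascending (replicate c h)
    constant zero    h = []
    constant (suc c) h = AllP.replicate⁺ c FinP.≤-refl ∷ constant c h

  count⇒↭ : ∀ xs ys → (∀ h → count h xs ≡ count h ys) → xs ↭ ys
  count⇒↭ []       []       e = Perm.refl
  count⇒↭ []       (y ∷ ys) e = ⊥-elim (∈-count y (y ∷ ys) (here ≡.refl) (≡.sym (e y)))
  count⇒↭ (x ∷ xs) ys       e with MemP.∈-∃++ (count-∈ x ys λ z → ∈-count x (x ∷ xs) (here ≡.refl) (≡.trans (e x) z))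
  ... | a , b , ≡.refl = Perm.trans (Perm.prep x (count⇒↭ xs (a ++ b) rest)) (Perm.↭-sym (PermP.shift x a b))
    where
    rest : ∀ h → count h xs ≡ count h (a ++ b)
    rest h = ℕP.+-cancelˡ-≡ (δ h x) _ _ (≡.trans (≡.sym (count-∷ h x xs)) (≡.trans (e h)
      (≡.trans (count-↭ h (PermP.shift x a b)) (count-∷ h x (a ++ b)))))

  ascending-unique : ∀ {xs ys} → Ascending xs → Ascending ys → (∀ h → count h xs ≡ count h ys) → xs ≡ ys
  ascending-unique {[]}     {[]}     _ _ e = ≡.refl
  ascending-unique {[]}     {y ∷ ys} _ _ e = ⊥-elim (∈-count y (y ∷ ys) (here ≡.refl) (≡.sym (e y)))
  ascending-unique {x ∷ xs} {[]}     _ _ e = ⊥-elim (∈-count x (x ∷ xs) (here ≡.refl) (e x))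
  ascending-unique {x ∷ xs} {y ∷ ys} (x≤ ∷ σ) (y≤ ∷ τ) e with FinP.≤-antisym
      (least x≤ (count-∈ y (x ∷ xs) λ z → ∈-count y (y ∷ ys) (here ≡.refl) (≡.trans (≡.sym (e y)) z)))
      (least y≤ (count-∈ x (y ∷ ys) λ z → ∈-count x (x ∷ xs) (here ≡.refl) (≡.trans (e x) z)))
    where
    least : ∀ {z w : Fin m} {zs} → All (z Fin.≤_) zs → w ∈ z ∷ zs → z Fin.≤ w
    least all (here ≡.refl) = FinP.≤-refl
    least all (there w∈)    = All.lookup all w∈
  ... | ≡.refl = ≡.cong (x ∷_) (ascending-unique σ τ λ h → ℕP.+-cancelˡ-≡ (δ h x) _ _
      (≡.trans (≡.sym (count-∷ h x xs)) (≡.trans (e h) (count-∷ h x ys))))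

  map-proj₁-zip : ∀ {A B : Set} (xs : List A) (ys : List B) → length xs ≡ length ys → map proj₁ (zip xs ys) ≡ xs
  map-proj₁-zip []       []       e = ≡.refl
  map-proj₁-zip (x ∷ xs) (y ∷ ys) e = ≡.cong (x ∷_) (map-proj₁-zip xs ys (ℕP.suc-injective e))

  zip-proj : ∀ (w : Word) → zip (map proj₁ w) (map proj₂ w) ≡ w
  zip-proj []      = ≡.refl
  zip-proj (a ∷ w) = ≡.cong (a ∷_) (zip-proj w)

  -- Balance makes the rows a rearrangement of the end heights, and sortedness leaves only the
  -- non-decreasing one.
  sorted-balanced : ∀ {w} → Sorted w → Balanced w → mkWord (sortW (map proj₂ w)) (map proj₂ w) ≡ w
  sorted-balanced {w} σ b = ≡.trans (≡.cong (λ v → zip v (map proj₂ w)) (≡.sym (ascending-unique (AllPairsP.map⁺ σ) (sortW-ascending (map proj₂ w))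
    λ h → ≡.trans (b h) (≡.sym (count-sortW h (map proj₂ w)))))) (zip-proj w)

  module _ {w : Word} (e : mkWord (sortW (map proj₂ w)) (map proj₂ w) ≡ w) where

    private
      rows≡ : map proj₁ w ≡ sortW (map proj₂ w)
      rows≡ = ≡.trans (≡.cong (map proj₁) (≡.sym e)) (map-proj₁-zip (sortW (map proj₂ w)) (map proj₂ w)
        (PermP.↭-length (count⇒↭ (sortW (map proj₂ w)) (map proj₂ w) λ h → count-sortW h (map proj₂ w))))

    mkWord-sorted : Sorted w
    mkWord-sorted = AllPairsP.map⁻ (≡.subst Ascending (≡.sym rows≡) (sortW-ascending (map proj₂ w)))

    mkWord-balanced : Balanced w
    mkWord-balanced h = ≡.trans (≡.cong (count h) rows≡) (count-sortW h (map proj₂ w))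

-- Comparison of the two sides

module Theorem (K : QAlgebra) (n m : ℕ) (n<m : n < m) where
  open QAlgebra K using (R)
  open CommutativeRing R
  open import Relation.Binary.Reasoning.Setoid setoid
  open Series K m hiding (ind)
  open Matrices n n<m using (lhs)
  open PushSeries K m
  open Powers K m using (power-nat)
  open Walks K m
  open Sylvester K m using (outermost; outermost-inverse; det-reduced; det-reduced-1)
  open LeftHandSide K m n n<m
  open Invariance K m
  open NormalForm K m
  open Cycles K m
  open SortedWords K m
  open Polynomials K m
  open Sums ring

  s : Ser
  s = one P.- Z

  s-0 : s [] ≈ 0#
  s-0 = trans (+-congˡ (-‿cong (det-reduced-1 inner outer inner++outer))) (-‿inverseʳ 1#)

  good-Z : Good Z
  good-Z = good-≋ (P.sym (det-reduced inner outer inner++outer))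
    (good-⊛ (good-closed inner) (good-D (allFin m) [] (ListP.++-identityʳ _)))

  good-s : Good s
  good-s = good-sub good-one good-Z

  g : Ser
  g = outermost inner outer inner++outer

  good-g : Good g
  good-g = good-⊛ (good-closed (allFin m)) (good-D inner outer inner++outer)

  g-inverse : g ⊛ (one P.- s) ≋ one
  g-inverse = P.trans (P.*-congˡ {g} λ w → solve 2 (λ o z → o :- (o :- z) := z) refl (one w) (Z w)) (outermost-inverse inner outer inner++outer)
    where open RingSolving R using (solve; _:=_; _:-_)

  polynomial-power : ∀ w → Polynomial (λ β → power β s w)
  polynomial-power w = polynomial-∑ (upTo (suc (length w))) λ r → polynomial-cong
    (λ β → trans (*-congʳ (Binomial.binom-cong K m r (+-assoc _ _ _))) (*-comm _ _))
    (polynomial-* ((s ⊛^ r) w) (polynomial-binom (natR R r - 1#) r))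

  module _ {w : Word} (e : mkWord (sortW (map proj₂ w)) (map proj₂ w) ≡ w) where

    private
      μ : List (Fin m)
      μ = map proj₂ w
      open Coeff n μ using (k; l; cyc; cond1; d) renaming (e to coefficient)
      module Lb = Labels K m n n<m μ
      open LabelWords K m n μ Lb.disj-sym using (J; X; X-0; X-suc; Y; valid)
      open LabelInsertions K m n μ Lb.disj-sym using (push-Y; push-X⋆Y; ∑-perms-cond1; cuts-choose)
      open Permutations K m using (perms-↭)

      spec : All SimpleCycle (cycles μ) × concat (cycles μ) ~ w
      spec = cycles-spec μ e (ListP.length-map proj₂ w) (mkWord-balanced e)

      simple : ∀ p → SimpleCycle (cyc p)
      simple p = All.lookup (proj₁ spec) (MemP.∈-lookup p)

      word-all : Lb.word (allFin k) ≡ concat (cycles μ)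
      word-all = ≡.cong concat (≡.trans (ListP.map-tabulate (λ p → p) cyc) (ListP.tabulate-lookup (cycles μ)))

      increasing-split : ∀ {S T us : List (Fin k)} → Interleaving S T us → AllPairs Fin._<_ us → AllPairs Fin._<_ S × AllPairs Fin._<_ T
      increasing-split []        []          = [] , []
      increasing-split (consˡ i) (x< ∷ inc) with increasing-split i inc
      ... | a , b = CycleBlocks.All-interleavingˡ K m i x< ∷ a , b
      increasing-split (consʳ i) (x< ∷ inc) with increasing-split i inc
      ... | a , b = a , CycleBlocks.All-interleavingˡ K m (Int.swap i) x< ∷ b

      increasing : AllPairs Fin._<_ (allFin k)
      increasing = AllPairsP.tabulate⁺-< λ i<j → i<j

      -- Condition (1) turns the sum over permutations into the projection `push`, and the binomial
      -- coefficient becomes the number of cuts into `r` blocks.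
      coefficient-nat : ∀ r → coefficient (natR R r) ≈ Lb.H.push (X r) (allFin k)
      coefficient-nat r = trans (∑-cong (perms (allFin k)) λ {π} π∈ → term π (perms-↭ (allFin k) π∈)) (∑-perms-cond1 (allFin k) (X r) increasing)
        where
        if-ind : ∀ b (x : Carrier) → (if b then x else 0#) ≈ ind b * x
        if-ind true  x = sym (*-identityˡ x)
        if-ind false x = sym (zeroˡ x)
        term : ∀ π → allFin k ↭ π →
          (if cond1 π ∧ valid π then binomR (natR R r + natR R l - 1# - natR R (d π)) l else 0#) ≈ ind (cond1 π) * X r π
        term π p = begin
          (if cond1 π ∧ valid π then binomR (natR R r + natR R l - 1# - natR R (d π)) l else 0#)
            ≈⟨ trans (if-ind (cond1 π ∧ valid π) _) (trans (*-congʳ (ind-∧ (cond1 π) (valid π))) (*-assoc _ _ _)) ⟩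
          ind (cond1 π) * (ind (valid π) * binomR (natR R r + natR R l - 1# - natR R (d π)) l)
            ≈⟨ *-congˡ (*-congˡ (trans (reflexive (≡.cong (λ l → binomR (natR R r + natR R l - 1# - natR R (d π)) l)
                 (PermP.↭-length (PermP.filter-↭ (λ p → Coeff.inJ n μ p Bool.≟ true) p)))) (sym (cuts-choose r (J π))))) ⟩
          ind (cond1 π) * X r π ∎

      polynomial-coefficient : Polynomial coefficient
      polynomial-coefficient = polynomial-∑ (perms (allFin k)) λ π → summand π (cond1 π ∧ valid π)
        where
        summand : ∀ π b → Polynomial (λ β → if b then binomR (β + natR R l - 1# - natR R (d π)) l else 0#)
        summand π false = polynomial-const 0#
        summand π true  = polynomial-cong (λ β → Binomial.binom-cong K m l (trans (+-congʳ (+-assoc _ _ _)) (+-assoc _ _ _)))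
          (polynomial-binom (natR R l - 1# - natR R (d π)) l)

      power-coefficient-nat : ∀ r → power (natR R r) s w ≈ coefficient (natR R r)
      power-coefficient-nat r = begin
        power (natR R r) s w                ≈⟨ power-nat s s-0 g-inverse r w ⟩
        (g ⊛^ r) w                          ≈⟨ proj₁ (good-⊛^ good-g r) (proj₂ spec) ⟨
        (g ⊛^ r) (concat (cycles μ))        ≡⟨ ≡.cong (g ⊛^ r) word-all ⟨
        (g ⊛^ r) (Lb.word (allFin k))       ≈⟨ Lb.outermost-powers simple (X 1) Y (AllPairs Fin._<_) increasing-split push-Y push-X⋆Y
                                                 X X-0 X-suc r (allFin k) increasing ⟩
        Lb.H.push (X r) (allFin k)          ≈⟨ coefficient-nat r ⟨
        coefficient (natR R r)              ∎

    power-coefficient : ∀ β → power β s w ≈ Coeff.e n (map proj₂ w) β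
    power-coefficient = polynomial-≈ (polynomial-power w) polynomial-coefficient power-coefficient-nat

  -- A sorted word that is not an o-sequence is not balanced, so the power vanishes on it; on
  -- unsorted words the normal form is zero.
  normalForm-lhs : ∀ β → normalForm (lhs β) ≋ rhs n β
  normalForm-lhs β w = trans (*-congˡ (push-lhs β w)) (compare (mkWord (sortW (map proj₂ w)) (map proj₂ w) ≟W w) ≡.refl)
    where
    compare : ∀ (dec : Dec (mkWord (sortW (map proj₂ w)) (map proj₂ w) ≡ w)) →
      (mkWord (sortW (map proj₂ w)) (map proj₂ w) ==W w) ≡ ⌊ dec ⌋ →
      ind ⌊ sorted? w ⌋ * power β s w ≈ rhs n β w
    compare (yes e) eq rewrite eq = trans (*-congʳ (ind-yes (sorted? w) (mkWord-sorted e))) (trans (*-identityˡ _) (power-coefficient e β))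
    compare (no ¬e) eq rewrite eq with sorted? w
    ... | no _  = zeroˡ _
    ... | yes σ = trans (*-identityˡ _) (proj₂ (good-power β good-s) w λ b → ¬e (sorted-balanced σ b))

theorem11p1 : (K : QAlgebra) (n m : ℕ) → 1 ≤ n → (n<m : n < m) →
    (β : CommutativeRing.Carrier (QAlgebra.R K)) →
    Series._≈CF_ K m (Series.Matrices.lhs K m n n<m β) (Series.rhs K m n β)
theorem11p1 K n m _ n<m β = NormalForm.≈CF-normalForm K m (Theorem.normalForm-lhs K n m n<m β)
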